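{- Let $G$ be an unweighted graph (loops allowed, no parallel edges) with no isolated vertices, with adjacency matrix $A_G$ (diagonal entry $1$ at looped vertices), and let $Q_G(\mathbf{x})=\tfrac12\mathbf{x}^TA_G\mathbf{x}$. The following are equivalent: (1) $G$ is antiferromagnetic; (2) $Q_G$ is Lorentzian; (3) $\operatorname{supp}(Q_G)$ is M-convex; (4) there exist disjoint vertex sets $V_1,V_2$ with $V_1\cup V_2=V(G)$ such that $V_1$ induces a complete multipartite graph (with no loops) and $V_2$ consists of looped vertices each adjacent to all vertices of $G$.
   Context: A symmetric nonnegative matrix (or the corresponding graph) is antiferromagnetic if it has at most one positive eigenvalue, counted with multiplicity. The support $\operatorname{supp}(f)\subseteq\mathbb{N}_0^n$ of a polynomial $f$ is the set of exponent vectors of monomials with nonzero coefficient. A set $S\subseteq\mathbb{N}_0^n$ is M-convex if for all $\mathbf{a},\mathbf{b}\in S$ and every $i$ with $a_i>b_i$ there is $j$ with $a_j<b_j$ and $\mathbf{a}-\mathbf{e}_i+\mathbf{e}_j\in S$. A homogeneous polynomial $f$ with nonnegative coefficients of degree $d\ge2$ is Lorentzian if: for $d=2$, its Hessian $(\partial_i\partial_jf)_{i,j}$ has at most one positive eigenvalue; for $d>2$, every $\partial_if$ is Lorentzian and $\operatorname{supp}(f)$ is M-convex. -}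

module Defs where

open import Algebra.Bundles using (RawMonoid)
open import Data.Bool.Base using (Bool; T; if_then_else_)
open import Data.Empty using (⊥)
open import Data.Fin.Base using (Fin)
open import Data.Fin.Subset using (Subset; _∈_; _∩_; _∪_; ⊤; Empty)
open import Data.Nat.Base as ℕ using (ℕ; zero; suc; pred)
import Data.Nat.Properties as ℕₚ
open import Data.Product.Base using (Σ-syntax; ∃-syntax; _×_; _,_; proj₁; proj₂)
open import Data.Rational.Base as ℚ using (ℚ; 0ℚ; 1ℚ; ½; ∣_∣)
import Data.Rational.Properties as ℚₚ
open import Data.Rational.Solver using (module +-*-Solver)
open import Data.Vec.Base as Vec using (Vec; lookup; updateAt; replicate)
open import Data.Vec.Functional using (Vector)
import Data.Vec.Properties as Vecₚ
open import Function.Bundles using (_⇔_)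
open import Level using (0ℓ)
open import Relation.Binary.PropositionalEquality
  using (_≡_; _≢_; refl; sym; trans; cong; cong₂; subst; subst₂)
open import Relation.Nullary.Decidable.Core using (⌊_⌋)
open import Relation.Nullary.Negation.Core using (¬_)

------------------------------------------------------------------------
-- Rational estimates used to construct the real numbers

private
  abstract
    half-sum : ∀ ε → ε ℚ.* ½ ℚ.+ ε ℚ.* ½ ≡ ε
    half-sum ε = trans (sym (ℚₚ.*-distribˡ-+ ε ½ ½)) (ℚₚ.*-identityʳ ε)

    half-pos : ∀ {ε} → 0ℚ ℚ.< ε → 0ℚ ℚ.< ε ℚ.* ½
    half-pos {ε} 0<ε =
      subst (ℚ._< ε ℚ.* ½) (ℚₚ.*-zeroˡ ½) (ℚₚ.*-monoˡ-<-pos ½ 0<ε)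

    +-split : ∀ a b c d →
              (a ℚ.+ b) ℚ.- (c ℚ.+ d) ≡ (a ℚ.- c) ℚ.+ (b ℚ.- d)
    +-split = solve 4 (λ a b c d →
      (a :+ b) :- (c :+ d) := (a :- c) :+ (b :- d)) refl
      where open +-*-Solver

    *-split : ∀ a b c d →
              a ℚ.* b ℚ.- c ℚ.* d ≡ a ℚ.* (b ℚ.- d) ℚ.+ (a ℚ.- c) ℚ.* d
    *-split = solve 4 (λ a b c d →
      a :* b :- c :* d := a :* (b :- d) :+ (a :- c) :* d) refl
      where open +-*-Solver

    diff-cancel : ∀ p q → (p ℚ.- q) ℚ.+ q ≡ p
    diff-cancel = solve 2 (λ p q → (p :- q) :+ q := p) refl
      where open +-*-Solver

    ∣p-p∣<ε : ∀ p {ε} → 0ℚ ℚ.< ε → ∣ p ℚ.- p ∣ ℚ.< ε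
    ∣p-p∣<ε p {ε} 0<ε = subst (ℚ._< ε) (sym (cong ∣_∣ (ℚₚ.+-inverseʳ p))) 0<ε

    *-mono-small : ∀ {x y c δ} → 0ℚ ℚ.< c → 0ℚ ℚ.≤ y → x ℚ.< c → y ℚ.< δ →
                   x ℚ.* y ℚ.≤ c ℚ.* δ
    *-mono-small {x} {y} {c} {δ} 0<c 0≤y x<c y<δ = ℚₚ.≤-trans
      (ℚₚ.*-monoʳ-≤-nonNeg y {{ℚ.nonNegative 0≤y}} (ℚₚ.<⇒≤ x<c))
      (ℚₚ.<⇒≤ (ℚₚ.*-monoʳ-<-pos c {{ℚ.positive 0<c}} y<δ))

    half<ε : ∀ {ε} → 0ℚ ℚ.< ε → ε ℚ.* ½ ℚ.< ε
    half<ε {ε} 0<ε = subst₂ ℚ._<_ (ℚₚ.+-identityʳ (ε ℚ.* ½)) (half-sum ε)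
      (ℚₚ.+-monoʳ-< (ε ℚ.* ½) (half-pos 0<ε))

    +-close : ∀ a b c d {ε} →
              ∣ a ℚ.- c ∣ ℚ.< ε ℚ.* ½ → ∣ b ℚ.- d ∣ ℚ.< ε ℚ.* ½ →
              ∣ (a ℚ.+ b) ℚ.- (c ℚ.+ d) ∣ ℚ.< ε
    +-close a b c d {ε} p q = ℚₚ.≤-<-trans
      (subst (ℚ._≤ ∣ a ℚ.- c ∣ ℚ.+ ∣ b ℚ.- d ∣) (cong ∣_∣ (sym (+-split a b c d)))
             (ℚₚ.∣p+q∣≤∣p∣+∣q∣ (a ℚ.- c) (b ℚ.- d)))
      (subst (∣ a ℚ.- c ∣ ℚ.+ ∣ b ℚ.- d ∣ ℚ.<_) (half-sum ε) (ℚₚ.+-mono-< p q))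

    *-close : ∀ a b c d {B C δ η ε} → 0ℚ ℚ.< B → 0ℚ ℚ.< C →
              (B ℚ.+ C) ℚ.* δ ≡ η → η ℚ.< ε →
              ∣ a ∣ ℚ.< B → ∣ d ∣ ℚ.< C →
              ∣ a ℚ.- c ∣ ℚ.< δ → ∣ b ℚ.- d ∣ ℚ.< δ →
              ∣ a ℚ.* b ℚ.- c ℚ.* d ∣ ℚ.< ε
    *-close a b c d {B} {C} {δ} {η} {ε} 0<B 0<C eq η<ε a<B d<C p q =
      ℚₚ.≤-<-trans (ℚₚ.≤-trans step₁ (ℚₚ.+-mono-≤ step₂ step₃))
                   (subst (ℚ._< ε) (trans (sym eq) (ℚₚ.*-distribʳ-+ δ B C)) η<ε)
      where
      step₁ : ∣ a ℚ.* b ℚ.- c ℚ.* d ∣ ℚ.≤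
              ∣ a ∣ ℚ.* ∣ b ℚ.- d ∣ ℚ.+ ∣ a ℚ.- c ∣ ℚ.* ∣ d ∣
      step₁ = subst₂ ℚ._≤_
        (cong ∣_∣ (sym (*-split a b c d)))
        (cong₂ ℚ._+_ (ℚₚ.∣p*q∣≡∣p∣*∣q∣ a (b ℚ.- d))
                     (ℚₚ.∣p*q∣≡∣p∣*∣q∣ (a ℚ.- c) d))
        (ℚₚ.∣p+q∣≤∣p∣+∣q∣ (a ℚ.* (b ℚ.- d)) ((a ℚ.- c) ℚ.* d))

      step₂ : ∣ a ∣ ℚ.* ∣ b ℚ.- d ∣ ℚ.≤ B ℚ.* δ
      step₂ = *-mono-small 0<B (ℚₚ.0≤∣p∣ (b ℚ.- d)) a<B q

      step₃ : ∣ a ℚ.- c ∣ ℚ.* ∣ d ∣ ℚ.≤ C ℚ.* δ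
      step₃ = subst (ℚ._≤ C ℚ.* δ) (ℚₚ.*-comm ∣ d ∣ ∣ a ℚ.- c ∣)
                (*-mono-small 0<C (ℚₚ.0≤∣p∣ (a ℚ.- c)) d<C p)

------------------------------------------------------------------------
-- The real numbers, as Cauchy sequences of rationals

Cauchy : (ℕ → ℚ) → Set
Cauchy s = ∀ ε → 0ℚ ℚ.< ε →
           ∃[ N ] (∀ m n → N ℕ.≤ m → N ℕ.≤ n → ∣ s m ℚ.- s n ∣ ℚ.< ε)

record ℝ : Set where
  constructor mkℝ
  field
    seq      : ℕ → ℚ
    isCauchy : Cauchy seq

open ℝ public

infix  4 _≈_ _<_ _≤_
infixl 6 _+_
infixl 7 _*_

_≈_ : ℝ → ℝ → Set
x ≈ y = ∀ ε → 0ℚ ℚ.< ε →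
        ∃[ N ] (∀ n → N ℕ.≤ n → ∣ seq x n ℚ.- seq y n ∣ ℚ.< ε)

_<_ : ℝ → ℝ → Set
x < y = Σ[ ε ∈ ℚ ] 0ℚ ℚ.< ε ×
        (∃[ N ] (∀ n → N ℕ.≤ n → seq x n ℚ.+ ε ℚ.< seq y n))

_≤_ : ℝ → ℝ → Set
x ≤ y = ¬ (y < x)

fromℚ : ℚ → ℝ
fromℚ q = mkℝ (λ _ → q) (λ ε 0<ε → 0 , λ _ _ _ _ → ∣p-p∣<ε q 0<ε)

0ℝ 1ℝ ½ℝ : ℝ
0ℝ = fromℚ 0ℚ
1ℝ = fromℚ 1ℚ
½ℝ = fromℚ ½

private
  abstract
    +-isCauchy : ∀ x y → Cauchy (λ n → seq x n ℚ.+ seq y n)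
    +-isCauchy x y ε 0<ε =
      let
        M , px = isCauchy x (ε ℚ.* ½) (half-pos 0<ε)
        N , py = isCauchy y (ε ℚ.* ½) (half-pos 0<ε)
      in
      M ℕ.⊔ N , λ m n m≥ n≥ →
        +-close (seq x m) (seq y m) (seq x n) (seq y n)
          (px m n (ℕₚ.m⊔n≤o⇒m≤o M N m≥) (ℕₚ.m⊔n≤o⇒m≤o M N n≥))
          (py m n (ℕₚ.m⊔n≤o⇒n≤o M N m≥) (ℕₚ.m⊔n≤o⇒n≤o M N n≥))

_+_ : ℝ → ℝ → ℝ
x + y = mkℝ (λ n → seq x n ℚ.+ seq y n) (+-isCauchy x y)

private
  abstract
    eventuallyBounded : ∀ x → Σ[ B ∈ ℚ ] 0ℚ ℚ.< B ×
                        (∃[ N ] (∀ n → N ℕ.≤ n → ∣ seq x n ∣ ℚ.< B))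
    eventuallyBounded x =
      let N , px = isCauchy x 1ℚ (ℚₚ.positive⁻¹ 1ℚ)
          p = seq x N
      in
      1ℚ ℚ.+ ∣ p ∣ ,
      ℚₚ.+-mono-<-≤ (ℚₚ.positive⁻¹ 1ℚ) (ℚₚ.0≤∣p∣ p) ,
      N , λ n n≥ → ℚₚ.≤-<-trans
        (subst (λ z → ∣ z ∣ ℚ.≤ ∣ seq x n ℚ.- p ∣ ℚ.+ ∣ p ∣)
               (diff-cancel (seq x n) p)
               (ℚₚ.∣p+q∣≤∣p∣+∣q∣ (seq x n ℚ.- p) p))
        (ℚₚ.+-monoˡ-< ∣ p ∣ (px n N n≥ ℕₚ.≤-refl))

    scale : ∀ B ε → 0ℚ ℚ.< B → 0ℚ ℚ.< ε →
            Σ[ δ ∈ ℚ ] 0ℚ ℚ.< δ × B ℚ.* δ ≡ ε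
    scale B ε 0<B 0<ε = ℚ.1/ B ℚ.* ε , 0<δ , eq
      where
      instance
        B-pos : ℚ.Positive B
        B-pos = ℚ.positive 0<B

        B-nonZero : ℚ.NonZero B
        B-nonZero = ℚₚ.pos⇒nonZero B

        1/B-pos : ℚ.Positive (ℚ.1/ B)
        1/B-pos = ℚₚ.1/pos⇒pos B

      0<δ : 0ℚ ℚ.< ℚ.1/ B ℚ.* ε
      0<δ = subst (ℚ._< ℚ.1/ B ℚ.* ε) (ℚₚ.*-zeroʳ (ℚ.1/ B))
                  (ℚₚ.*-monoʳ-<-pos (ℚ.1/ B) 0<ε)

      eq : B ℚ.* (ℚ.1/ B ℚ.* ε) ≡ ε
      eq = trans (sym (ℚₚ.*-assoc B (ℚ.1/ B) ε))
                 (trans (cong (ℚ._* ε) (ℚₚ.*-inverseʳ B)) (ℚₚ.*-identityˡ ε))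

    *-isCauchy : ∀ x y → Cauchy (λ n → seq x n ℚ.* seq y n)
    *-isCauchy x y ε 0<ε =
      let
        B , 0<B , K , bx = eventuallyBounded x
        C , 0<C , L , by = eventuallyBounded y
        δ , 0<δ , eq = scale (B ℚ.+ C) (ε ℚ.* ½)
                             (ℚₚ.+-mono-< 0<B 0<C) (half-pos 0<ε)
        M , px = isCauchy x δ 0<δ
        N , py = isCauchy y δ 0<δ
      in
      (K ℕ.⊔ L) ℕ.⊔ (M ℕ.⊔ N) , λ m n m≥ n≥ →
        *-close (seq x m) (seq y m) (seq x n) (seq y n) 0<B 0<C eq (half<ε 0<ε)
          (bx m (ℕₚ.m⊔n≤o⇒m≤o K L (ℕₚ.m⊔n≤o⇒m≤o (K ℕ.⊔ L) (M ℕ.⊔ N) m≥)))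
          (by n (ℕₚ.m⊔n≤o⇒n≤o K L (ℕₚ.m⊔n≤o⇒m≤o (K ℕ.⊔ L) (M ℕ.⊔ N) n≥)))
          (px m n (ℕₚ.m⊔n≤o⇒m≤o M N (ℕₚ.m⊔n≤o⇒n≤o (K ℕ.⊔ L) (M ℕ.⊔ N) m≥))
                  (ℕₚ.m⊔n≤o⇒m≤o M N (ℕₚ.m⊔n≤o⇒n≤o (K ℕ.⊔ L) (M ℕ.⊔ N) n≥)))
          (py m n (ℕₚ.m⊔n≤o⇒n≤o M N (ℕₚ.m⊔n≤o⇒n≤o (K ℕ.⊔ L) (M ℕ.⊔ N) m≥))
                  (ℕₚ.m⊔n≤o⇒n≤o M N (ℕₚ.m⊔n≤o⇒n≤o (K ℕ.⊔ L) (M ℕ.⊔ N) n≥)))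

_*_ : ℝ → ℝ → ℝ
x * y = mkℝ (λ n → seq x n ℚ.* seq y n) (*-isCauchy x y)

+-rawMonoid : RawMonoid 0ℓ 0ℓ
+-rawMonoid = record { Carrier = ℝ ; _≈_ = _≈_ ; _∙_ = _+_ ; ε = 0ℝ }

open import Algebra.Definitions.RawMonoid +-rawMonoid public
  using (sum) renaming (_×_ to _·_)

------------------------------------------------------------------------
-- Real matrices and eigenvalues

Matrix : ℕ → Set
Matrix n = Fin n → Fin n → ℝ

_*ᵥ_ : ∀ {n} → Matrix n → Vector ℝ n → Vector ℝ n
(A *ᵥ v) i = sum (λ j → A i j * v j)

Symmetric : ∀ {n} → Matrix n → Set
Symmetric A = ∀ i j → A i j ≈ A j i

Nonnegative : ∀ {n} → Matrix n → Set
Nonnegative A = ∀ i j → 0ℝ ≤ A i j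

-- v = 0 is allowed here, so that this describes the whole λ-eigenspace.
InEigenspace : ∀ {n} → Matrix n → ℝ → Vector ℝ n → Set
InEigenspace A λ′ v = ∀ i → (A *ᵥ v) i ≈ λ′ * v i

IsEigenvalue : ∀ {n} → Matrix n → ℝ → Set
IsEigenvalue {n} A λ′ =
  Σ[ v ∈ Vector ℝ n ] ¬ (∀ i → v i ≈ 0ℝ) × InEigenspace A λ′ v

LinearlyIndependent : ∀ {n} → Vector ℝ n → Vector ℝ n → Set
LinearlyIndependent v w =
  ∀ a b → (∀ i → a * v i + b * w i ≈ 0ℝ) → a ≈ 0ℝ × b ≈ 0ℝ

-- The multiplicity of an eigenvalue is the dimension of its eigenspace, which
-- for the symmetric matrices considered here is also its multiplicity as a
-- root of the characteristic polynomial.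
record AtMostOnePositiveEigenvalue {n} (A : Matrix n) : Set where
  field
    unique : ∀ λ′ μ → 0ℝ < λ′ → 0ℝ < μ →
             IsEigenvalue A λ′ → IsEigenvalue A μ → λ′ ≈ μ
    simple : ∀ λ′ → 0ℝ < λ′ → ∀ v w →
             InEigenspace A λ′ v → InEigenspace A λ′ w →
             ¬ LinearlyIndependent v w

record Antiferromagnetic {n} (A : Matrix n) : Set where
  field
    symmetric   : Symmetric A
    nonnegative : Nonnegative A
    atMostOne   : AtMostOnePositiveEigenvalue A

------------------------------------------------------------------------
-- Polynomials in n variables

Exponent : ℕ → Set
Exponent n = Vec ℕ n

infixl 6 _+e_ _-e_

_+e_ : ∀ {n} → Exponent n → Fin n → Exponent n
α +e i = updateAt α i suc

-- Truncated: this is α - eᵢ only when αᵢ > 0.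
_-e_ : ∀ {n} → Exponent n → Fin n → Exponent n
α -e i = updateAt α i pred

0ᵉ : ∀ {n} → Exponent n
0ᵉ = replicate _ 0

-- A polynomial is given by its coefficients.  Finiteness of the support is not
-- recorded, as it follows from homogeneity, which is required wherever it
-- matters below.
Polynomial : ℕ → Set
Polynomial n = Exponent n → ℝ

monomial : ∀ {n} → ℝ → Exponent n → Polynomial n
monomial c β α = if ⌊ Vecₚ.≡-dec ℕₚ._≟_ α β ⌋ then c else 0ℝ

∂ : ∀ {n} → Fin n → Polynomial n → Polynomial n
∂ i f α = suc (lookup α i) · f (α +e i)

supp : ∀ {n} → Polynomial n → Exponent n → Set
supp f α = ¬ (f α ≈ 0ℝ)

Homogeneous : ∀ {n} → ℕ → Polynomial n → Set
Homogeneous d f = ∀ α → Vec.sum α ≢ d → f α ≈ 0ℝ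

NonnegativeCoefficients : ∀ {n} → Polynomial n → Set
NonnegativeCoefficients f = ∀ α → 0ℝ ≤ f α

-- For f homogeneous of degree 2 the second derivatives are constants, read off
-- as their constant coefficients.
hessian : ∀ {n} → Polynomial n → Matrix n
hessian f i j = ∂ i (∂ j f) 0ᵉ

MConvex : ∀ {n} → (Exponent n → Set) → Set
MConvex S = ∀ a b → S a → S b → ∀ i → lookup b i ℕ.< lookup a i →
            ∃[ j ] lookup a j ℕ.< lookup b j × S (a -e i +e j)

Lorentzian : ∀ {n} → ℕ → Polynomial n → Set
Lorentzian 0 f = ⊥
Lorentzian 1 f = ⊥
Lorentzian 2 f =
  Homogeneous 2 f × NonnegativeCoefficients f ×
  AtMostOnePositiveEigenvalue (hessian f)
Lorentzian (suc d@(suc (suc _))) f =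
  Homogeneous (suc d) f × NonnegativeCoefficients f ×
  (∀ i → Lorentzian d (∂ i f)) × MConvex (supp f)

-- ½ xᵀ A x
quadraticForm : ∀ {n} → Matrix n → Polynomial n
quadraticForm A α =
  sum λ i → sum λ j → monomial (½ℝ * A i j) (0ᵉ +e i +e j) α

------------------------------------------------------------------------
-- Graphs

record Graph (n : ℕ) : Set where
  field
    adj     : Fin n → Fin n → Bool
    adj-sym : ∀ u v → adj u v ≡ adj v u

  Adj : Fin n → Fin n → Set
  Adj u v = T (adj u v)

open Graph public using (Adj)

-- A loop at v counts as an edge at v.
NoIsolatedVertices : ∀ {n} → Graph n → Set
NoIsolatedVertices G = ∀ v → ∃[ u ] Adj G v u

adjacencyMatrix : ∀ {n} → Graph n → Matrix n
adjacencyMatrix G i j = if Graph.adj G i j then 1ℝ else 0ℝ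

Q : ∀ {n} → Graph n → Polynomial n
Q G = quadraticForm (adjacencyMatrix G)

-- Parts are the fibres of `part` on V; in particular V may be empty or consist
-- of a single part, and u = v excludes loops.
InducesCompleteMultipartite : ∀ {n} → Graph n → Subset n → Set
InducesCompleteMultipartite {n} G V =
  ∃[ k ] Σ[ part ∈ (Fin n → Fin k) ]
    (∀ u v → u ∈ V → v ∈ V → Adj G u v ⇔ part u ≢ part v)

LoopedAndUniversal : ∀ {n} → Graph n → Fin n → Set
LoopedAndUniversal G v = Adj G v v × (∀ u → Adj G v u)

HasMultipartiteDecomposition : ∀ {n} → Graph n → Set
HasMultipartiteDecomposition {n} G =
  Σ[ V₁ ∈ Subset n ] Σ[ V₂ ∈ Subset n ]
    Empty (V₁ ∩ V₂) × V₁ ∪ V₂ ≡ ⊤ ×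
    InducesCompleteMultipartite G V₁ ×
    (∀ v → v ∈ V₂ → LoopedAndUniversal G v)

module Submission where

-- All conditions are equivalent to: looped vertices are universal and
-- non-adjacency is transitive.  For the M-convexity of the support this is an
-- exchange argument on edges.
--
-- If the graph has this structure, its adjacency matrix is J - Σ_c P_c P_cᵀ,
-- with J the all-ones matrix and P_c the indicator vectors of the parts, so its
-- form is nonpositive on a hyperplane and two independent eigenvectors with
-- positive eigenvalues are impossible.
--
-- Otherwise a small obstruction spans a plane on which the form of A is positive
-- definite, and positive eigenvalues violating the hypothesis must be produced
-- constructively.  For rational t the inertia of A - t is decidable, so bisection
-- on "A - t has two positive directions" yields a real λ > 0.  At λ itself
-- reasoning up to ¬¬ suffices, as the goal is a contradiction: either A - λ has
-- no positive direction, and then its kernel is at least two-dimensional, or it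
-- has exactly one, and then λ is an eigenvalue and a second bisection finds the
-- largest eigenvalue above it.

open import Algebra.Bundles using (CommutativeRing)
import Algebra.Properties.Ring as RingProperties
import Algebra.Properties.Semiring.Sum as SemiringSum
import Algebra.Solver.Ring as RingSolver
open import Algebra.Solver.Ring.AlmostCommutativeRing
  using (fromCommutativeRing; _-Raw-AlmostCommutative⟶_)
open import Algebra.Structures using (IsCommutativeRing)
open import Data.Bool.Base using (Bool; true; false; T; if_then_else_; _∧_; not)
open import Data.Bool.Properties using (T?)
open import Data.Empty using (⊥-elim)
open import Data.Fin.Base using (Fin; zero; suc; combine; funToFin; finToFun)
open import Data.Fin.Properties using (_≟_; any?; suc-injective; finToFun-funToFin)
open import Data.Fin.Subset using (Subset; _∈_; _∩_; ∁)
open import Data.Fin.Subset.Properties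
  using (∈⊤; x∈p∩q⁻; x∈p∪q⁻; p∪∁p≡⊤; x∈∁p⇒x∉p; ∪-comm)
import Data.Integer.Base as ℤ
import Data.Integer.Properties as ℤₚ
import Data.Maybe.Base as Maybe
open import Data.Nat.Base as ℕ using (ℕ; zero; suc; z≤n; s≤s)
import Data.Nat.Properties as ℕₚ
open import Data.Product.Base using (Σ-syntax; ∃-syntax; _×_; _,_; proj₁; proj₂)
open import Data.Rational.Base as ℚ using (ℚ; 0ℚ; 1ℚ; ½; ∣_∣)
import Data.Rational.Properties as ℚₚ
open import Data.Rational.Solver using (module +-*-Solver)
import Data.Rational.Unnormalised.Base as ℚᵘ
import Data.Rational.Unnormalised.Properties as ℚᵘₚ
open import Data.Sum.Base using (_⊎_; inj₁; inj₂; [_,_]′)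
open import Data.Vec.Base as Vec using (lookup; tabulate; _∷_)
open import Data.Vec.Functional using (Vector)
import Data.Vec.Properties as Vecₚ
open import Function.Base using (_∘_; id; case_of_)
open import Function.Bundles using (_⇔_; mk⇔; Equivalence)
open import Level using (0ℓ)
open import Relation.Binary.Consequences using (dec⇒weaklyDec)
open import Relation.Binary.Definitions using (tri<; tri≈; tri>)
import Relation.Binary.PropositionalEquality as ≡
open ≡ using (_≡_; _≢_)
open import Relation.Nullary.Decidable using (_×-dec_)
open import Relation.Nullary.Decidable.Core using (Dec; yes; no; decidable-stable; ⌊_⌋)
open import Relation.Nullary.Negation.Core using (¬_)

-- The obstacle is that the limit of a bisection is a real number at which no sign can be decided,
-- while the conditions bisected on are known only at nearby rationals. What can be carried across
-- the limit is what tolerates a small perturbation: strict inequalities with a margin, and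
-- definiteness with explicit constants. This is why `Inertia` has exactly three outcomes. Having a
-- positive vector and being definite both persist under small changes of the shift, so at the
-- boundary between two conditions only the degenerate case survives, and its null vector is an
-- eigenvector.
--
-- The same algebra is needed over ℚ, where signs are decidable and drive the bisection, and over ℝ,
-- where they are available only up to ¬¬; hence the abstract `OrderedRing`. It has no inverses, so
-- eliminations are scaled instead of normalised and bounds carry a constant on each side. Passing
-- from ℚ to ℝ is cheap because the adjacency matrix is rational: the real form, evaluated termwise,
-- is the rational form of the samples.

-- `Pos x` stands for 0 < x.  The axioms are those satisfied constructively by
-- the reals: no decidability, but `Pos-split` and tightness.
record OrderedRing : Set₁ where
  field
    commutativeRing : CommutativeRing 0ℓ 0ℓ
  open CommutativeRing commutativeRing public hiding (zero)
  field
    ⟦_⟧     : ℚ → Carrier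
    +-homo  : ∀ p q → ⟦ p ℚ.+ q ⟧ ≈ ⟦ p ⟧ + ⟦ q ⟧
    *-homo  : ∀ p q → ⟦ p ℚ.* q ⟧ ≈ ⟦ p ⟧ * ⟦ q ⟧
    -‿homo  : ∀ p → ⟦ ℚ.- p ⟧ ≈ - ⟦ p ⟧
    0-homo  : ⟦ 0ℚ ⟧ ≈ 0#
    1-homo  : ⟦ 1ℚ ⟧ ≈ 1#
    Pos       : Carrier → Set
    Pos-resp  : ∀ {x y} → x ≈ y → Pos x → Pos y
    Pos-1     : Pos 1#
    Pos-+     : ∀ {x y} → Pos x → Pos y → Pos (x + y)
    Pos-*     : ∀ {x y} → Pos x → Pos y → Pos (x * y)
    Pos-split : ∀ {x y} → Pos (x + y) → Pos x ⊎ Pos y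
    ¬Pos-0    : ¬ Pos 0#
    tight     : ∀ {x} → ¬ Pos x → ¬ Pos (- x) → x ≈ 0#

-- Ordered rings, and linear and symmetric forms over them

module OrderedRingProperties (O : OrderedRing) where
  open OrderedRing O public

  open RingProperties ring using (-0#≈0#) public
  open SemiringSum semiring using (sum; sum-cong-≋; ∑-distrib-+; *-distribˡ-sum; ∑-comm; sum-replicate-zero) public

  private
    weaklyDec : ∀ p q → Maybe.Maybe (⟦ p ⟧ ≈ ⟦ q ⟧)
    weaklyDec p q = Maybe.map (λ p≡q → reflexive (≡.cong ⟦_⟧ p≡q))
                              (dec⇒weaklyDec ℚₚ._≟_ p q)

    -- Rational coefficients let the ring solver treat the constants 2 and ½ in the identities below
    -- as literals in every instance.
    morphism : ℚ.+-*-rawRing -Raw-AlmostCommutative⟶ fromCommutativeRing commutativeRing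
    morphism = record
      { ⟦_⟧ = ⟦_⟧ ; +-homo = +-homo ; *-homo = *-homo ; -‿homo = -‿homo
      ; 0-homo = 0-homo ; 1-homo = 1-homo }

  module S = RingSolver ℚ.+-*-rawRing (fromCommutativeRing commutativeRing) morphism weaklyDec
  open S public using (solve; _:=_; _:+_; _:*_; _:-_; :-_; con)

  -- A negated strict inequality is stable under ¬¬, so nonnegativity can be proved by cases on
  -- `trichotomy` although signs are undecidable over ℝ.
  NonNeg : Carrier → Set
  NonNeg x = ¬ Pos (- x)

  NonNeg-resp : ∀ {x y} → x ≈ y → NonNeg x → NonNeg y
  NonNeg-resp x≈y nn p = nn (Pos-resp (-‿cong (sym x≈y)) p)

  trichotomy : ∀ x → ¬ ¬ (Pos x ⊎ x ≈ 0# ⊎ Pos (- x))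
  trichotomy x k = k (inj₂ (inj₁ (tight (λ p → k (inj₁ p)) (λ p → k (inj₂ (inj₂ p))))))

  Pos⇒NonNeg : ∀ {x} → Pos x → NonNeg x
  Pos⇒NonNeg {x} p q = ¬Pos-0 (Pos-resp (-‿inverseʳ x) (Pos-+ p q))

  ≈0⇒NonNeg : ∀ {x} → x ≈ 0# → NonNeg x
  ≈0⇒NonNeg x≈0 p = ¬Pos-0 (Pos-resp (trans (-‿cong x≈0) -0#≈0#) p)

  Pos⇒≉0 : ∀ {x} → Pos x → ¬ (x ≈ 0#)
  Pos⇒≉0 p x≈0 = ¬Pos-0 (Pos-resp x≈0 p)

  NonNeg-+ : ∀ {x y} → NonNeg x → NonNeg y → NonNeg (x + y)
  NonNeg-+ {x} {y} nx ny p
    with Pos-split (Pos-resp (solve 2 (λ x y → :- (x :+ y) := :- x :+ :- y) refl x y) p)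
  ... | inj₁ q = nx q
  ... | inj₂ q = ny q

  NonNeg-* : ∀ {x y} → NonNeg x → NonNeg y → NonNeg (x * y)
  NonNeg-* {x} {y} nx ny p = trichotomy x λ where
    (inj₂ (inj₂ q)) → nx q
    (inj₂ (inj₁ q)) → ≈0⇒NonNeg (trans (*-congʳ q) (zeroˡ y)) p
    (inj₁ q) → trichotomy y λ where
      (inj₂ (inj₂ r)) → ny r
      (inj₂ (inj₁ r)) → ≈0⇒NonNeg (trans (*-congˡ r) (zeroʳ x)) p
      (inj₁ r) → Pos⇒NonNeg (Pos-* q r) p

  NonNeg-² : ∀ x → NonNeg (x * x)
  NonNeg-² x p = trichotomy x λ where
    (inj₁ q) → Pos⇒NonNeg (Pos-* q q) p
    (inj₂ (inj₁ q)) → ≈0⇒NonNeg (trans (*-congʳ q) (zeroˡ x)) p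
    (inj₂ (inj₂ q)) → Pos⇒NonNeg (Pos-* q q)
      (Pos-resp (solve 1 (λ x → :- (x :* x) := :- (:- x :* :- x)) refl x) p)

  Pos-+-NonNeg : ∀ {x y} → Pos x → NonNeg y → Pos (x + y)
  Pos-+-NonNeg {x} {y} px ny
    with Pos-split (Pos-resp (solve 2 (λ x y → x := (x :+ y) :+ :- y) refl x y) px)
  ... | inj₁ p = p
  ... | inj₂ p = ⊥-elim (ny p)

  NonNeg-cancelˡ : ∀ {k x} → Pos k → NonNeg (k * x) → NonNeg x
  NonNeg-cancelˡ {k} {x} pk nn p =
    nn (Pos-resp (solve 2 (λ k x → k :* (:- x) := :- (k :* x)) refl k x) (Pos-* pk p))

  antisym : ∀ {x} → NonNeg x → NonNeg (- x) → x ≈ 0#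
  antisym {x} nx n-x = tight (λ p → n-x (Pos-resp (solve 1 (λ x → x := :- (:- x)) refl x) p)) nx

  stable-≈0 : ∀ {x} → ¬ ¬ (x ≈ 0#) → x ≈ 0#
  stable-≈0 k = tight (λ p → k (Pos⇒≉0 p))
    (λ p → k (λ x≈0 → ≈0⇒NonNeg x≈0 p))

  *-zero-Pos : ∀ {k x} → Pos k → k * x ≈ 0# → x ≈ 0#
  *-zero-Pos {k} {x} pk kx≈0 = antisym (NonNeg-cancelˡ pk (≈0⇒NonNeg kx≈0))
    (NonNeg-cancelˡ pk (≈0⇒NonNeg
      (trans (solve 2 (λ k x → k :* (:- x) := :- (k :* x)) refl k x)
             (trans (-‿cong kx≈0) -0#≈0#))))

  ²-zero : ∀ {x} → x * x ≈ 0# → x ≈ 0#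
  ²-zero {x} x²≈0 = stable-≈0 λ k → trichotomy x λ where
    (inj₁ p) → Pos⇒≉0 (Pos-* p p) x²≈0
    (inj₂ (inj₁ p)) → k p
    (inj₂ (inj₂ p)) → Pos⇒≉0 (Pos-* p p)
      (trans (solve 1 (λ x → :- x :* :- x := x :* x) refl x) x²≈0)

  NonNeg-+-zeroˡ : ∀ {x y} → NonNeg x → NonNeg y → NonNeg (- (x + y)) → x ≈ 0#
  NonNeg-+-zeroˡ {x} {y} nx ny n = antisym nx (NonNeg-resp
    (solve 2 (λ x y → :- (x :+ y) :+ y := :- x) refl x y) (NonNeg-+ n ny))

  one two : Carrier
  one = ⟦ 1ℚ ⟧
  two = ⟦ 1ℚ ℚ.+ 1ℚ ⟧

  Pos-one : Pos one
  Pos-one = Pos-resp (sym 1-homo) Pos-1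

  Pos-two : Pos two
  Pos-two = Pos-resp (sym (+-homo 1ℚ 1ℚ)) (Pos-+ Pos-one Pos-one)

  zero-term : ∀ {x y} → x ≈ 0# → y * x ≈ 0#
  zero-term x≈0 = trans (*-congˡ x≈0) (zeroʳ _)

  V : ℕ → Set
  V = Vector Carrier

  infixl 6 _⊕_
  infixr 7 _⊙_

  _⊕_ : ∀ {n} → V n → V n → V n
  (x ⊕ y) i = x i + y i

  _⊙_ : ∀ {n} → Carrier → V n → V n
  (k ⊙ x) i = k * x i

  infix 4 _≋_
  _≋_ : ∀ {n} → V n → V n → Set
  x ≋ y = ∀ i → x i ≈ y i

  record LinearForm (n : ℕ) : Set where
    field
      ⟨_⟩    : V n → Carrier
      ⟨⟩-cong : ∀ {x y} → x ≋ y → ⟨ x ⟩ ≈ ⟨ y ⟩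
      ⟨⟩-⊕    : ∀ x y → ⟨ x ⊕ y ⟩ ≈ ⟨ x ⟩ + ⟨ y ⟩
      ⟨⟩-⊙    : ∀ k x → ⟨ k ⊙ x ⟩ ≈ k * ⟨ x ⟩

  open LinearForm

  record SymmetricForm (n : ℕ) : Set where
    field
      B      : V n → V n → Carrier
      B-cong : ∀ {x x′ y y′} → x ≋ x′ → y ≋ y′ → B x y ≈ B x′ y′
      B-sym  : ∀ x y → B x y ≈ B y x
      B-⊕    : ∀ x y z → B (x ⊕ y) z ≈ B x z + B y z
      B-⊙    : ∀ k x z → B (k ⊙ x) z ≈ k * B x z

    B-⊕ʳ : ∀ x y z → B z (x ⊕ y) ≈ B z x + B z y
    B-⊕ʳ x y z = trans (B-sym z _) (trans (B-⊕ x y z) (+-cong (B-sym x z) (B-sym y z)))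

    B-⊙ʳ : ∀ k x z → B z (k ⊙ x) ≈ k * B z x
    B-⊙ʳ k x z = trans (B-sym z _) (trans (B-⊙ k x z) (*-congˡ (B-sym x z)))

    B-comb : ∀ a b x y z → B z (a ⊙ x ⊕ b ⊙ y) ≈ a * B z x + b * B z y
    B-comb a b x y z = trans (B-⊕ʳ _ _ z) (+-cong (B-⊙ʳ a x z) (B-⊙ʳ b y z))

    B-binomial : ∀ a b x y → B (a ⊙ x ⊕ b ⊙ y) (a ⊙ x ⊕ b ⊙ y) ≈
                 a * a * B x x + two * (a * b) * B x y + b * b * B y y
    B-binomial a b x y = trans (B-⊕ _ _ _) (trans (+-cong
      (trans (B-⊙ a x _) (*-congˡ (B-comb a b x y x)))
      (trans (B-⊙ b y _) (*-congˡ (trans (B-comb a b x y y) (+-congʳ (*-congˡ (B-sym y x)))))))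
      (solve 5 (λ a b p q r → a :* (a :* p :+ b :* q) :+ b :* (a :* q :+ b :* r) :=
          a :* a :* p :+ con (1ℚ ℚ.+ 1ℚ) :* (a :* b) :* q :+ b :* b :* r) refl a b _ _ _))

    row : V n → LinearForm n
    row x = record { ⟨_⟩ = B x ; ⟨⟩-cong = B-cong (λ _ → refl)
                   ; ⟨⟩-⊕ = λ y z → B-⊕ʳ y z x ; ⟨⟩-⊙ = λ k y → B-⊙ʳ k y x }

  open SymmetricForm

  dot : ∀ {n} → V n → V n → Carrier
  dot x y = sum (λ i → x i * y i)

  euclidean : ∀ n → SymmetricForm n
  euclidean n = record
    { B = dot
    ; B-cong = λ p q → sum-cong-≋ (λ i → *-cong (p i) (q i))
    ; B-sym = λ x y → sum-cong-≋ (λ i → *-comm (x i) (y i))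
    ; B-⊕ = λ x y z → trans (sum-cong-≋ (λ i → distribʳ (z i) (x i) (y i)))
                            (∑-distrib-+ (λ i → x i * z i) (λ i → y i * z i))
    ; B-⊙ = λ k x z → trans (sum-cong-≋ (λ i → *-assoc k (x i) (z i)))
                            (sym (*-distribˡ-sum k (λ i → x i * z i)))
    }

  ‖_‖² : ∀ {n} → V n → Carrier
  ‖ x ‖² = dot x x

  NonNeg-‖‖² : ∀ {n} (x : V n) → NonNeg ‖ x ‖²
  NonNeg-‖‖² {zero} x = ≈0⇒NonNeg refl
  NonNeg-‖‖² {suc n} x = NonNeg-+ (NonNeg-² (x zero)) (NonNeg-‖‖² (x ∘ suc))

  ‖‖²-zero : ∀ {n} {x : V n} → ‖ x ‖² ≈ 0# → ∀ i → x i ≈ 0#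
  ‖‖²-zero {suc n} {x} e zero = ²-zero (NonNeg-+-zeroˡ (NonNeg-² (x zero))
    (NonNeg-‖‖² (x ∘ suc)) (≈0⇒NonNeg (trans (-‿cong e) -0#≈0#)))
  ‖‖²-zero {suc n} {x} e (suc i) = ‖‖²-zero {x = x ∘ suc} (NonNeg-+-zeroˡ (NonNeg-‖‖² (x ∘ suc))
    (NonNeg-² (x zero)) (≈0⇒NonNeg (trans (-‿cong (trans (+-comm _ _) e)) -0#≈0#))) i

  ‖‖²-of-zero : ∀ {n} {x : V n} → (∀ i → x i ≈ 0#) → ‖ x ‖² ≈ 0#
  ‖‖²-of-zero {n} x≈0 = trans (sum-cong-≋ (λ i → zero-term (x≈0 i))) (sum-replicate-zero n)

  rankOneUpdate : ∀ {n} → Carrier → SymmetricForm n → Carrier → LinearForm n → SymmetricForm n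
  rankOneUpdate c F k ℓ = record
    { B = λ x y → c * B F x y + k * (⟨ ℓ ⟩ x * ⟨ ℓ ⟩ y)
    ; B-cong = λ p q → +-cong (*-congˡ (B-cong F p q)) (*-congˡ (*-cong (⟨⟩-cong ℓ p) (⟨⟩-cong ℓ q)))
    ; B-sym = λ x y → +-cong (*-congˡ (B-sym F x y)) (*-congˡ (*-comm _ _))
    ; B-⊕ = λ x y z → trans (+-cong (*-congˡ (B-⊕ F x y z)) (*-congˡ (*-congʳ (⟨⟩-⊕ ℓ x y))))
        (solve 7 (λ c k p q a b r → c :* (p :+ q) :+ k :* ((a :+ b) :* r) :=
                     (c :* p :+ k :* (a :* r)) :+ (c :* q :+ k :* (b :* r))) refl c k _ _ _ _ _)
    ; B-⊙ = λ m x z → trans (+-cong (*-congˡ (B-⊙ F m x z)) (*-congˡ (*-congʳ (⟨⟩-⊙ ℓ m x))))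
        (solve 6 (λ c k m p a r → c :* (m :* p) :+ k :* ((m :* a) :* r) :=
                     m :* (c :* p :+ k :* (a :* r))) refl c k m _ _ _)
    }

  shift : ∀ {n} → SymmetricForm n → Carrier → SymmetricForm n
  shift F t = record
    { B = λ x y → B F x y + t * dot x y
    ; B-cong = λ p q → +-cong (B-cong F p q) (*-congˡ (B-cong (euclidean _) p q))
    ; B-sym = λ x y → +-cong (B-sym F x y) (*-congˡ (B-sym (euclidean _) x y))
    ; B-⊕ = λ x y z → trans (+-cong (B-⊕ F x y z) (*-congˡ (B-⊕ (euclidean _) x y z)))
        (solve 5 (λ t p q a b → (p :+ q) :+ t :* (a :+ b) := (p :+ t :* a) :+ (q :+ t :* b)) refl t _ _ _ _)
    ; B-⊙ = λ k x z → trans (+-cong (B-⊙ F k x z) (*-congˡ (B-⊙ (euclidean _) k x z)))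
        (solve 4 (λ t k p a → k :* p :+ t :* (k :* a) := k :* (p :+ t :* a)) refl t k _ _)
    }

  module _ {n : ℕ} where
    e₀ : V (suc n)
    e₀ zero = one
    e₀ (suc i) = 0#

    incl : V n → V (suc n)
    incl x zero = 0#
    incl x (suc i) = x i

    decompose : ∀ x → x ≋ (x zero ⊙ e₀ ⊕ one ⊙ incl (x ∘ suc))
    decompose x zero = trans (sym (+-identityʳ _)) (+-cong
      (solve 1 (λ x → x := x :* con 1ℚ) refl _) (sym (zeroʳ one)))
    decompose x (suc i) = trans (sym (+-identityˡ _)) (+-cong (sym (zeroʳ _))
      (solve 1 (λ x → x := con 1ℚ :* x) refl _))

    incl-⊕ : ∀ x y → incl (x ⊕ y) ≋ incl x ⊕ incl y
    incl-⊕ x y zero = sym (+-identityˡ 0#)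
    incl-⊕ x y (suc i) = refl

    incl-⊙ : ∀ k x → incl (k ⊙ x) ≋ k ⊙ incl x
    incl-⊙ k x zero = sym (zeroʳ k)
    incl-⊙ k x (suc i) = refl

    incl-cong : ∀ {x y} → x ≋ y → incl x ≋ incl y
    incl-cong p zero = refl
    incl-cong p (suc i) = p i

    restrictLinear : LinearForm (suc n) → LinearForm n
    restrictLinear ℓ = record
      { ⟨_⟩ = ⟨ ℓ ⟩ ∘ incl
      ; ⟨⟩-cong = λ p → ⟨⟩-cong ℓ (incl-cong p)
      ; ⟨⟩-⊕ = λ x y → trans (⟨⟩-cong ℓ (incl-⊕ x y)) (⟨⟩-⊕ ℓ _ _)
      ; ⟨⟩-⊙ = λ k x → trans (⟨⟩-cong ℓ (incl-⊙ k x)) (⟨⟩-⊙ ℓ k _)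
      }

    restrict : SymmetricForm (suc n) → SymmetricForm n
    restrict F = record
      { B = λ x y → B F (incl x) (incl y)
      ; B-cong = λ p q → B-cong F (incl-cong p) (incl-cong q)
      ; B-sym = λ x y → B-sym F _ _
      ; B-⊕ = λ x y z → trans (B-cong F (incl-⊕ x y) (λ _ → refl)) (B-⊕ F _ _ _)
      ; B-⊙ = λ k x z → trans (B-cong F (incl-⊙ k x) (λ _ → refl)) (B-⊙ F k _ _)
      }

    linear-decompose : ∀ (ℓ : LinearForm (suc n)) x →
      ⟨ ℓ ⟩ x ≈ x zero * ⟨ ℓ ⟩ e₀ + ⟨ restrictLinear ℓ ⟩ (x ∘ suc)
    linear-decompose ℓ x = trans (⟨⟩-cong ℓ (decompose x)) (trans (⟨⟩-⊕ ℓ _ _)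
      (+-cong (⟨⟩-⊙ ℓ _ _) (trans (⟨⟩-⊙ ℓ _ _) (solve 1 (λ x → con 1ℚ :* x := x) refl _))))

    form-decompose : ∀ (F : SymmetricForm (suc n)) x → B F x x ≈
      x zero * x zero * B F e₀ e₀ + two * x zero * B F e₀ (incl (x ∘ suc))
        + B (restrict F) (x ∘ suc) (x ∘ suc)
    form-decompose F x = trans (B-cong F (decompose x) (decompose x))
      (trans (B-binomial F (x zero) one e₀ (incl (x ∘ suc)))
        (solve 4 (λ a p q r → a :* a :* p :+ con (1ℚ ℚ.+ 1ℚ) :* (a :* con 1ℚ) :* q :+ con 1ℚ :* con 1ℚ :* r
           := a :* a :* p :+ con (1ℚ ℚ.+ 1ℚ) :* a :* q :+ r) refl (x zero) _ _ _))

  linear-zero : (ℓ : LinearForm 0) → ∀ x → ⟨ ℓ ⟩ x ≈ 0#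
  linear-zero ℓ x = trans (⟨⟩-cong ℓ {y = 0# ⊙ x} (λ ())) (trans (⟨⟩-⊙ ℓ 0# x) (zeroˡ _))

  -- A Cauchy-Schwarz bound with a wasteful constant, by induction on the dimension: (ac + r)² + (ca
  -- - r)² = 2(a²c² + r²), and r² is bounded by the induction hypothesis.
  linear-bound : ∀ {n} (ℓ : LinearForm n) →
    ∃[ K ] NonNeg K × (∀ x → NonNeg (K * ‖ x ‖² - ⟨ ℓ ⟩ x * ⟨ ℓ ⟩ x))
  linear-bound {zero} ℓ = 0# , ≈0⇒NonNeg refl , λ x → ≈0⇒NonNeg
    (trans (+-cong (zeroˡ _) (-‿cong (zero-term (linear-zero ℓ x)))) (-‿inverseʳ 0#))
  linear-bound {suc n} ℓ =
    let K , K≥0 , bound = linear-bound (restrictLinear ℓ)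
        c = ⟨ ℓ ⟩ e₀
        two≥0 = Pos⇒NonNeg Pos-two
    in two * (c * c + K) , NonNeg-* two≥0 (NonNeg-+ (NonNeg-² c) K≥0) , λ x →
      let a = x zero
          N = ‖ x ∘ suc ‖²
          r = ⟨ restrictLinear ℓ ⟩ (x ∘ suc)
      in NonNeg-resp
        (trans (solve 5 (λ a c K N r →
            con (1ℚ ℚ.+ 1ℚ) :* (K :* N :- r :* r) :+
              ((con (1ℚ ℚ.+ 1ℚ) :* ((c :* c) :* N :+ K :* (a :* a))) :+ (c :* a :- r) :* (c :* a :- r))
            := con (1ℚ ℚ.+ 1ℚ) :* (c :* c :+ K) :* (a :* a :+ N) :- (a :* c :+ r) :* (a :* c :+ r))
            refl a c K N r)
          (+-congˡ (-‿cong (sym (*-cong (linear-decompose ℓ x) (linear-decompose ℓ x))))))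
        (NonNeg-+ (NonNeg-* two≥0 (bound (x ∘ suc)))
          (NonNeg-+ (NonNeg-* two≥0 (NonNeg-+ (NonNeg-* (NonNeg-² c) (NonNeg-‖‖² (x ∘ suc)))
                                              (NonNeg-* K≥0 (NonNeg-² a))))
                    (NonNeg-² _)))

  NegSemidefinite : ∀ {n} → SymmetricForm n → Set
  NegSemidefinite F = ∀ z → NonNeg (- B F z z)

  -- With b = F(z,y), the coefficients are chosen so that F(y,y) cancels and (2b)² remains. A null
  -- vector that pairs nontrivially with some y therefore yields a positive direction, and a null
  -- vector of a semidefinite form lies in the kernel.
  isotropic-value : ∀ {n} (F : SymmetricForm n) z y → B F z z ≈ 0# →
    ∃[ w ] B F w w ≈ two * B F z y * (two * B F z y)
  isotropic-value F z y Bzz≈0 = (one - B F y y) ⊙ z ⊕ (two * B F z y) ⊙ y ,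
    trans (B-binomial F _ _ z y) (trans (+-congʳ (+-congʳ (zero-term Bzz≈0)))
      (trans (+-congʳ (+-identityˡ _))
      (solve 2 (λ b c → let t = con (1ℚ ℚ.+ 1ℚ) in
         t :* ((con 1ℚ :- c) :* (t :* b)) :* b :+ t :* b :* (t :* b) :* c := t :* b :* (t :* b))
         refl _ _)))

  isotropic⇒kernel : ∀ {n} (F : SymmetricForm n) → NegSemidefinite F →
    ∀ z → B F z z ≈ 0# → ∀ y → B F z y ≈ 0#
  isotropic⇒kernel F nsd z Bzz≈0 y =
    let w , eq = isotropic-value F z y Bzz≈0 in
    *-zero-Pos Pos-two (²-zero (antisym (NonNeg-² _) (NonNeg-resp (-‿cong eq) (nsd w))))

-- Inertia of symmetric forms

-- M is the identity over ℚ, where signs are decidable, and ¬¬ over ℝ.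
module Inertia (O : OrderedRing)
  (M : Set → Set) (pure : {A : Set} → A → M A)
  (_>>=_ : {A C : Set} → M A → (A → M C) → M C)
  (sign : ∀ x → M (OrderedRing.Pos O x ⊎ OrderedRing._≈_ O x (OrderedRing.0# O)
                     ⊎ OrderedRing.Pos O (OrderedRing.-_ O x))) where

  open OrderedRingProperties O
  open LinearForm
  open SymmetricForm

  -- `definite` is quantitative, with two constants in place of the quotient c/K, because it has to
  -- survive a small change of the form.
  data Inertia {n} (F : SymmetricForm n) : Set where
    positive   : ∀ x → Pos (B F x x) → Inertia F
    degenerate : NegSemidefinite F → ∀ z → Pos ‖ z ‖² → B F z z ≈ 0# → Inertia F
    definite   : ∀ c K → Pos c → Pos K →
                 (∀ z → NonNeg (K * (- B F z z) - c * ‖ z ‖²)) → Inertia F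

  private
    definite⇒NegSemidefinite : ∀ {n} (F : SymmetricForm n) {c K} → Pos c → Pos K →
      (∀ z → NonNeg (K * (- B F z z) - c * ‖ z ‖²)) → NegSemidefinite F
    definite⇒NegSemidefinite F c>0 K>0 h z = NonNeg-cancelˡ K>0 (NonNeg-resp
      (solve 2 (λ p q → p :- q :+ q := p) refl _ _)
      (NonNeg-+ (h z) (NonNeg-* (Pos⇒NonNeg c>0) (NonNeg-‖‖² z))))

    linear-sign : ∀ {n} (ℓ : LinearForm n) →
      M ((∃[ y ] Pos (⟨ ℓ ⟩ y * ⟨ ℓ ⟩ y)) ⊎ (∀ x → ⟨ ℓ ⟩ x ≈ 0#))
    linear-sign {zero} ℓ = pure (inj₂ (linear-zero ℓ))
    linear-sign {suc n} ℓ = sign (⟨ ℓ ⟩ e₀) >>= λ where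
      (inj₁ p) → pure (inj₁ (e₀ , Pos-* p p))
      (inj₂ (inj₂ p)) → pure (inj₁ (e₀ , Pos-resp
        (solve 1 (λ x → :- x :* :- x := x :* x) refl _) (Pos-* p p)))
      (inj₂ (inj₁ z)) → linear-sign (restrictLinear ℓ) >>= λ where
        (inj₁ (y , p)) → pure (inj₁ (incl y , p))
        (inj₂ h) → pure (inj₂ λ x → trans (linear-decompose ℓ x)
          (trans (+-cong (zero-term z) (h (x ∘ suc))) (+-identityˡ 0#)))

    -- Completing the square when F(e₀,e₀) < 0: with a = F(e₀,e₀), r = F(e₀,·)
    -- and the Schur complement D′ = -a D + r², one has
    -- -a · -F(x,x) = (a x₀ + r)² - D′.
    module Schur {n} (F : SymmetricForm (suc n)) (a<0 : Pos (- B F e₀ e₀)) where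
      a : Carrier
      a = B F e₀ e₀

      r : LinearForm n
      r = restrictLinear (row F e₀)

      complement : SymmetricForm n
      complement = rankOneUpdate (- a) (restrict F) one r

      square : V (suc n) → Carrier
      square x = (a * x zero + ⟨ r ⟩ (x ∘ suc)) * (a * x zero + ⟨ r ⟩ (x ∘ suc))

      complete : ∀ x → - a * (- B F x x) ≈ square x - B complement (x ∘ suc) (x ∘ suc)
      complete x = trans (*-congˡ (-‿cong (form-decompose F x)))
        (solve 4 (λ a x r d → :- a :* (:- (x :* x :* a :+ con (1ℚ ℚ.+ 1ℚ) :* x :* r :+ d)) :=
            (a :* x :+ r) :* (a :* x :+ r) :- (:- a :* d :+ con 1ℚ :* (r :* r))) refl _ _ _ _)

      -- The projection of `incl y` to the F-orthogonal complement of `e₀`, multiplied by -a to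
      -- avoid dividing.
      lift : V n → V (suc n)
      lift y = ⟨ r ⟩ y ⊙ e₀ ⊕ (- a) ⊙ incl y

      lift-value : ∀ y → B F (lift y) (lift y) ≈ - a * B complement y y
      lift-value y = trans (B-binomial F _ _ e₀ (incl y))
        (solve 3 (λ a r d → r :* r :* a :+ con (1ℚ ℚ.+ 1ℚ) :* (r :* :- a) :* r :+ :- a :* :- a :* d :=
          :- a :* (:- a :* d :+ con 1ℚ :* (r :* r))) refl _ _ _)

      lift-Pos : ∀ {y} → Pos ‖ y ‖² → Pos ‖ lift y ‖²
      lift-Pos {y} p = Pos-resp (+-comm _ _) (Pos-+-NonNeg
        (Pos-resp (sym (trans (B-cong E tail tail)
            (trans (B-⊙ E (- a) y _) (*-congˡ (B-⊙ʳ E (- a) y y)))))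
          (Pos-* a<0 (Pos-* a<0 p)))
        (NonNeg-² _))
        where
        E = euclidean n
        tail : lift y ∘ suc ≋ (- a) ⊙ y
        tail i = trans (+-congʳ (zeroʳ _)) (+-identityˡ _)

      negSemidefinite : NegSemidefinite complement → NegSemidefinite F
      negSemidefinite nsd x = NonNeg-cancelˡ a<0 (NonNeg-resp (sym (complete x))
        (NonNeg-+ (NonNeg-² _) (nsd (x ∘ suc))))

      isDefinite : Inertia complement → Inertia F
      isDefinite (positive y p) = positive (lift y) (Pos-resp (sym (lift-value y)) (Pos-* a<0 p))
      isDefinite (degenerate nsd z z≠0 e) =
        degenerate (negSemidefinite nsd) (lift z) (lift-Pos z≠0) (trans (lift-value z) (zero-term e))
      -- With u = a x₀ + ρ one has a²x₀² = (u - ρ)², which is at most 2u² + 2ρ² and hence at most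
      -- 2u² + 2Ln, while cn is at most KN. So c a²(x₀² + n) is at most 2c u² + kK N for k = 2L +
      -- a², and `m` dominates both coefficients.
      isDefinite (definite c K c>0 K>0 h) =
        definite (c * (- a * - a)) (m * - a) (Pos-* c>0 (Pos-* a<0 a<0)) (Pos-* m>0 a<0) λ x →
          let n = ‖ x ∘ suc ‖²
              N = - B complement (x ∘ suc) (x ∘ suc)
              u = a * x zero + ⟨ r ⟩ (x ∘ suc)
              ρ = ⟨ r ⟩ (x ∘ suc)
              N≥0 = definite⇒NegSemidefinite complement c>0 K>0 h (x ∘ suc)
          in NonNeg-resp (trans
            (solve 8 (λ a x ρ N n c K L →
              let t = con (1ℚ ℚ.+ 1ℚ)
                  u = a :* x :+ ρ
                  k = t :* L :+ :- a :* :- a in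
              (k :* K :* (u :* u) :+ t :* c :* N) :+ (c :* ((u :+ ρ) :* (u :+ ρ)) :+
                (k :* (K :* N :- c :* n) :+ t :* c :* (L :* n :- ρ :* ρ)))
              := (t :* c :+ k :* K) :* (u :* u :+ N) :- c :* (:- a :* :- a) :* (x :* x :+ n))
              refl a (x zero) ρ N n c K L)
            (+-congʳ (trans (*-congˡ (sym (complete x))) (sym (*-assoc _ _ _)))))
            (NonNeg-+ (NonNeg-+ (NonNeg-* (NonNeg-* k≥0 (Pos⇒NonNeg K>0)) (NonNeg-² u))
                                (NonNeg-* (Pos⇒NonNeg (Pos-* Pos-two c>0)) N≥0))
              (NonNeg-+ (NonNeg-* (Pos⇒NonNeg c>0) (NonNeg-² _))
                (NonNeg-+ (NonNeg-* k≥0 (h (x ∘ suc)))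
                  (NonNeg-* (Pos⇒NonNeg (Pos-* Pos-two c>0)) (proj₂ (proj₂ bound) (x ∘ suc))))))
        where
        bound = linear-bound r
        L = proj₁ bound
        k = two * L + - a * - a
        k≥0 = NonNeg-+ (NonNeg-* (Pos⇒NonNeg Pos-two) (proj₁ (proj₂ bound))) (NonNeg-² (- a))
        m = two * c + k * K
        m>0 = Pos-+-NonNeg (Pos-* Pos-two c>0) (NonNeg-* k≥0 (Pos⇒NonNeg K>0))

    null-leading : ∀ {n} (F : SymmetricForm (suc n)) → B F e₀ e₀ ≈ 0# →
      (∀ y → B F e₀ (incl y) ≈ 0#) → NegSemidefinite (restrict F) → Inertia F
    null-leading {n} F a≈0 b≈0 nsd = degenerate
      (λ x → NonNeg-resp (-‿cong (sym (trans (form-decompose F x)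
          (trans (+-congʳ (trans (+-cong (zero-term a≈0) (zero-term (b≈0 _))) (+-identityˡ 0#)))
                 (+-identityˡ _)))))
        (nsd (x ∘ suc)))
      e₀ (Pos-+-NonNeg (Pos-* Pos-one Pos-one) (NonNeg-‖‖² (e₀ {n} ∘ suc))) a≈0

  positive-or-negSemidefinite : ∀ {n} {F : SymmetricForm n} → Inertia F →
    (∃[ x ] Pos (B F x x)) ⊎ NegSemidefinite F
  positive-or-negSemidefinite (positive x p) = inj₁ (x , p)
  positive-or-negSemidefinite (degenerate nsd _ _ _) = inj₂ nsd
  positive-or-negSemidefinite {F = F} (definite _ _ c>0 K>0 h) = inj₂ (definite⇒NegSemidefinite F c>0 K>0 h)

  inertia : ∀ {n} (F : SymmetricForm n) → M (Inertia F)
  inertia {zero} F = pure (definite one one Pos-one Pos-one λ z → ≈0⇒NonNeg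
    (trans (+-cong (zero-term (trans (-‿cong (linear-zero (row F z) z)) -0#≈0#))
                   (trans (-‿cong (zeroʳ one)) -0#≈0#)) (+-identityˡ 0#)))
  inertia {suc n} F = sign (B F e₀ e₀) >>= λ where
    (inj₁ p) → pure (positive e₀ p)
    (inj₂ (inj₂ a<0)) → inertia (Schur.complement F a<0) >>= λ I → pure (Schur.isDefinite F a<0 I)
    (inj₂ (inj₁ a≈0)) → linear-sign (restrictLinear (row F e₀)) >>= λ where
      -- Here `e₀` is null but pairs nontrivially with `y`, so the two vectors span a hyperbolic
      -- plane.
      (inj₁ (y , p)) →
        let w , eq = isotropic-value F e₀ (incl y) a≈0 in
        pure (positive w (Pos-resp (sym (trans eq
          (solve 2 (λ t b → t :* b :* (t :* b) := (t :* t) :* (b :* b)) refl two _)))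
          (Pos-* (Pos-* Pos-two Pos-two) p)))
      -- Now `e₀` lies in the kernel, so only the sign of the restriction matters: the form cannot
      -- be definite.
      (inj₂ b≈0) → inertia (restrict F) >>= λ I → pure (case positive-or-negSemidefinite I of λ where
        (inj₁ (y , p)) → positive (incl y) p
        (inj₂ nsd) → null-leading F a≈0 b≈0 nsd)

¬¬-bind : {A C : Set} → ¬ ¬ A → (A → ¬ ¬ C) → ¬ ¬ C
¬¬-bind a f k = a (λ x → f x k)

-- Positive directions, bounds on hyperplanes, and eigenvectors

module Signature (O : OrderedRing) where
  open OrderedRingProperties O public
  open LinearForm public
  open SymmetricForm public

  NonNeg⇒¬Pos- : ∀ {x} → NonNeg (- x) → ¬ Pos x
  NonNeg⇒¬Pos- n p = n (Pos-resp (solve 1 (λ x → x := :- (:- x)) refl _) p)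

  ≉0⇒¬¬Pos : ∀ {x} → NonNeg x → ¬ (x ≈ 0#) → ¬ ¬ Pos x
  ≉0⇒¬¬Pos {x} x≥0 x≉0 k = trichotomy x λ where
    (inj₁ p) → k p
    (inj₂ (inj₁ e)) → x≉0 e
    (inj₂ (inj₂ p)) → x≥0 p

  *-zero-≉ : ∀ {k x} → ¬ (k ≈ 0#) → k * x ≈ 0# → x ≈ 0#
  *-zero-≉ {k} {x} k≉0 kx≈0 = stable-≈0 λ x≉0 → trichotomy k λ where
    (inj₁ p) → x≉0 (*-zero-Pos p kx≈0)
    (inj₂ (inj₁ e)) → k≉0 e
    (inj₂ (inj₂ p)) → x≉0 (*-zero-Pos p
      (trans (solve 2 (λ k x → :- k :* x := :- (k :* x)) refl k x) (trans (-‿cong kx≈0) -0#≈0#)))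

  -- Positive index at least two. An orthogonal pair is asked for instead of a positive definite
  -- plane so that mixed terms vanish in every later computation.
  TwoPositive : ∀ {n} → SymmetricForm n → Set
  TwoPositive F = ∃[ x ] ∃[ y ] Pos (B F x x) × Pos (B F y y) × B F x y ≈ 0#

  TwoPositive-resp : ∀ {n} (F G : SymmetricForm n) → (∀ x y → B F x y ≈ B G x y) →
    TwoPositive F → TwoPositive G
  TwoPositive-resp F G e (x , y , p , q , o) =
    x , y , Pos-resp (e x x) p , Pos-resp (e y y) q , trans (sym (e x y)) o

  telescope : ∀ a b c → (a - b) + (b - c) ≈ a - c
  telescope = solve 3 (λ a b c → (a :- b) :+ (b :- c) := a :- c) refl

  subtract-square : ∀ {n} (F : SymmetricForm n) (ℓ : LinearForm n) z →
    - B (rankOneUpdate one F (- one) ℓ) z z ≈ - B F z z + ⟨ ℓ ⟩ z * ⟨ ℓ ⟩ z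
  subtract-square F ℓ z =
    solve 2 (λ f s → :- (con 1ℚ :* f :+ :- con 1ℚ :* (s :* s)) := :- f :+ s :* s) refl _ _

  subtract-square-negSemidefinite : ∀ {n} (F : SymmetricForm n) (ℓ : LinearForm n) →
    NegSemidefinite F → NegSemidefinite (rankOneUpdate one F (- one) ℓ)
  subtract-square-negSemidefinite F ℓ nsd z =
    NonNeg-resp (sym (subtract-square F ℓ z)) (NonNeg-+ (nsd z) (NonNeg-² _))

  -- The form F(x,x) F - F(x,·)² vanishes on x and equals F(x,x) F on the
  -- F-orthogonal complement of x.
  deflate : ∀ {n} → SymmetricForm n → V n → SymmetricForm n
  deflate F x = rankOneUpdate (B F x x) F (- one) (row F x)

  -- A Gram-Schmidt step without division: `y′` is F(x,x) times the part of `y` orthogonal to `x`,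
  -- and its value is F(x,x) times the deflated value at `y`.
  deflate-positive : ∀ {n} (F : SymmetricForm n) {x y} →
    Pos (B F x x) → Pos (B (deflate F x) y y) → TwoPositive F
  deflate-positive F {x} {y} p pos = x , y′ , p ,
    Pos-resp (sym (trans (B-binomial F q (- B F x y) y x) (trans
      (+-congʳ (+-congˡ (*-congˡ (B-sym F y x))))
      (solve 3 (λ q b c → q :* q :* c :+ con (1ℚ ℚ.+ 1ℚ) :* (q :* :- b) :* b :+ :- b :* :- b :* q
        := q :* (q :* c :+ :- con 1ℚ :* (b :* b))) refl q _ _)))) (Pos-* p pos) ,
    trans (B-comb F q (- B F x y) y x x)
      (trans (solve 2 (λ q b → q :* b :+ :- b :* q := con 0ℚ) refl q _) 0-homo)
    where
    q = B F x x
    y′ = q ⊙ y ⊕ (- B F x y) ⊙ x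

  -- Sylvester's criterion for the plane spanned by `x` and `y`.
  gram⇒twoPositive : ∀ {n} (F : SymmetricForm n) {x y a b c} → B F x x ≈ a → B F x y ≈ b → B F y y ≈ c →
    Pos a → Pos (a * c - b * b) → TwoPositive F
  gram⇒twoPositive F {x} {y} xx≈a xy≈b yy≈c a>0 p = deflate-positive F {x} {y} (Pos-resp (sym xx≈a) a>0)
    (Pos-resp (trans (solve 3 (λ a b c → a :* c :- b :* b := a :* c :+ :- con 1ℚ :* (b :* b)) refl _ _ _)
      (sym (+-cong (*-cong xx≈a yy≈c) (*-congˡ (*-cong xy≈b xy≈b))))) p)

  -- The combination z = ℓ(y)x - ℓ(x)y lies in the hyperplane. As `x` and `y` are F-orthogonal but
  -- perhaps not Euclidean orthogonal, ‖z‖² has a mixed term; adding ‖z⁻‖² removes it and doubles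
  -- the squared norms, which is where `two` comes from. The outcome forces ℓ(y) = 0, and then `y`
  -- itself violates the bound. The slack e is the distance of a nearby shift from the limit.
  twoPositive-bound : ∀ {n} (F : SymmetricForm n) (ℓ : LinearForm n) {e} → NonNeg e →
    (∀ z → ⟨ ℓ ⟩ z ≈ 0# → NonNeg (e * ‖ z ‖² - B F z z)) →
    ∀ {x y} → B F x y ≈ 0# → Pos (B F x x - e * (two * ‖ x ‖²)) →
    ¬ Pos (B F y y - e * (two * ‖ y ‖²))
  twoPositive-bound {n} F ℓ {e} e≥0 h {x} {y} o p q = NonNeg⇒¬Pos-
    (NonNeg-resp (solve 2 (λ n q → n :- q := :- (q :- n)) refl _ _) (h y ℓy≈0))
    (Pos-resp (solve 3 (λ q e n → (q :- e :* (con (1ℚ ℚ.+ 1ℚ) :* n)) :+ e :* n := q :- e :* n) refl _ _ _)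
      (Pos-+-NonNeg q (NonNeg-* e≥0 (NonNeg-‖‖² y))))
    where
    E = euclidean n
    a = ⟨ ℓ ⟩ y
    b = - ⟨ ℓ ⟩ x
    z = a ⊙ x ⊕ b ⊙ y
    z⁻ = a ⊙ x ⊕ (- b) ⊙ y
    ℓz≈0 : ⟨ ℓ ⟩ z ≈ 0#
    ℓz≈0 = trans (⟨⟩-⊕ ℓ _ _) (trans (+-cong (⟨⟩-⊙ ℓ _ _) (⟨⟩-⊙ ℓ _ _))
      (trans (solve 2 (λ a b → a :* b :+ :- b :* a := con 0ℚ) refl _ _) 0-homo))
    P = B F x x - e * (two * ‖ x ‖²)
    Q = B F y y - e * (two * ‖ y ‖²)
    -- By the parallelogram law for z and z⁻.
    key : e * ‖ z ‖² - B F z z + e * ‖ z⁻ ‖² ≈ - (a * a * P + b * b * Q)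
    key = trans (+-cong (+-cong (*-congˡ (B-binomial E a b x y)) (-‿cong (trans (B-binomial F a b x y)
            (+-congʳ (trans (+-congˡ (zero-term o)) (+-identityʳ _))))))
            (*-congˡ (B-binomial E a (- b) x y)))
      (solve 8 (λ e a b nx xy ny p q → let t = con (1ℚ ℚ.+ 1ℚ) in
        e :* (a :* a :* nx :+ t :* (a :* b) :* xy :+ b :* b :* ny) :- (a :* a :* p :+ b :* b :* q)
          :+ e :* (a :* a :* nx :+ t :* (a :* :- b) :* xy :+ :- b :* :- b :* ny)
        := :- (a :* a :* (p :- e :* (t :* nx)) :+ b :* b :* (q :- e :* (t :* ny))))
        refl e a b _ _ _ _ _)
    ℓy≈0 : a ≈ 0#
    ℓy≈0 = ²-zero (*-zero-Pos p (trans (*-comm _ _) (NonNeg-+-zeroˡ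
      (NonNeg-* (NonNeg-² a) (Pos⇒NonNeg p)) (NonNeg-* (NonNeg-² b) (Pos⇒NonNeg q))
      (NonNeg-resp key (NonNeg-+ (h z ℓz≈0) (NonNeg-* e≥0 (NonNeg-‖‖² z⁻)))))))

  twoPositive-contradiction : ∀ {n} (F : SymmetricForm n) (ℓ : LinearForm n) →
    (∀ z → ⟨ ℓ ⟩ z ≈ 0# → NonNeg (- B F z z)) → ¬ TwoPositive F
  twoPositive-contradiction F ℓ h (x , y , p , q , o) =
    twoPositive-bound F ℓ (≈0⇒NonNeg refl)
      (λ z e → NonNeg-resp (trans (sym (+-identityˡ _)) (+-congʳ (sym (zeroˡ _)))) (h z e)) o
      (Pos-resp unscale p) (Pos-resp unscale q)
    where
    unscale : ∀ {p s} → p ≈ p - 0# * s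
    unscale = trans (sym (+-identityʳ _)) (+-congˡ (trans (sym -0#≈0#) (-‿cong (sym (zeroˡ _)))))

  -- An upper bound for the spectrum; it supplies the right end of the bisections.
  form-bound : ∀ {n} (F : SymmetricForm n) →
    ∃[ K ] NonNeg K × NegSemidefinite (shift F (- K))
  form-bound {zero} F = 0# , ≈0⇒NonNeg refl , λ z → ≈0⇒NonNeg
    (trans (-‿cong (trans (+-cong (linear-zero (row F z) z) (zeroʳ _)) (+-identityˡ 0#))) -0#≈0#)
  form-bound {suc n} F =
    let K , K≥0 , bound = form-bound (restrict F)
        r = restrictLinear (row F e₀)
        L , L≥0 , boundʳ = linear-bound r
        a = B F e₀ e₀
        -- From (a - ½)² being nonnegative, a is at most a² + ½², a bound that needs neither the
        -- sign nor the absolute value of a.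
        h = ⟦ ½ ⟧
        k≥0 = NonNeg-+ (NonNeg-+ (NonNeg-² a) (NonNeg-² h)) (Pos⇒NonNeg Pos-one)
    in (a * a + h * h + one) + (L + K) , NonNeg-+ k≥0 (NonNeg-+ L≥0 K≥0) , λ x →
      let x₀ = x zero
          m = ‖ x ∘ suc ‖²
          ρ = ⟨ r ⟩ (x ∘ suc)
          d = B (restrict F) (x ∘ suc) (x ∘ suc)
      in NonNeg-resp
        (trans (solve 7 (λ a x ρ d m K L → let h = con ½ in
            (x :* x :* ((a :- h) :* (a :- h)) :+ (x :- ρ) :* (x :- ρ)) :+
              ((L :* m :- ρ :* ρ) :+ (:- (d :+ :- K :* m) :+
                ((L :+ K) :* (x :* x) :+ (a :* a :+ h :* h :+ con 1ℚ) :* m)))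
            := :- ((x :* x :* a :+ con (1ℚ ℚ.+ 1ℚ) :* x :* ρ :+ d)
                   :+ :- ((a :* a :+ h :* h :+ con 1ℚ) :+ (L :+ K)) :* (x :* x :+ m)))
            refl a x₀ ρ d m K L)
          (-‿cong (+-congʳ (sym (form-decompose F x)))))
        (NonNeg-+ (NonNeg-+ (NonNeg-* (NonNeg-² x₀) (NonNeg-² _)) (NonNeg-² _))
          (NonNeg-+ (boundʳ (x ∘ suc)) (NonNeg-+ (bound (x ∘ suc))
            (NonNeg-+ (NonNeg-* (NonNeg-+ L≥0 K≥0) (NonNeg-² x₀)) (NonNeg-* k≥0 (NonNeg-‖‖² (x ∘ suc)))))))

  _*ᴹ_ : ∀ {n} → (Fin n → V n) → V n → V n
  (A *ᴹ x) i = sum (λ j → A i j * x j)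

  *ᴹ-cong : ∀ {n} (A : Fin n → V n) {x y} → x ≋ y → A *ᴹ x ≋ A *ᴹ y
  *ᴹ-cong A e i = sum-cong-≋ (λ j → *-congˡ (e j))

  matrixForm : ∀ {n} (A : Fin n → V n) → (∀ i j → A i j ≈ A j i) → SymmetricForm n
  matrixForm {n} A A-sym = record
    { B = λ x y → dot x (A *ᴹ y)
    ; B-cong = λ p q → B-cong E p (*ᴹ-cong A q)
    ; B-sym = λ x y → trans (expand x y) (trans (∑-comm (λ i j → x i * (A i j * y j)))
        (trans (sum-cong-≋ (λ j → sum-cong-≋ (λ i → trans
          (solve 3 (λ x a y → x :* (a :* y) := y :* (a :* x)) refl (x i) (A i j) (y j))
          (*-congˡ (*-congʳ (A-sym i j))))))
        (sym (expand y x))))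
    ; B-⊕ = λ x y z → B-⊕ E x y _
    ; B-⊙ = λ k x z → B-⊙ E k x _
    }
    where
    E = euclidean n
    expand : ∀ x y → dot x (A *ᴹ y) ≈ sum (λ i → sum (λ j → x i * (A i j * y j)))
    expand x y = sum-cong-≋ (λ i → *-distribˡ-sum (x i) (λ j → A i j * y j))

  module _ {n} (A : Fin n → V n) (A-sym : ∀ i j → A i j ≈ A j i) where
    private
      F = matrixForm A A-sym
      E = euclidean n

    Eigenvector : Carrier → V n → Set
    Eigenvector μ v = A *ᴹ v ≋ μ ⊙ v

    -- The kernel condition is tested on the residual y = Av - μv, where the shifted form gives
    -- ‖y‖².
    kernel⇒eigenvector : ∀ μ v → (∀ y → B (shift F (- μ)) v y ≈ 0#) → Eigenvector μ v
    kernel⇒eigenvector μ v h i = trans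
      (solve 2 (λ p q → p := con 1ℚ :* p :+ :- q :+ q) refl _ _)
      (trans (+-congʳ (trans (+-congˡ (solve 2 (λ m v → :- (m :* v) := :- m :* v) refl μ (v i)))
         (‖‖²-zero {x = y} y²≈0 i))) (+-identityˡ _))
      where
      y = one ⊙ (A *ᴹ v) ⊕ (- μ) ⊙ v
      y²≈0 : ‖ y ‖² ≈ 0#
      y²≈0 = trans (B-comb E one (- μ) (A *ᴹ v) v y) (trans
        (+-congʳ (solve 1 (λ x → con 1ℚ :* x := x) refl _))
        (trans (B-sym (shift F (- μ)) y v) (h y)))

    eigenvector-value : ∀ {μ v} → Eigenvector μ v → ∀ y → B F y v ≈ μ * dot y v
    eigenvector-value {μ} {v} ev y = trans (B-cong E (λ _ → refl) ev) (B-⊙ʳ E μ v y)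

    module _ (ℓ : LinearForm n) (h : ∀ z → ⟨ ℓ ⟩ z ≈ 0# → NonNeg (- B F z z)) where

      eigenvector-zero : ∀ {μ v} → Pos μ → Eigenvector μ v → ⟨ ℓ ⟩ v ≈ 0# → ∀ i → v i ≈ 0#
      eigenvector-zero {μ} {v} μ>0 ev ℓv≈0 = ‖‖²-zero (antisym (NonNeg-‖‖² v)
        (NonNeg-cancelˡ μ>0 (NonNeg-resp (trans (-‿cong (eigenvector-value ev v))
          (solve 2 (λ m n → :- (m :* n) := m :* :- n) refl _ _)) (h v ℓv≈0))))

      private
        -- The combination annihilated by `ℓ`: every plane meets the hyperplane.
        comb : V n → V n → V n
        comb v w = ⟨ ℓ ⟩ w ⊙ v ⊕ (- ⟨ ℓ ⟩ v) ⊙ w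

        ℓ-comb : ∀ v w → ⟨ ℓ ⟩ (comb v w) ≈ 0#
        ℓ-comb v w = trans (⟨⟩-⊕ ℓ _ _) (trans (+-cong (⟨⟩-⊙ ℓ _ _) (⟨⟩-⊙ ℓ _ _))
          (trans (solve 2 (λ a b → a :* b :+ :- b :* a := con 0ℚ) refl _ _) 0-homo))

      -- `comb v w` is an eigenvector inside the hyperplane, hence zero. Independence then gives
      -- ℓ(v) = 0, so `v` is zero too, against independence with coefficients 1 and 0.
      eigenspace-simple : ∀ {μ v w} → Pos μ → Eigenvector μ v → Eigenvector μ w →
        ¬ (∀ a b → a ⊙ v ⊕ b ⊙ w ≋ (λ _ → 0#) → a ≈ 0# × b ≈ 0#)
      eigenspace-simple {μ} {v} {w} μ>0 ev ew indep =
        Pos⇒≉0 Pos-one (proj₁ (indep one 0# λ i →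
          trans (+-cong (zero-term (eigenvector-zero μ>0 ev ℓv≈0 i)) (zeroˡ _)) (+-identityˡ 0#)))
        where
        a = ⟨ ℓ ⟩ w
        b = - ⟨ ℓ ⟩ v
        ez : Eigenvector μ (comb v w)
        ez i = trans (sum-cong-≋ (λ j → solve 5 (λ m a v b w → m :* (a :* v :+ b :* w)
                   := a :* (m :* v) :+ b :* (m :* w)) refl (A i j) a (v j) b (w j)))
          (trans (∑-distrib-+ (λ j → a * (A i j * v j)) (λ j → b * (A i j * w j)))
          (trans (+-cong (sym (*-distribˡ-sum a (λ j → A i j * v j))) (sym (*-distribˡ-sum b (λ j → A i j * w j))))
          (trans (+-cong (*-congˡ (ev i)) (*-congˡ (ew i)))
            (solve 5 (λ m a v b w → a :* (m :* v) :+ b :* (m :* w) := m :* (a :* v :+ b :* w))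
              refl μ a (v i) b (w i)))))
        ℓv≈0 : ⟨ ℓ ⟩ v ≈ 0#
        ℓv≈0 = trans (solve 1 (λ x → x := :- (:- x)) refl _) (trans (-‿cong
          (proj₂ (indep a b (eigenvector-zero μ>0 ez (ℓ-comb v w))))) -0#≈0#)

      -- Eigenvectors for different eigenvalues are orthogonal, so the form at `comb v w` is a²κ‖v‖²
      -- + b²μ‖w‖² with no mixed term. Its nonpositivity forces a = ℓ(w) = 0, and so `w` is zero.
      eigenvalue-unique : ∀ {κ μ v w} → Pos κ → Pos μ → Eigenvector κ v → Eigenvector μ w →
        ¬ (∀ i → v i ≈ 0#) → ¬ (∀ i → w i ≈ 0#) → κ - μ ≈ 0#
      eigenvalue-unique {κ} {μ} {v} {w} κ>0 μ>0 ev ew v≉0 w≉0 = stable-≈0 λ κ≉μ →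
        let vw≈0 : dot v w ≈ 0#
            vw≈0 = *-zero-≉ κ≉μ (trans
              (trans (solve 3 (λ k m d → (k :- m) :* d := k :* d :- m :* d) refl κ μ _)
                (+-cong (trans (*-congˡ (B-sym E v w)) (trans (sym (eigenvector-value ev w)) (B-sym F w v)))
                        (-‿cong (sym (eigenvector-value ew v)))))
              (-‿inverseʳ _))
            a = ⟨ ℓ ⟩ w
            b = - ⟨ ℓ ⟩ v
            value : - B F (comb v w) (comb v w) ≈ - (a * a * (κ * ‖ v ‖²) + b * b * (μ * ‖ w ‖²))
            value = -‿cong (trans (B-binomial F a b v w) (+-cong
              (trans (+-cong (*-congˡ (eigenvector-value ev v))
                (zero-term (trans (eigenvector-value ew v) (zero-term vw≈0)))) (+-identityʳ _))
              (*-congˡ (eigenvector-value ew w))))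
        in ≉0⇒¬¬Pos (NonNeg-‖‖² v) (λ e → v≉0 (‖‖²-zero e)) λ v>0 →
          w≉0 (eigenvector-zero μ>0 ew (²-zero (*-zero-Pos (Pos-* κ>0 v>0) (trans (*-comm _ _)
            (NonNeg-+-zeroˡ
              (NonNeg-* (NonNeg-² a) (Pos⇒NonNeg (Pos-* κ>0 v>0)))
              (NonNeg-* (NonNeg-² b) (NonNeg-* (Pos⇒NonNeg μ>0) (NonNeg-‖‖² w)))
              (NonNeg-resp value (h _ (ℓ-comb v w))))))))

-- Matrices in coordinates, and the form of J - Σ_c P_c P_cᵀ

module Incidence (O : OrderedRing) where
  open Signature O

  sum-zero : ∀ {n} {f : V n} → (∀ k → f k ≈ 0#) → sum f ≈ 0#
  sum-zero {n} f≈0 = trans (sum-cong-≋ f≈0) (sum-replicate-zero n)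

  sum-single : ∀ {n} (f : V n) p → (∀ k → k ≢ p → f k ≈ 0#) → sum f ≈ f p
  sum-single f zero f≈0 = trans (+-congˡ (sum-zero (λ k → f≈0 (suc k) λ ()))) (+-identityʳ _)
  sum-single f (suc p) f≈0 = trans
    (+-cong (f≈0 zero λ ()) (sum-single (f ∘ suc) p (λ k k≢p → f≈0 (suc k) (k≢p ∘ suc-injective))))
    (+-identityˡ _)

  sum-pair : ∀ {n} (f : V n) {p q} → p ≢ q → (∀ k → k ≢ p → k ≢ q → f k ≈ 0#) → sum f ≈ f p + f q
  sum-pair f {zero} {zero} p≢q f≈0 = ⊥-elim (p≢q ≡.refl)
  sum-pair f {zero} {suc q} p≢q f≈0 = +-congˡ (sum-single (f ∘ suc) q
    (λ k k≢q → f≈0 (suc k) (λ ()) (k≢q ∘ suc-injective)))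
  sum-pair f {suc p} {zero} p≢q f≈0 = trans (+-congˡ (sum-single (f ∘ suc) p
    (λ k k≢p → f≈0 (suc k) (k≢p ∘ suc-injective) (λ ())))) (+-comm _ _)
  sum-pair f {suc p} {suc q} p≢q f≈0 = trans (+-cong (f≈0 zero (λ ()) (λ ()))
    (sum-pair (f ∘ suc) (p≢q ∘ ≡.cong suc)
      (λ k k≢p k≢q → f≈0 (suc k) (k≢p ∘ suc-injective) (k≢q ∘ suc-injective)))) (+-identityˡ _)

  basis : ∀ {n} → Fin n → V n
  basis u k = if ⌊ u ≟ k ⌋ then 1# else 0#

  basis-≡ : ∀ {n} (u : Fin n) → basis u u ≈ 1#
  basis-≡ u with u ≟ u
  ... | yes _ = refl
  ... | no u≢u = ⊥-elim (u≢u ≡.refl)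

  basis-≢ : ∀ {n} {u k : Fin n} → u ≢ k → basis u k ≈ 0#
  basis-≢ {u = u} {k} u≢k with u ≟ k
  ... | yes u≡k = ⊥-elim (u≢k u≡k)
  ... | no _ = refl

  dot-basis : ∀ {n} (u : Fin n) x → dot (basis u) x ≈ x u
  dot-basis u x = trans
    (sum-single _ u (λ k k≢u → trans (*-congʳ (basis-≢ (k≢u ∘ ≡.sym))) (zeroˡ _)))
    (trans (*-congʳ (basis-≡ u)) (*-identityˡ _))

  matrixForm-basis : ∀ {n} (A : Fin n → V n) A-sym u v →
    B (matrixForm A A-sym) (basis u) (basis v) ≈ A u v
  matrixForm-basis A A-sym u v = trans (dot-basis u _)
    (trans (sum-cong-≋ (λ j → *-comm (A u j) (basis v j))) (dot-basis v (A u)))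

  *ᴹ-congˡ : ∀ {n} (A A′ : Fin n → V n) → (∀ i j → A i j ≈ A′ i j) → ∀ x → A *ᴹ x ≋ A′ *ᴹ x
  *ᴹ-congˡ A A′ e x i = sum-cong-≋ (λ j → *-congʳ (e i j))

  eigenvector-cong : ∀ {n} (A A′ : Fin n → V n) → (∀ i j → A i j ≈ A′ i j) → ∀ μ v →
    A *ᴹ v ≋ μ ⊙ v → A′ *ᴹ v ≋ μ ⊙ v
  eigenvector-cong A A′ e μ v ev i = trans (sym (*ᴹ-congˡ A A′ e v i)) (ev i)

  minus-zero⇒≈ : ∀ x y → x - y ≈ 0# → x ≈ y
  minus-zero⇒≈ x y e = trans (solve 2 (λ x y → x := x :- y :+ y) refl x y)
    (trans (+-congʳ e) (+-identityˡ y))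

  ones : ∀ {n} → V n
  ones _ = 1#

  -- If A = J - Σ_c P_c P_cᵀ with J the all-ones matrix, then
  -- xᵀ A x = (Σ x)² - Σ_c (P_c · x)².
  module _ {n k} (A : Fin n → V n) (A-sym : ∀ i j → A i j ≈ A j i) (P : Fin k → V n)
    (A≈J-PPᵀ : ∀ i j → A i j ≈ 1# - sum (λ c → P c i * P c j)) where

    private
      d : V n → V k
      d x c = dot (P c) x

      entry : ∀ i j x → A i j * x ≈ 1# * x + sum (λ c → - P c i * (P c j * x))
      entry i j x = trans (*-congʳ (A≈J-PPᵀ i j)) (trans
        (solve 3 (λ o q x → (o :- q) :* x := o :* x :+ q :* :- x) refl 1# _ x)
        (+-congˡ (trans (*-comm _ _) (trans (*-distribˡ-sum (- x) (λ c → P c i * P c j))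
          (sum-cong-≋ (λ c → solve 3 (λ x p q → :- x :* (p :* q) := :- p :* (q :* x)) refl x (P c i) (P c j)))))))

      row-value : ∀ x i → (A *ᴹ x) i ≈ dot ones x + sum (λ c → - P c i * d x c)
      row-value x i = trans (sum-cong-≋ (λ j → entry i j (x j))) (trans
        (∑-distrib-+ (λ j → 1# * x j) (λ j → sum (λ c → - P c i * (P c j * x j))))
        (+-congˡ (trans (∑-comm (λ j c → - P c i * (P c j * x j)))
          (sum-cong-≋ (λ c → sym (*-distribˡ-sum (- P c i) (λ j → P c j * x j)))))))

    form-value : ∀ x → - B (matrixForm A A-sym) x x ≈ ‖ d x ‖² - dot ones x * dot ones x
    form-value x = trans (-‿cong (trans
      (sum-cong-≋ (λ i → trans (*-congˡ (row-value x i)) (trans (distribˡ _ _ _) (+-cong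
        (trans (*-comm _ _) (*-congˡ (sym (*-identityˡ _))))
        (trans (*-distribˡ-sum (x i) (λ c → - P c i * d x c)) (sum-cong-≋ (λ c →
          solve 3 (λ x p d → x :* (:- p :* d) := :- d :* (p :* x)) refl (x i) (P c i) (d x c))))))))
      (trans (∑-distrib-+ (λ i → s * (1# * x i)) (λ i → sum (λ c → - d x c * (P c i * x i))))
        (+-cong (sym (*-distribˡ-sum s (λ i → 1# * x i)))
          (trans (∑-comm (λ i c → - d x c * (P c i * x i)))
            (sum-cong-≋ (λ c → sym (*-distribˡ-sum (- d x c) (λ i → P c i * x i)))))))))
      (trans (solve 3 (λ s n m → :- (s :* s :+ m) := (n :- s :* s) :- (n :+ m)) refl s ‖ d x ‖² _)
        (trans (+-congˡ (trans (-‿cong (trans (sym (∑-distrib-+ (λ c → d x c * d x c) (λ c → - d x c * d x c)))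
            (sum-zero (λ c → trans (solve 1 (λ d → d :* d :+ :- d :* d := con 0ℚ) refl (d x c)) 0-homo))))
          -0#≈0#)) (+-identityʳ _)))
      where s = dot ones x

    nonpositive-on-hyperplane : ∀ x → dot ones x ≈ 0# → NonNeg (- B (matrixForm A A-sym) x x)
    nonpositive-on-hyperplane x s≈0 = NonNeg-resp (sym (trans (form-value x)
      (trans (+-congˡ (trans (-‿cong (zero-term s≈0)) -0#≈0#)) (+-identityʳ _)))) (NonNeg-‖‖² (d x))

  sum-parts : ∀ {n k} (m : Fin n → Bool) (part : Fin n → Fin k) i j →
    sum (λ c → (if m i then basis (part i) c else 0#) * (if m j then basis (part j) c else 0#)) ≈
    (if m i ∧ m j ∧ ⌊ part i ≟ part j ⌋ then 1# else 0#)
  sum-parts {k = k} m part i j with m i | m j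
  ... | false | b = sum-zero {k} {λ c → 0# * (if b then basis (part j) c else 0#)} (λ c → zeroˡ _)
  ... | true | false = sum-zero {k} {λ c → basis (part i) c * 0#} (λ c → zeroʳ _)
  ... | true | true = trans (dot-basis (part i) (basis (part j))) (swap (part i) (part j))
    where
    swap : ∀ {k} (p q : Fin k) → basis q p ≈ basis p q
    swap p q with p ≟ q | q ≟ p
    ... | yes _ | yes _ = refl
    ... | no _ | no _ = refl
    ... | yes p≡q | no q≢p = ⊥-elim (q≢p (≡.sym p≡q))
    ... | no p≢q | yes q≡p = ⊥-elim (p≢q (≡.sym q≡p))

-- Eigenvalues at the boundary between two sign conditions

module Spectrum (O : OrderedRing) where
  open Signature O public
  open Inertia O (λ X → ¬ ¬ X) (λ x k → k x) ¬¬-bind trichotomy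

  -- N holds arbitrarily close above μ, respectively P below μ; closeness is
  -- expressed by the strict inequalities that have to survive.
  Above Below : (Carrier → Set) → Carrier → Set
  Above N μ = ∀ p s q t → Pos p → Pos q →
    ∃[ κ ] NonNeg (κ - μ) × Pos (p - (κ - μ) * s) × Pos (q - (κ - μ) * t) × N κ
  Below P μ = ∀ c K → Pos c → ∃[ κ ] Pos (c - (μ - κ) * K) × P κ

  Pos-perturb : ∀ {p s e C ε} → NonNeg C → NonNeg (C - s) → NonNeg e → NonNeg (ε - e) →
    Pos (p - C * ε) → Pos (p - e * s)
  Pos-perturb {p} {s} {e} {C} {ε} C≥0 s≤C e≥0 e≤ε p>Cε = Pos-resp
    (solve 5 (λ p s e C ε → (p :- C :* ε) :+ (C :* (ε :- e) :+ e :* (C :- s)) := p :- e :* s) refl p s e C ε)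
    (Pos-+-NonNeg p>Cε (NonNeg-+ (NonNeg-* C≥0 e≤ε) (NonNeg-* e≥0 s≤C)))

  module _ {n} (A : Fin n → V n) (A-sym : ∀ i j → A i j ≈ A j i) where
    private
      F = matrixForm A A-sym
      E = euclidean n

    shifted : Carrier → SymmetricForm n
    shifted μ = shift F (- μ)

    -- `AtMostOnePositive` is the Courant-Fischer description of positive index at most one.
    Positive AtMostOnePositive : Carrier → Set
    Positive μ = ∃[ x ] Pos (B (shifted μ) x x)
    AtMostOnePositive μ = Σ[ ℓ ∈ LinearForm n ] (∀ z → ⟨ ℓ ⟩ z ≈ 0# → NonNeg (- B (shifted μ) z z))

    shifted-cong : ∀ {μ κ} → μ ≈ κ → ∀ x y → B (shifted μ) x y ≈ B (shifted κ) x y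
    shifted-cong e x y = +-congˡ (*-congʳ (-‿cong e))

    shifted-0 : ∀ x y → B F x y ≈ B (shifted 0#) x y
    shifted-0 x y = trans (sym (+-identityʳ _)) (+-congˡ (trans (sym (zeroˡ _)) (*-congʳ (sym -0#≈0#))))

    hyperplane-negative : ∀ {q μ} (ℓ : LinearForm n) → Pos q → ∀ z →
      NonNeg (- B (rankOneUpdate q (shifted μ) (- one) ℓ) z z) → ⟨ ℓ ⟩ z ≈ 0# → NonNeg (- B (shifted μ) z z)
    hyperplane-negative {q} ℓ q>0 z h ℓz≈0 = NonNeg-cancelˡ q>0 (NonNeg-resp
      (trans (-‿cong (trans (+-congˡ (zero-term (trans (*-congʳ ℓz≈0) (zeroˡ _)))) (+-identityʳ _)))
        (solve 2 (λ q f → :- (q :* f) := q :* :- f) refl q _)) h)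

    private
      shifted-shift : ∀ μ κ z → B (shifted κ) z z ≈ B (shifted μ) z z - (κ - μ) * ‖ z ‖²
      shifted-shift μ κ z = solve 4 (λ f m k n → f :+ :- k :* n := f :+ :- m :* n :- (k :- m) :* n) refl _ μ κ _

      -- Lowering the shift from μ to κ raises the form by (μ - κ)‖z‖², which definiteness absorbs
      -- while (μ - κ)K stays below c.
      definite-below : ∀ {μ κ c K} → Pos K → Pos (c - (μ - κ) * K) → ∀ z →
        NonNeg (K * (- B (shifted μ) z z) - c * ‖ z ‖²) → NonNeg (- B (shifted κ) z z)
      definite-below {μ} {κ} {c} {K} K>0 small z h = NonNeg-cancelˡ K>0 (NonNeg-resp
        (trans (solve 6 (λ K f c n m k → (K :* :- f :- c :* n) :+ (c :- (m :- k) :* K) :* n := K :* :- (f :- (k :- m) :* n))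
                 refl K _ c _ μ κ)
               (*-congˡ (-‿cong (sym (shifted-shift μ κ z)))))
        (NonNeg-+ h (NonNeg-* (Pos⇒NonNeg small) (NonNeg-‖‖² z))))

      null⇒eigenvector : ∀ {μ v} → NegSemidefinite (shifted μ) → B (shifted μ) v v ≈ 0# → Eigenvector A A-sym μ v
      null⇒eigenvector {μ} {v} nsd e = kernel⇒eigenvector A A-sym μ v (isotropic⇒kernel (shifted μ) nsd v e)

    -- A vector positive at μ would stay positive slightly above μ, where the form is negative
    -- semidefinite. Definiteness at μ would persist slightly below, where a positive vector exists.
    -- What remains is a null vector of a semidefinite form.
    largest-eigenvalue : ∀ {μ} → Above (λ κ → NegSemidefinite (shifted κ)) μ → Below Positive μ →
      ¬ ¬ (NegSemidefinite (shifted μ) × ∃[ v ] Pos ‖ v ‖² × Eigenvector A A-sym μ v)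
    largest-eigenvalue {μ} above below k = inertia (shifted μ) λ where
      (positive x p) →
        let κ , _ , small , _ , nsd = above _ ‖ x ‖² _ ‖ x ‖² p p
        in NonNeg⇒¬Pos- (nsd x) (Pos-resp (sym (shifted-shift μ κ x)) small)
      (degenerate nsd v v>0 Bvv≈0) → k (nsd , v , v>0 , null⇒eigenvector nsd Bvv≈0)
      (definite c K c>0 K>0 h) →
        let κ , small , x , p = below c K c>0
        in NonNeg⇒¬Pos- (definite-below K>0 small x (h x)) p

    module _ {μ} (above : Above AtMostOnePositive μ) (below : Below (TwoPositive ∘ shifted) μ) where
      private
        H = shifted μ

      -- Both positive directions must survive at one common κ, which is why `Above` delivers two
      -- strict inequalities at once.
      ¬twoPositive : ¬ TwoPositive H
      ¬twoPositive (x , y , p , q , o) =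
        let κ , κ≥μ , small , small′ , ℓ , h = above _ (two * ‖ x ‖²) _ (two * ‖ y ‖²) p q
        in twoPositive-bound H ℓ κ≥μ (λ z ℓz≈0 → NonNeg-resp
          (trans (-‿cong (shifted-shift μ κ z)) (solve 2 (λ f n → :- (f :- n) := n :- f) refl _ _)) (h z ℓz≈0))
          o small small′

      private
        -- Definiteness on a hyperplane would leave the form nonpositive there slightly below μ,
        -- which is incompatible with two positive directions.
        ¬definite-on-hyperplane : (ℓ : LinearForm n) → ∀ {c K} → Pos c → Pos K →
          ¬ (∀ z → ⟨ ℓ ⟩ z ≈ 0# → NonNeg (K * (- B H z z) - c * ‖ z ‖²))
        ¬definite-on-hyperplane ℓ {c} {K} c>0 K>0 h =
          let κ , small , tp = below c K c>0
          in twoPositive-contradiction (shifted κ) ℓ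
            (λ z ℓz≈0 → definite-below K>0 small z (h z ℓz≈0)) tp

      -- In `SimpleSecond` a direction is still positive at μ, so a larger eigenvalue has to be
      -- found; in `DoubleLargest` μ alone contradicts simplicity.
      SimpleSecond DoubleLargest : Set
      SimpleSecond = (∃[ x ] Pos (B H x x)) × (∃[ z ] Pos ‖ z ‖² × Eigenvector A A-sym μ z)
      DoubleLargest = ∃[ v ] ∃[ w ] Pos ‖ v ‖² × Pos ‖ w ‖² × dot v w ≈ 0# ×
        Eigenvector A A-sym μ v × Eigenvector A A-sym μ w

      private
        -- Doubling the rank-one term makes the form negative on x while
        -- keeping the kernel of H.
        simpleSecond : ∀ x → Pos (B H x x) → ¬ ¬ SimpleSecond
        simpleSecond x x>0 k = inertia C λ where
            -- Adding back one copy of the square turns `C` into `deflate H x`, so a positive vector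
            -- of `C` would give H a second positive direction.
            (positive y p) → ¬twoPositive (deflate-positive H {x} {y} x>0 (Pos-resp
              (solve 3 (λ q f s → q :* f :+ :- con (1ℚ ℚ.+ 1ℚ) :* (s :* s) :+ s :* s := q :* f :+ :- con 1ℚ :* (s :* s))
                refl q _ _) (Pos-+-NonNeg p (NonNeg-² (B H x y)))))
            (degenerate nsd z z>0 Czz≈0) →
              let ker = isotropic⇒kernel C nsd z Czz≈0
                  xz≈0 : B H x z ≈ 0#
                  xz≈0 = *-zero-Pos x>0 (trans (trans
                    (solve 2 (λ q s → q :* s := :- (q :* s :+ :- con (1ℚ ℚ.+ 1ℚ) :* (s :* q))) refl q _)
                    (-‿cong (trans (+-congʳ (*-congˡ (B-sym H x z))) (ker x)))) -0#≈0#)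
              in k ((x , x>0) , z , z>0 , kernel⇒eigenvector A A-sym μ z λ y → *-zero-Pos x>0
                (trans (sym (+-identityʳ _)) (trans (+-congˡ (sym (zero-term (trans (*-congʳ xz≈0) (zeroˡ _))))) (ker y))))
            (definite c K c>0 K>0 h) → ¬definite-on-hyperplane (row H x) c>0 (Pos-* K>0 x>0) λ z xz≈0 →
              NonNeg-resp (+-congʳ (trans (*-congˡ (-‿cong (trans
                  (+-congˡ (zero-term (trans (*-congʳ xz≈0) (zeroˡ _)))) (+-identityʳ _))))
                (solve 3 (λ K q f → K :* :- (q :* f) := K :* q :* :- f) refl K q _))) (h z)
          where
          q = B H x x
          C = rankOneUpdate q H (- two) (row H x)

        -- Subtracting ⟨v,·⟩² removes `v` from the kernel. Since -C is a sum of two nonnegative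
        -- terms, a null vector of `C` is null for H and orthogonal to `v`; a definite `C` would
        -- make H definite on the hyperplane orthogonal to `v`.
        doubleLargest : NegSemidefinite H → ∀ v → Pos ‖ v ‖² → B H v v ≈ 0# → ¬ ¬ DoubleLargest
        doubleLargest nsd v v>0 Bvv≈0 k = inertia C λ where
            (positive y p) → NonNeg⇒¬Pos- (C-nsd y) p
            (degenerate _ w w>0 Cww≈0) →
              let zero-sum = ≈0⇒NonNeg (trans (-‿cong (trans (sym (C-value w)) (trans (-‿cong Cww≈0) -0#≈0#))) -0#≈0#)
                  Bww≈0 : B H w w ≈ 0#
                  Bww≈0 = trans (solve 1 (λ x → x := :- (:- x)) refl _) (trans (-‿cong
                    (NonNeg-+-zeroˡ (nsd w) (NonNeg-² (dot v w)) zero-sum)) -0#≈0#)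
                  vw≈0 : dot v w ≈ 0#
                  vw≈0 = ²-zero (NonNeg-+-zeroˡ (NonNeg-² (dot v w)) (nsd w)
                    (NonNeg-resp (-‿cong (+-comm _ _)) zero-sum))
              in k (v , w , v>0 , w>0 , vw≈0 , null⇒eigenvector nsd Bvv≈0 , null⇒eigenvector nsd Bww≈0)
            (definite c K c>0 K>0 h) → ¬definite-on-hyperplane (row E v) c>0 K>0 λ z vz≈0 →
              NonNeg-resp (+-congʳ (*-congˡ (trans (C-value z)
                (trans (+-congˡ (trans (*-congʳ vz≈0) (zeroˡ _))) (+-identityʳ _))))) (h z)
          where
          C = rankOneUpdate one H (- one) (row E v)
          C-value = subtract-square H (row E v)
          C-nsd = subtract-square-negSemidefinite H (row E v) nsd

      second-eigenvalue : ¬ ¬ (SimpleSecond ⊎ DoubleLargest)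
      second-eigenvalue k = inertia H λ where
        (positive x p) → simpleSecond x p (k ∘ inj₁)
        (degenerate nsd v v>0 Bvv≈0) → doubleLargest nsd v v>0 Bvv≈0 (k ∘ inj₂)
        -- The zero linear form serves as hyperplane condition, as H is definite on the whole space.
        (definite c K c>0 K>0 h) → ¬definite-on-hyperplane (row E (λ _ → 0#)) c>0 K>0 (λ z _ → h z)

  orthogonal⇒independent : ∀ {n} {v w : V n} → Pos ‖ v ‖² → Pos ‖ w ‖² → dot v w ≈ 0# →
    ∀ a b → a ⊙ v ⊕ b ⊙ w ≋ (λ _ → 0#) → a ≈ 0# × b ≈ 0#
  orthogonal⇒independent {n} {v} {w} v>0 w>0 vw≈0 a b comb≈0 =
    *-zero-Pos v>0 (trans (*-comm _ _) (trans (sym (+-identityʳ _)) (trans (+-congˡ (sym (zero-term vw≈0)))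
      (trans (sym (B-comb E a b v w v)) (dot-zero v))))) ,
    *-zero-Pos w>0 (trans (*-comm _ _) (trans (sym (+-identityˡ _)) (trans
      (+-congʳ (sym (zero-term (trans (B-sym E w v) vw≈0))))
      (trans (sym (B-comb E a b v w w)) (dot-zero w)))))
    where
    E = euclidean n
    dot-zero : ∀ x → dot x (a ⊙ v ⊕ b ⊙ w) ≈ 0#
    dot-zero x = trans (sum-cong-≋ (λ i → zero-term (comb≈0 i))) (sum-replicate-zero n)

open import Defs
open ≡ using (refl; sym; trans; cong; cong₂; subst; subst₂)

-- The ordered fields ℚ and ℝ

0<-cong : ∀ {x y} → x ≡ y → 0ℚ ℚ.< x → 0ℚ ℚ.< y
0<-cong = subst (0ℚ ℚ.<_)

<⇒0<- : ∀ {p q} → p ℚ.< q → 0ℚ ℚ.< q ℚ.- p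
<⇒0<- {p} {q} p<q = subst (ℚ._< q ℚ.- p) (ℚₚ.+-inverseʳ p) (ℚₚ.+-monoˡ-< (ℚ.- p) p<q)

0<-⇒< : ∀ {p q} → 0ℚ ℚ.< q ℚ.- p → p ℚ.< q
0<-⇒< {p} {q} h = subst₂ ℚ._<_ (ℚₚ.+-identityˡ p)
  (solve 2 (λ p q → q :- p :+ p := q) refl p q) (ℚₚ.+-monoˡ-< p h)
  where open +-*-Solver

0<-+ : ∀ {p q} → 0ℚ ℚ.< p → 0ℚ ℚ.< q → 0ℚ ℚ.< p ℚ.+ q
0<-+ = ℚₚ.+-mono-<

0<-* : ∀ {p q} → 0ℚ ℚ.< p → 0ℚ ℚ.< q → 0ℚ ℚ.< p ℚ.* q
0<-* {p} {q} 0<p 0<q = ℚₚ.positive⁻¹ _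
  {{ℚₚ.pos*pos⇒pos p {{ℚ.positive 0<p}} q {{ℚ.positive 0<q}}}}

0<½ : 0ℚ ℚ.< ½
0<½ = ℚₚ.positive⁻¹ ½

0<1 : 0ℚ ℚ.< 1ℚ
0<1 = ℚₚ.positive⁻¹ 1ℚ

ℚ-orderedRing : OrderedRing
ℚ-orderedRing = record
  { commutativeRing = ℚₚ.+-*-commutativeRing
  ; ⟦_⟧ = id
  ; +-homo = λ _ _ → refl ; *-homo = λ _ _ → refl ; -‿homo = λ _ → refl
  ; 0-homo = refl ; 1-homo = refl
  ; Pos = 0ℚ ℚ.<_
  ; Pos-resp = 0<-cong
  ; Pos-1 = 0<1
  ; Pos-+ = 0<-+
  ; Pos-* = 0<-*
  ; Pos-split = split
  ; ¬Pos-0 = ℚₚ.<-irrefl refl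
  ; tight = λ np nn → ℚₚ.≤-antisym (ℚₚ.≮⇒≥ np) (ℚₚ.≮⇒≥ λ p → nn (ℚₚ.neg-antimono-< p))
  }
  where
  split : ∀ {x y} → 0ℚ ℚ.< x ℚ.+ y → 0ℚ ℚ.< x ⊎ 0ℚ ℚ.< y
  split {x} {y} p with 0ℚ ℚₚ.<? x | 0ℚ ℚₚ.<? y
  ... | yes q | _ = inj₁ q
  ... | no _ | yes q = inj₂ q
  ... | no q | no r = ⊥-elim (ℚₚ.<-irrefl refl (ℚₚ.<-≤-trans p (ℚₚ.+-mono-≤ (ℚₚ.≮⇒≥ q) (ℚₚ.≮⇒≥ r))))

ℚ-sign : ∀ x → 0ℚ ℚ.< x ⊎ x ≡ 0ℚ ⊎ 0ℚ ℚ.< ℚ.- x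
ℚ-sign x with ℚₚ.<-cmp x 0ℚ
... | tri< p _ _ = inj₂ (inj₂ (ℚₚ.neg-antimono-< p))
... | tri≈ _ p _ = inj₂ (inj₁ p)
... | tri> _ _ p = inj₁ p

p≤∣p∣ : ∀ p → p ℚ.≤ ∣ p ∣
p≤∣p∣ p with 0ℚ ℚₚ.≤? p
... | yes 0≤p = ℚₚ.≤-reflexive (sym (ℚₚ.0≤p⇒∣p∣≡p 0≤p))
... | no 0≰p = ℚₚ.≤-trans (ℚₚ.<⇒≤ (ℚₚ.≰⇒> 0≰p)) (ℚₚ.0≤∣p∣ p)

∣∣<-intro : ∀ {p ε} → p ℚ.< ε → ℚ.- p ℚ.< ε → ∣ p ∣ ℚ.< ε
∣∣<-intro {p} {ε} h₁ h₂ with ℚₚ.∣p∣≡p∨∣p∣≡-p p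
... | inj₁ e = subst (ℚ._< ε) (sym e) h₁
... | inj₂ e = subst (ℚ._< ε) (sym e) h₂

halves : ∀ ε → ε ℚ.* ½ ℚ.+ ε ℚ.* ½ ≡ ε
halves ε = trans (sym (ℚₚ.*-distribˡ-+ ε ½ ½)) (ℚₚ.*-identityʳ ε)

0<half : ∀ {ε} → 0ℚ ℚ.< ε → 0ℚ ℚ.< ε ℚ.* ½
0<half p = 0<-* p 0<½

half< : ∀ {ε} → 0ℚ ℚ.< ε → ε ℚ.* ½ ℚ.< ε
half< {ε} p = 0<-⇒< (0<-cong (solve 1 (λ e → e :* con ½ := e :- e :* con ½) refl ε) (0<half p))
  where open +-*-Solver

quotient : ∀ {B ε} → 0ℚ ℚ.< B → 0ℚ ℚ.< ε → Σ[ δ ∈ ℚ ] 0ℚ ℚ.< δ × B ℚ.* δ ≡ ε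
quotient {B} {ε} 0<B 0<ε = ℚ.1/ B ℚ.* ε ,
  0<-* (ℚₚ.positive⁻¹ (ℚ.1/ B) {{ℚₚ.1/pos⇒pos B}}) 0<ε ,
  trans (sym (ℚₚ.*-assoc B (ℚ.1/ B) ε)) (trans (cong (ℚ._* ε) (ℚₚ.*-inverseʳ B)) (ℚₚ.*-identityˡ ε))
  where
  instance
    B-positive : ℚ.Positive B
    B-positive = ℚ.positive 0<B
    B-nonZero : ℚ.NonZero B
    B-nonZero = ℚₚ.pos⇒nonZero B

-- `x ≈ y` unfolds to `Null` of the termwise difference, so the congruence laws reduce to closure
-- properties of null sequences.
Null : (ℕ → ℚ) → Set
Null s = ∀ ε → 0ℚ ℚ.< ε → ∃[ N ] (∀ n → N ℕ.≤ n → ∣ s n ∣ ℚ.< ε)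

Null-resp : ∀ {s t} → (∀ n → s n ≡ t n) → Null s → Null t
Null-resp e h ε p = let N , f = h ε p in N , λ n n≥ → subst (λ z → ∣ z ∣ ℚ.< ε) (e n) (f n n≥)

Null-0 : ∀ {s} → (∀ n → s n ≡ 0ℚ) → Null s
Null-0 e ε p = 0 , λ n _ → subst (λ z → ∣ z ∣ ℚ.< ε) (sym (e n)) p

Null-+ : ∀ {s t} → Null s → Null t → Null (λ n → s n ℚ.+ t n)
Null-+ {s} {t} h k ε p =
  let M , f = h (ε ℚ.* ½) (0<half p)
      N , g = k (ε ℚ.* ½) (0<half p)
  in M ℕ.⊔ N , λ n n≥ → ℚₚ.≤-<-trans (ℚₚ.∣p+q∣≤∣p∣+∣q∣ (s n) (t n))
    (subst (_ ℚ.<_) (halves ε) (ℚₚ.+-mono-< (f n (ℕₚ.m⊔n≤o⇒m≤o M N n≥)) (g n (ℕₚ.m⊔n≤o⇒n≤o M N n≥))))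

Null-neg : ∀ {s} → Null s → Null (λ n → ℚ.- s n)
Null-neg {s} h ε p = let N , f = h ε p in
  N , λ n n≥ → subst (ℚ._< ε) (sym (ℚₚ.∣-p∣≡∣p∣ (s n))) (f n n≥)

bounded : ∀ x → Σ[ C ∈ ℚ ] 0ℚ ℚ.< C × ∃[ N ] (∀ n → N ℕ.≤ n → ∣ seq x n ∣ ℚ.< C)
bounded x =
  let N , f = isCauchy x 1ℚ 0<1
      p = seq x N
  in 1ℚ ℚ.+ ∣ p ∣ , ℚₚ.+-mono-<-≤ 0<1 (ℚₚ.0≤∣p∣ p) , N , λ n n≥ →
    ℚₚ.≤-<-trans
      (subst (λ z → ∣ z ∣ ℚ.≤ ∣ seq x n ℚ.- p ∣ ℚ.+ ∣ p ∣)
        (solve 2 (λ a p → a :- p :+ p := a) refl (seq x n) p) (ℚₚ.∣p+q∣≤∣p∣+∣q∣ (seq x n ℚ.- p) p))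
      (ℚₚ.+-monoˡ-< ∣ p ∣ (f n N n≥ ℕₚ.≤-refl))
  where open +-*-Solver

Null-* : ∀ x {s} → Null s → Null (λ n → seq x n ℚ.* s n)
Null-* x {s} h ε p =
  let C , 0<C , M , f = bounded x
      δ , 0<δ , Cδ≡ε = quotient 0<C p
      N , g = h δ 0<δ
  in M ℕ.⊔ N , λ n n≥ → subst₂ ℚ._<_ (sym (ℚₚ.∣p*q∣≡∣p∣*∣q∣ (seq x n) (s n))) Cδ≡ε
    (ℚₚ.≤-<-trans
      (ℚₚ.*-monoʳ-≤-nonNeg ∣ s n ∣ {{ℚ.nonNegative (ℚₚ.0≤∣p∣ (s n))}}
        (ℚₚ.<⇒≤ (f n (ℕₚ.m⊔n≤o⇒m≤o M N n≥))))
      (ℚₚ.*-monoʳ-<-pos C {{ℚ.positive 0<C}} (g n (ℕₚ.m⊔n≤o⇒n≤o M N n≥))))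

infix 8 -_
-_ : ℝ → ℝ
- x = mkℝ (λ n → ℚ.- seq x n) λ ε p → let N , f = isCauchy x ε p in
  N , λ m n m≥ n≥ → subst (ℚ._< ε)
    (trans (sym (ℚₚ.∣-p∣≡∣p∣ _)) (cong ∣_∣
      (solve 2 (λ a b → :- (a :- b) := :- a :- :- b) refl (seq x m) (seq x n))))
    (f m n m≥ n≥)
  where open +-*-Solver

≗⇒≈ : ∀ {x y} → (∀ n → seq x n ≡ seq y n) → x ≈ y
≗⇒≈ {x} {y} e = Null-0 {λ n → seq x n ℚ.- seq y n}
  λ n → trans (cong (ℚ._- seq y n) (e n)) (ℚₚ.+-inverseʳ (seq y n))

≈-refl : ∀ {x} → x ≈ x
≈-refl {x} = ≗⇒≈ {x} {x} λ _ → refl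

≈-sym : ∀ {x y} → x ≈ y → y ≈ x
≈-sym {x} {y} h = Null-resp
  (λ n → solve 2 (λ a b → :- (a :- b) := b :- a) refl (seq x n) (seq y n)) (Null-neg h)
  where open +-*-Solver

≈-trans : ∀ {x y z} → x ≈ y → y ≈ z → x ≈ z
≈-trans {x} {y} {z} h k = Null-resp
  (λ n → solve 3 (λ a b c → a :- b :+ (b :- c) := a :- c) refl (seq x n) (seq y n) (seq z n))
  (Null-+ h k)
  where open +-*-Solver

ℝ-isCommutativeRing : IsCommutativeRing _≈_ _+_ _*_ -_ 0ℝ 1ℝ
ℝ-isCommutativeRing = record
  { isRing = record
    { +-isAbelianGroup = record
      { isGroup = record
        { isMonoid = record
          { isSemigroup = record
            { isMagma = record
              { isEquivalence = record
                { refl = λ {x} → ≈-refl {x}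
                ; sym = λ {x} {y} → ≈-sym {x} {y}
                ; trans = λ {x} {y} {z} → ≈-trans {x} {y} {z} }
              ; ∙-cong = λ {x} {y} {u} {v} h k → Null-resp
                  (λ n → solve 4 (λ x y u v → (x :- y) :+ (u :- v) := (x :+ u) :- (y :+ v)) refl
                    (seq x n) (seq y n) (seq u n) (seq v n)) (Null-+ h k)
              }
            ; assoc = λ x y z → ≗⇒≈ {x + y + z} {x + (y + z)} λ n → ℚₚ.+-assoc (seq x n) (seq y n) (seq z n) }
          ; identity = (λ x → ≗⇒≈ {0ℝ + x} {x} λ n → ℚₚ.+-identityˡ _)
                     , (λ x → ≗⇒≈ {x + 0ℝ} {x} λ n → ℚₚ.+-identityʳ _) }
        ; inverse = (λ x → ≗⇒≈ {(- x) + x} {0ℝ} λ n → ℚₚ.+-inverseˡ (seq x n))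
                  , (λ x → ≗⇒≈ {x + (- x)} {0ℝ} λ n → ℚₚ.+-inverseʳ (seq x n))
        ; ⁻¹-cong = λ {x} {y} h → Null-resp
            (λ n → solve 2 (λ a b → :- (a :- b) := :- a :- :- b) refl (seq x n) (seq y n))
            (Null-neg h)
        }
      ; comm = λ x y → ≗⇒≈ {x + y} {y + x} λ n → ℚₚ.+-comm (seq x n) (seq y n) }
    ; *-cong = λ {x} {y} {u} {v} h k → Null-resp
        (λ n → solve 4 (λ x y u v → x :* (u :- v) :+ v :* (x :- y) := x :* u :- y :* v) refl
          (seq x n) (seq y n) (seq u n) (seq v n))
        (Null-+ (Null-* x k) (Null-* v h))
    ; *-assoc = λ x y z → ≗⇒≈ {x * y * z} {x * (y * z)} λ n → ℚₚ.*-assoc (seq x n) (seq y n) (seq z n)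
    ; *-identity = (λ x → ≗⇒≈ {1ℝ * x} {x} λ n → ℚₚ.*-identityˡ _)
                 , (λ x → ≗⇒≈ {x * 1ℝ} {x} λ n → ℚₚ.*-identityʳ _)
    ; distrib = (λ x y z → ≗⇒≈ {x * (y + z)} {x * y + x * z} λ n → ℚₚ.*-distribˡ-+ (seq x n) (seq y n) (seq z n))
              , (λ x y z → ≗⇒≈ {(y + z) * x} {y * x + z * x} λ n → ℚₚ.*-distribʳ-+ (seq x n) (seq y n) (seq z n))
    }
  ; *-comm = λ x y → ≗⇒≈ {x * y} {y * x} λ n → ℚₚ.*-comm (seq x n) (seq y n)
  }
  where open +-*-Solver

ℝ-commutativeRing : CommutativeRing 0ℓ 0ℓ
ℝ-commutativeRing = record { isCommutativeRing = ℝ-isCommutativeRing }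

EventuallyAbove : ℝ → ℚ → Set
EventuallyAbove x ε = ∃[ N ] (∀ n → N ℕ.≤ n → ε ℚ.< seq x n)

0<-intro : ∀ {x ε} → 0ℚ ℚ.< ε → EventuallyAbove x ε → 0ℝ < x
0<-intro {x} {ε} 0<ε (N , f) = ε , 0<ε , N , λ n n≥ →
  subst (ℚ._< seq x n) (sym (ℚₚ.+-identityˡ ε)) (f n n≥)

0<-elim : ∀ {x} → 0ℝ < x → Σ[ ε ∈ ℚ ] 0ℚ ℚ.< ε × EventuallyAbove x ε
0<-elim {x} (ε , 0<ε , N , f) = ε , 0<ε , N , λ n n≥ →
  subst (ℚ._< seq x n) (ℚₚ.+-identityˡ ε) (f n n≥)

-- A sample exceeding 2h, at an index beyond which the sequence oscillates by
-- less than h, certifies positivity.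
0<-sample : ∀ x {h N} → 0ℚ ℚ.< h →
  (∀ m n → N ℕ.≤ m → N ℕ.≤ n → ∣ seq x m ℚ.- seq x n ∣ ℚ.< h) → h ℚ.+ h ℚ.< seq x N → 0ℝ < x
0<-sample x {h} {N} 0<h osc above = 0<-intro {x} 0<h (N , λ n n≥ → 0<-⇒< (0<-cong
  (solve 3 (λ h a b → (a :- (h :+ h)) :+ (h :- (a :- b)) := b :- h) refl h (seq x N) (seq x n))
  (0<-+ (<⇒0<- above) (<⇒0<- (ℚₚ.≤-<-trans (p≤∣p∣ _) (osc N n ℕₚ.≤-refl n≥))))))
  where open +-*-Solver

0<-sample⁻ : ∀ x {h N} → 0ℚ ℚ.< h →
  (∀ m n → N ℕ.≤ m → N ℕ.≤ n → ∣ seq x m ℚ.- seq x n ∣ ℚ.< h) → h ℚ.+ h ℚ.< ℚ.- seq x N → 0ℝ < - x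
0<-sample⁻ x {h} {N} 0<h osc above = 0<-intro { - x} 0<h (N , λ n n≥ → 0<-⇒< (0<-cong
  (solve 3 (λ h a b → (:- a :- (h :+ h)) :+ (h :- (b :- a)) := :- b :- h) refl h (seq x N) (seq x n))
  (0<-+ (<⇒0<- above) (<⇒0<- (ℚₚ.≤-<-trans (p≤∣p∣ _) (osc n N n≥ ℕₚ.≤-refl))))))
  where open +-*-Solver

ℝ-Pos-resp : ∀ {x y} → x ≈ y → 0ℝ < x → 0ℝ < y
ℝ-Pos-resp {x} {y} x≈y 0<x =
  let ε , 0<ε , M , f = 0<-elim {x} 0<x
      N , g = x≈y (ε ℚ.* ½) (0<half 0<ε)
  in 0<-intro {y} (0<half 0<ε) (M ℕ.⊔ N , λ n n≥ → 0<-⇒< (0<-cong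
    (solve 3 (λ e a b → (a :- e) :+ (e :* con ½ :- (a :- b)) := b :- e :* con ½) refl ε (seq x n) (seq y n))
    (0<-+ (<⇒0<- (f n (ℕₚ.m⊔n≤o⇒m≤o M N n≥)))
          (<⇒0<- (ℚₚ.≤-<-trans (p≤∣p∣ _) (g n (ℕₚ.m⊔n≤o⇒n≤o M N n≥)))))))
  where open +-*-Solver

ℝ-Pos-+ : ∀ {x y} → 0ℝ < x → 0ℝ < y → 0ℝ < x + y
ℝ-Pos-+ {x} {y} 0<x 0<y =
  let δ , 0<δ , M , f = 0<-elim {x} 0<x
      ε , 0<ε , N , g = 0<-elim {y} 0<y
  in 0<-intro {x + y} (0<-+ 0<δ 0<ε) (M ℕ.⊔ N , λ n n≥ →
    ℚₚ.+-mono-< (f n (ℕₚ.m⊔n≤o⇒m≤o M N n≥)) (g n (ℕₚ.m⊔n≤o⇒n≤o M N n≥)))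

ℝ-Pos-* : ∀ {x y} → 0ℝ < x → 0ℝ < y → 0ℝ < x * y
ℝ-Pos-* {x} {y} 0<x 0<y =
  let δ , 0<δ , M , f = 0<-elim {x} 0<x
      ε , 0<ε , N , g = 0<-elim {y} 0<y
  in 0<-intro {x * y} (0<-* 0<δ 0<ε) (M ℕ.⊔ N , λ n n≥ →
    let fₙ = f n (ℕₚ.m⊔n≤o⇒m≤o M N n≥)
    in ℚₚ.<-trans (ℚₚ.*-monoʳ-<-pos δ {{ℚ.positive 0<δ}} (g n (ℕₚ.m⊔n≤o⇒n≤o M N n≥)))
         (ℚₚ.*-monoˡ-<-pos (seq y n) {{ℚ.positive (ℚₚ.<-trans 0<ε (g n (ℕₚ.m⊔n≤o⇒n≤o M N n≥)))}} fₙ))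

ℝ-Pos-split : ∀ {x y} → 0ℝ < x + y → 0ℝ < x ⊎ 0ℝ < y
ℝ-Pos-split {x} {y} p = decide
  where
  open +-*-Solver
  e = 0<-elim {x + y} p
  ε = proj₁ e
  K = proj₁ (proj₂ (proj₂ e))
  -- With h a quarter of the margin, either the sample of x exceeds 2h, or that of y exceeds ε - 2h
  -- = 2h. This is a comparison of rationals, hence decidable.
  h = ε ℚ.* ½ ℚ.* ½
  0<h : 0ℚ ℚ.< h
  0<h = 0<half (0<half (proj₁ (proj₂ e)))
  Cx = isCauchy x h 0<h
  Cy = isCauchy y h 0<h
  N = K ℕ.⊔ (proj₁ Cx ℕ.⊔ proj₁ Cy)
  x≥ : ∀ {n} → N ℕ.≤ n → proj₁ Cx ℕ.≤ n
  x≥ n≥ = ℕₚ.m⊔n≤o⇒m≤o (proj₁ Cx) _ (ℕₚ.m⊔n≤o⇒n≤o K _ n≥)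
  y≥ : ∀ {n} → N ℕ.≤ n → proj₁ Cy ℕ.≤ n
  y≥ n≥ = ℕₚ.m⊔n≤o⇒n≤o (proj₁ Cx) _ (ℕₚ.m⊔n≤o⇒n≤o K _ n≥)
  decide : 0ℝ < x ⊎ 0ℝ < y
  decide with h ℚ.+ h ℚₚ.<? seq x N
  ... | yes q = inj₁ (0<-sample x 0<h (λ m n m≥ n≥ → proj₂ Cx m n (x≥ m≥) (x≥ n≥)) q)
  ... | no q = inj₂ (0<-sample y 0<h (λ m n m≥ n≥ → proj₂ Cy m n (y≥ m≥) (y≥ n≥))
    (0<-⇒< (0<-cong
      (solve 3 (λ e a b → let h = e :* con ½ :* con ½ in
          ((a :+ b) :- e) :+ ((h :+ h) :- a) := b :- (h :+ h)) refl ε (seq x N) (seq y N))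
      (ℚₚ.+-mono-<-≤ (<⇒0<- (proj₂ (proj₂ (proj₂ e)) N (ℕₚ.m≤m⊔n K _)))
        (subst (ℚ._≤ h ℚ.+ h ℚ.- seq x N) (ℚₚ.+-inverseʳ (seq x N))
          (ℚₚ.+-monoˡ-≤ (ℚ.- seq x N) (ℚₚ.≮⇒≥ q)))))))

ℝ-tight : ∀ {x} → ¬ (0ℝ < x) → ¬ (0ℝ < - x) → x ≈ 0ℝ
ℝ-tight {x} ¬p ¬n ε 0<ε = N , λ n n≥ → subst (λ z → ∣ z ∣ ℚ.< ε) (sym (ℚₚ.+-identityʳ (seq x n)))
  (∣∣<-intro
    (0<-⇒< (0<-cong
      (solve 3 (λ e a b → let h = e :* con ½ :* con ½ in
         (h :- (b :- a)) :+ ((h :+ h :- a) :+ h) := e :- b) refl ε (seq x N) (seq x n))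
      (0<-+ (<⇒0<- (ℚₚ.≤-<-trans (p≤∣p∣ _) (osc n N n≥ ℕₚ.≤-refl)))
        (ℚₚ.+-mono-≤-< (below (seq x N) λ q → ¬p (0<-sample x 0<h osc q)) 0<h))))
    (0<-⇒< (0<-cong
      (solve 3 (λ e a b → let h = e :* con ½ :* con ½ in
         (h :- (a :- b)) :+ ((h :+ h :- :- a) :+ h) := e :- :- b) refl ε (seq x N) (seq x n))
      (0<-+ (<⇒0<- (ℚₚ.≤-<-trans (p≤∣p∣ _) (osc N n ℕₚ.≤-refl n≥)))
        (ℚₚ.+-mono-≤-< (below (ℚ.- seq x N) λ q → ¬n (0<-sample⁻ x 0<h osc q)) 0<h)))))
  where
  open +-*-Solver
  -- The sample accounts for 2h, the oscillation for h, and the last quarter makes the bound strict.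
  h = ε ℚ.* ½ ℚ.* ½
  0<h : 0ℚ ℚ.< h
  0<h = 0<half (0<half 0<ε)
  N = proj₁ (isCauchy x h 0<h)
  osc = proj₂ (isCauchy x h 0<h)
  below : ∀ a → ¬ (h ℚ.+ h ℚ.< a) → 0ℚ ℚ.≤ h ℚ.+ h ℚ.- a
  below a q = subst (ℚ._≤ h ℚ.+ h ℚ.- a) (ℚₚ.+-inverseʳ a) (ℚₚ.+-monoˡ-≤ (ℚ.- a) (ℚₚ.≮⇒≥ q))

ℝ-orderedRing : OrderedRing
ℝ-orderedRing = record
  { commutativeRing = ℝ-commutativeRing
  ; ⟦_⟧ = fromℚ
  ; +-homo = λ p q → ≗⇒≈ {fromℚ (p ℚ.+ q)} {fromℚ p + fromℚ q} λ _ → refl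
  ; *-homo = λ p q → ≗⇒≈ {fromℚ (p ℚ.* q)} {fromℚ p * fromℚ q} λ _ → refl
  ; -‿homo = λ p → ≗⇒≈ {fromℚ (ℚ.- p)} { - fromℚ p} λ _ → refl
  ; 0-homo = ≈-refl {0ℝ} ; 1-homo = ≈-refl {1ℝ}
  ; Pos = 0ℝ <_
  ; Pos-resp = λ {x} {y} → ℝ-Pos-resp {x} {y}
  ; Pos-1 = 0<-intro {1ℝ} 0<½ (0 , λ _ _ → half< 0<1)
  ; Pos-+ = λ {x} {y} → ℝ-Pos-+ {x} {y}
  ; Pos-* = λ {x} {y} → ℝ-Pos-* {x} {y}
  ; Pos-split = λ {x} {y} → ℝ-Pos-split {x} {y}
  ; ¬Pos-0 = λ p → let ε , 0<ε , N , f = 0<-elim {0ℝ} p in ℚₚ.<-asym 0<ε (f N ℕₚ.≤-refl)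
  ; tight = λ {x} → ℝ-tight {x}
  }


module RationalInertia = Inertia ℚ-orderedRing id id (λ a f → f a) ℚ-sign

open OrderedRingProperties ℝ-orderedRing using (NonNeg)

-- The Archimedean property and bisection

ι : ℕ → ℚ
ι zero = 0ℚ
ι (suc k) = 1ℚ ℚ.+ ι k

0≤ι : ∀ k → 0ℚ ℚ.≤ ι k
0≤ι zero = ℚₚ.≤-refl
0≤ι (suc k) = ℚₚ.+-mono-≤ (ℚₚ.<⇒≤ 0<1) (0≤ι k)

toℚᵘ-ι : ∀ k → ℚ.toℚᵘ (ι k) ℚᵘ.≃ ℚᵘ.mkℚᵘ (ℤ.+ k) 0
toℚᵘ-ι zero = ℚᵘₚ.≃-refl
toℚᵘ-ι (suc k) = ℚᵘₚ.≃-trans (ℚₚ.toℚᵘ-homo-+ 1ℚ (ι k))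
  (ℚᵘₚ.≃-trans (ℚᵘₚ.+-congʳ (ℚ.toℚᵘ 1ℚ) (toℚᵘ-ι k))
    (ℚᵘ.*≡* (cong (λ z → (ℤ.+ 1 ℤ.+ z) ℤ.* ℤ.+ 1) (ℤₚ.*-identityʳ (ℤ.+ k)))))

n≤∣n∣ : ∀ n → n ℤ.≤ ℤ.+ ℤ.∣ n ∣
n≤∣n∣ (ℤ.+ n) = ℤₚ.≤-refl
n≤∣n∣ (ℤ.-[1+ n ]) = ℤ.-≤+

archimedean : ∀ q → ∃[ k ] q ℚ.≤ ι k
archimedean q@(ℚ.mkℚ n d _) = ℤ.∣ n ∣ , ℚₚ.toℚᵘ-cancel-≤
  (ℚᵘₚ.≤-trans (ℚᵘ.*≤* (ℤₚ.≤-trans (ℤₚ.≤-reflexive (ℤₚ.*-identityʳ n)) (ℤₚ.≤-trans (n≤∣n∣ n)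
      (subst (ℤ.+ ℤ.∣ n ∣ ℤ.≤_) (ℤₚ.pos-* ℤ.∣ n ∣ (suc d)) (ℤ.+≤+ (ℕₚ.m≤m*n ℤ.∣ n ∣ (suc d)))))))
    (ℚᵘₚ.≤-reflexive (ℚᵘₚ.≃-sym (toℚᵘ-ι ℤ.∣ n ∣))))

0≤-⇒≤ : ∀ {p q} → 0ℚ ℚ.≤ q ℚ.- p → p ℚ.≤ q
0≤-⇒≤ {p} {q} h = subst₂ ℚ._≤_ (ℚₚ.+-identityˡ p)
  (solve 2 (λ p q → q :- p :+ p := q) refl p q) (ℚₚ.+-monoˡ-≤ p h)
  where open +-*-Solver

≤⇒0≤- : ∀ {p q} → p ℚ.≤ q → 0ℚ ℚ.≤ q ℚ.- p
≤⇒0≤- {p} {q} p≤q = subst (ℚ._≤ q ℚ.- p) (ℚₚ.+-inverseʳ p) (ℚₚ.+-monoˡ-≤ (ℚ.- p) p≤q)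

0≤-cong : ∀ {x y} → x ≡ y → 0ℚ ℚ.≤ x → 0ℚ ℚ.≤ y
0≤-cong = subst (0ℚ ℚ.≤_)

0≤* : ∀ {p q} → 0ℚ ℚ.≤ p → 0ℚ ℚ.≤ q → 0ℚ ℚ.≤ p ℚ.* q
0≤* {p} {q} 0≤p 0≤q = subst (ℚ._≤ p ℚ.* q) (ℚₚ.*-zeroˡ q)
  (ℚₚ.*-monoʳ-≤-nonNeg q {{ℚ.nonNegative 0≤q}} 0≤p)

eventually-≥0 : ∀ x N → (∀ n → N ℕ.≤ n → 0ℚ ℚ.≤ seq x n) → NonNeg x
eventually-≥0 x N h 0<-x =
  let ε , 0<ε , M , f = 0<-elim { - x} 0<-x
      n = M ℕ.⊔ N
  in ℚₚ.<-irrefl refl (ℚₚ.<-≤-trans (ℚₚ.<-trans 0<ε (f n (ℕₚ.m≤m⊔n M N)))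
                                    (ℚₚ.neg-antimono-≤ (h n (ℕₚ.m≤n⊔m M N))))

module Bisection (P N : ℚ → Set) (decide : ∀ t → P t ⊎ N t) where

  record Bracket : Set where
    constructor bracket
    field
      lo hi : ℚ
      lo≤hi : lo ℚ.≤ hi
      P-lo  : P lo
      N-hi  : N hi
    width : ℚ
    width = hi ℚ.- lo

  open Bracket

  mid : Bracket → ℚ
  mid b = (lo b ℚ.+ hi b) ℚ.* ½

  private
    lo≤mid : ∀ b → lo b ℚ.≤ mid b
    lo≤mid b = 0≤-⇒≤ (0≤-cong
      (solve 2 (λ l h → (h :- l) :* con ½ := (l :+ h) :* con ½ :- l) refl (lo b) (hi b))
      (0≤* (≤⇒0≤- (lo≤hi b)) (ℚₚ.<⇒≤ 0<½)))
      where open +-*-Solver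

    mid≤hi : ∀ b → mid b ℚ.≤ hi b
    mid≤hi b = 0≤-⇒≤ (0≤-cong
      (solve 2 (λ l h → (h :- l) :* con ½ := h :- (l :+ h) :* con ½) refl (lo b) (hi b))
      (0≤* (≤⇒0≤- (lo≤hi b)) (ℚₚ.<⇒≤ 0<½)))
      where open +-*-Solver

  step : Bracket → Bracket
  step b with decide (mid b)
  ... | inj₁ p = bracket (mid b) (hi b) (mid≤hi b) p (N-hi b)
  ... | inj₂ n = bracket (lo b) (mid b) (lo≤mid b) (P-lo b) n

  private
    lo≤lo-step : ∀ b → lo b ℚ.≤ lo (step b)
    lo≤lo-step b with decide (mid b)
    ... | inj₁ _ = lo≤mid b
    ... | inj₂ _ = ℚₚ.≤-refl

    hi-step≤hi : ∀ b → hi (step b) ℚ.≤ hi b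
    hi-step≤hi b with decide (mid b)
    ... | inj₁ _ = ℚₚ.≤-refl
    ... | inj₂ _ = mid≤hi b

    width-step : ∀ b → width (step b) ≡ width b ℚ.* ½
    width-step b with decide (mid b)
    ... | inj₁ _ = solve 2 (λ l h → h :- (l :+ h) :* con ½ := (h :- l) :* con ½) refl (lo b) (hi b)
      where open +-*-Solver
    ... | inj₂ _ = solve 2 (λ l h → (l :+ h) :* con ½ :- l := (h :- l) :* con ½) refl (lo b) (hi b)
      where open +-*-Solver

  module _ (b₀ : Bracket) where

    iter : ℕ → Bracket
    iter zero = b₀
    iter (suc k) = step (iter k)

    private
      lo-mono′ : ∀ {m n} → m ℕ.≤′ n → lo (iter m) ℚ.≤ lo (iter n)
      lo-mono′ ℕ.≤′-refl = ℚₚ.≤-refl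
      lo-mono′ {n = suc n} (ℕ.≤′-step p) = ℚₚ.≤-trans (lo-mono′ p) (lo≤lo-step (iter n))

      hi-anti′ : ∀ {m n} → m ℕ.≤′ n → hi (iter n) ℚ.≤ hi (iter m)
      hi-anti′ ℕ.≤′-refl = ℚₚ.≤-refl
      hi-anti′ {n = suc n} (ℕ.≤′-step p) = ℚₚ.≤-trans (hi-step≤hi (iter n)) (hi-anti′ p)

      lo-mono : ∀ {m n} → m ℕ.≤ n → lo (iter m) ℚ.≤ lo (iter n)
      lo-mono p = lo-mono′ (ℕₚ.≤⇒≤′ p)

      lo≤hi-later : ∀ {m n} → m ℕ.≤ n → lo (iter n) ℚ.≤ hi (iter m)
      lo≤hi-later {n = n} p = ℚₚ.≤-trans (lo≤hi (iter n)) (hi-anti′ (ℕₚ.≤⇒≤′ p))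

      -- The weak estimate that 2⁻ᵏ is at most 1/(k+1) suffices for convergence and avoids powers of
      -- two.
      width-bound : ∀ k → width (iter k) ℚ.* ι (suc k) ℚ.≤ width b₀
      width-bound zero = ℚₚ.≤-reflexive (ℚₚ.*-identityʳ _)
      width-bound (suc k) = ℚₚ.≤-trans (0≤-⇒≤ (0≤-cong
        (trans (solve 2 (λ w i → w :* (i :* con ½) := w :* (con 1ℚ :+ i) :- w :* con ½ :* (con 1ℚ :+ (con 1ℚ :+ i)))
                 refl (width (iter k)) (ι k))
          (cong (λ z → width (iter k) ℚ.* ι (suc k) ℚ.- z ℚ.* ι (suc (suc k))) (sym (width-step (iter k)))))
        (0≤* (≤⇒0≤- (lo≤hi (iter k))) (0≤* (0≤ι k) (ℚₚ.<⇒≤ 0<½))))) (width-bound k)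
        where open +-*-Solver

    narrow : ∀ {ε} → 0ℚ ℚ.< ε → ∃[ k ] width (iter k) ℚ.< ε
    narrow {ε} 0<ε =
      let w = width b₀
          -- `quotient` needs a positive numerator, but the width may be 0; hence w + 1.
          r , _ , εr≡w+1 = quotient 0<ε (ℚₚ.+-mono-≤-< (≤⇒0≤- (lo≤hi b₀)) 0<1)
          k , r≤ιk = archimedean r
      in k , ℚₚ.*-cancelʳ-<-nonNeg (ι (suc k)) {{ℚ.nonNegative (0≤ι (suc k))}}
        (ℚₚ.≤-<-trans (width-bound k) (ℚₚ.<-≤-trans
          (0<-⇒< {w} {w ℚ.+ 1ℚ} (0<-cong (solve 1 (λ w → con 1ℚ := w :+ con 1ℚ :- w) refl w) 0<1))
          (ℚₚ.≤-trans (ℚₚ.≤-reflexive (sym εr≡w+1))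
            (ℚₚ.*-monoˡ-≤-nonNeg ε {{ℚ.nonNegative (ℚₚ.<⇒≤ 0<ε)}}
              (ℚₚ.≤-trans r≤ιk (0≤-⇒≤ (0≤-cong
                (solve 1 (λ i → con 1ℚ := con 1ℚ :+ i :- i) refl (ι k)) (ℚₚ.<⇒≤ 0<1))))))))
      where open +-*-Solver

    limit : ℝ
    limit = mkℝ (λ k → lo (iter k)) λ ε 0<ε →
      let K , w<ε = narrow 0<ε in
      K , λ m n m≥ n≥ → ∣∣<-intro
        (ℚₚ.≤-<-trans (ℚₚ.+-mono-≤ (lo≤hi-later m≥) (ℚₚ.neg-antimono-≤ (lo-mono n≥))) w<ε)
        (ℚₚ.≤-<-trans (ℚₚ.≤-trans
          (ℚₚ.≤-reflexive (solve 2 (λ a b → :- (a :- b) := b :- a) refl (lo (iter m)) (lo (iter n))))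
          (ℚₚ.+-mono-≤ (lo≤hi-later n≥) (ℚₚ.neg-antimono-≤ (lo-mono m≥)))) w<ε)
      where open +-*-Solver

    limit≥lo : NonNeg (limit + - fromℚ (lo b₀))
    limit≥lo = eventually-≥0 (limit + - fromℚ (lo b₀)) 0 λ n _ → ≤⇒0≤- (lo-mono {0} {n} ℕ.z≤n)

    P-below : ∀ {ε} → 0ℚ ℚ.< ε → Σ[ t ∈ ℚ ] P t ×
      NonNeg (limit + - fromℚ t) × NonNeg (fromℚ ε + - (limit + - fromℚ t))
    P-below {ε} 0<ε =
      let k , w<ε = narrow 0<ε ; l = lo (iter k) in
      l , P-lo (iter k) ,
      eventually-≥0 (limit + - fromℚ l) k (λ n n≥ → ≤⇒0≤- (lo-mono n≥)) ,
      eventually-≥0 (fromℚ ε + - (limit + - fromℚ l)) k (λ n n≥ → ≤⇒0≤-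
        (ℚₚ.≤-trans (ℚₚ.+-monoˡ-≤ (ℚ.- l) (lo≤hi-later n≥)) (ℚₚ.<⇒≤ w<ε)))

    N-above : ∀ {ε} → 0ℚ ℚ.< ε → Σ[ t ∈ ℚ ] N t ×
      NonNeg (fromℚ t + - limit) × NonNeg (fromℚ ε + - (fromℚ t + - limit))
    N-above {ε} 0<ε =
      let k , w<ε = narrow 0<ε ; h = hi (iter k) in
      h , N-hi (iter k) ,
      eventually-≥0 (fromℚ h + - limit) k (λ n n≥ → ≤⇒0≤- (lo≤hi-later n≥)) ,
      eventually-≥0 (fromℚ ε + - (fromℚ h + - limit)) k (λ n n≥ → ≤⇒0≤-
        (ℚₚ.≤-trans (ℚₚ.+-monoʳ-≤ h (ℚₚ.neg-antimono-≤ (lo-mono n≥))) (ℚₚ.<⇒≤ w<ε)))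

-- From rational certificates to real eigenvalues

module 𝐐 = Spectrum ℚ-orderedRing
module 𝐑 = Spectrum ℝ-orderedRing

sample : ∀ {n} → Vector ℝ n → ℕ → Vector ℚ n
sample v k i = seq (v i) k

seq-sum : ∀ {n} (v : Vector ℝ n) k → seq (sum v) k ≡ 𝐐.sum (sample v k)
seq-sum {zero} v k = refl
seq-sum {suc n} v k = cong (seq (v zero) k ℚ.+_) (seq-sum (v ∘ suc) k)

seq-dot : ∀ {n} (v w : Vector ℝ n) k → seq (𝐑.dot v w) k ≡ 𝐐.dot (sample v k) (sample w k)
seq-dot v w k = seq-sum (λ i → v i * w i) k

0<-constant : ∀ {x q} → (∀ k → seq x k ≡ q) → 0ℚ ℚ.< q → 0ℝ < x
0<-constant {x} {q} e 0<q = 0<-intro {x} (0<half 0<q)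
  (0 , λ k _ → subst (q ℚ.* ½ ℚ.<_) (sym (e k)) (half< 0<q))

NonNeg-samples : ∀ x → (∀ k → 𝐐.NonNeg (seq x k)) → 𝐑.NonNeg x
NonNeg-samples x h = eventually-≥0 x 0 λ k _ → ℚₚ.≮⇒≥ λ p → h k (ℚₚ.neg-antimono-< p)

-- Converts the strict inequalities demanded by `Above` and `Below` into a rational distance to
-- which the bisection has to be run.
0<-margin : ∀ {p} s → 0ℝ < p → Σ[ ε ∈ ℚ ] 0ℚ ℚ.< ε ×
  (∀ e → 𝐑.NonNeg e → 𝐑.NonNeg (fromℚ ε + - e) → 0ℝ < p + - (e * s))
0<-margin {p} s 0<p =
  let δ , 0<δ , M , above = 0<-elim {p} 0<p
      C , 0<C , N , below = bounded s
      ε , 0<ε , Cε≡½δ = quotient 0<C (0<half 0<δ)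
  in ε , 0<ε , λ e e≥0 e≤ε → 𝐑.Pos-perturb {p} {s} {e} {fromℚ C} {fromℚ ε}
    (eventually-≥0 (fromℚ C) 0 λ _ _ → ℚₚ.<⇒≤ 0<C)
    (eventually-≥0 (fromℚ C + - s) N λ k k≥ → ℚₚ.<⇒≤ (<⇒0<- (ℚₚ.≤-<-trans (p≤∣p∣ (seq s k)) (below k k≥))))
    e≥0 e≤ε
    (0<-intro {p + - (fromℚ C * fromℚ ε)} (0<half 0<δ) (M , λ k k≥ →
      subst₂ ℚ._<_ (trans (cong (λ z → z ℚ.- δ ℚ.* ½) (sym (halves δ))) (halve-cancel (δ ℚ.* ½)))
        (cong (λ z → seq p k ℚ.- z) (sym Cε≡½δ))
        (ℚₚ.+-monoˡ-< (ℚ.- (δ ℚ.* ½)) (above k k≥))))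
  where
  open +-*-Solver
  halve-cancel : ∀ h → h ℚ.+ h ℚ.- h ≡ h
  halve-cancel = solve 1 (λ h → h :+ h :- h := h) refl

module Limit (P N : ℚ → Set) (decide : ∀ t → P t ⊎ N t) where
  open Bisection P N decide public

  limit-above : ∀ b {N′} → (∀ t → N t → N′ (fromℚ t)) → 𝐑.Above N′ (limit b)
  limit-above b N⇒N′ p s q t 0<p 0<q =
    let ε , 0<ε , f = 0<-margin {p} s 0<p
        δ , 0<δ , g = 0<-margin {q} t 0<q
        η = ε ℚ.⊓ δ
        κ , Nκ , κ≥ , κ≤ = N-above b {η} (0<-⊓ 0<ε 0<δ)
        e = fromℚ κ + - limit b
        weaken : ∀ γ → η ℚ.≤ γ → 𝐑.NonNeg (fromℚ γ + - e)
        weaken γ η≤γ = 𝐑.NonNeg-resp {(fromℚ γ + - fromℚ η) + (fromℚ η + - e)} {fromℚ γ + - e}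
          (𝐑.telescope (fromℚ γ) (fromℚ η) e)
          (𝐑.NonNeg-+ {fromℚ γ + - fromℚ η} {fromℚ η + - e}
            (eventually-≥0 (fromℚ γ + - fromℚ η) 0 λ _ _ → ≤⇒0≤- η≤γ) κ≤)
    in fromℚ κ , κ≥ , f e κ≥ (weaken ε (ℚₚ.p⊓q≤p ε δ)) , g e κ≥ (weaken δ (ℚₚ.p⊓q≤q ε δ)) , N⇒N′ κ Nκ
    where
    0<-⊓ : ∀ {x y} → 0ℚ ℚ.< x → 0ℚ ℚ.< y → 0ℚ ℚ.< x ℚ.⊓ y
    0<-⊓ {x} {y} 0<x 0<y with ℚₚ.⊓-sel x y
    ... | inj₁ e = subst (0ℚ ℚ.<_) (sym e) 0<x
    ... | inj₂ e = subst (0ℚ ℚ.<_) (sym e) 0<y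

  limit-below : ∀ b {P′} → (∀ t → P t → P′ (fromℚ t)) → 𝐑.Below P′ (limit b)
  limit-below b P⇒P′ c K 0<c =
    let ε , 0<ε , f = 0<-margin {c} K 0<c
        κ , Pκ , κ≤ , κ≥ = P-below b {ε} 0<ε
    in fromℚ κ , f (limit b + - fromℚ κ) κ≤ κ≥ , P⇒P′ κ Pκ

module _ {n} (A : Fin n → Fin n → ℚ) (A-sym : ∀ i j → A i j ≡ A j i)
  (Aᴿ : Matrix n) (Aᴿ-seq : ∀ i j k → seq (Aᴿ i j) k ≡ A i j) where

  private
    Aᴿ-sym : Symmetric Aᴿ
    Aᴿ-sym i j = ≗⇒≈ {Aᴿ i j} {Aᴿ j i} λ k →
      trans (Aᴿ-seq i j k) (trans (A-sym i j) (sym (Aᴿ-seq j i k)))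

    H : ℚ → 𝐐.SymmetricForm n
    H = 𝐐.shifted A A-sym

    Hᴿ : ℝ → 𝐑.SymmetricForm n
    Hᴿ = 𝐑.shifted Aᴿ Aᴿ-sym

    seq-*ᵥ : ∀ v k i → seq ((Aᴿ *ᵥ v) i) k ≡ (A 𝐐.*ᴹ sample v k) i
    seq-*ᵥ v k i = trans (seq-sum (λ j → Aᴿ i j * v j) k)
      (𝐐.sum-cong-≋ λ j → cong (ℚ._* seq (v j) k) (Aᴿ-seq i j k))

    -- The matrix and the shift are constant sequences, so each term of the real form is a rational
    -- form at rational vectors. Semidefiniteness over ℚ thus extends to all real vectors.
    seq-Hᴿ : ∀ t v w k → seq (𝐑.B (Hᴿ (fromℚ t)) v w) k ≡ 𝐐.B (H t) (sample v k) (sample w k)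
    seq-Hᴿ t v w k = cong₂ ℚ._+_
      (trans (seq-dot v (Aᴿ *ᵥ w) k) (𝐐.sum-cong-≋ λ i → cong (seq (v i) k ℚ.*_) (seq-*ᵥ w k i)))
      (cong (ℚ.- t ℚ.*_) (seq-dot v w k))

    Hᴿ-constant : ∀ t x y k → seq (𝐑.B (Hᴿ (fromℚ t)) (fromℚ ∘ x) (fromℚ ∘ y)) k ≡ 𝐐.B (H t) x y
    Hᴿ-constant t x y k = seq-Hᴿ t (fromℚ ∘ x) (fromℚ ∘ y) k

    -- `N₂` is a rational certificate of positive index at most one: q H - H(x,·)² negative
    -- semidefinite makes H nonpositive where H(x,·) vanishes. Leaving q free lets x = 0 cover the
    -- case that H itself is semidefinite.
    P₁ N₁ P₂ N₂ : ℚ → Set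
    P₁ t = ∃[ x ] 0ℚ ℚ.< 𝐐.B (H t) x x
    N₁ t = 𝐐.NegSemidefinite (H t)
    P₂ t = 𝐐.TwoPositive (H t)
    N₂ t = ∃[ q ] ∃[ x ] 0ℚ ℚ.< q × 𝐐.NegSemidefinite (𝐐.rankOneUpdate q (H t) (𝐐.- 𝐐.one) (𝐐.row (H t) x))

    decide₁ : ∀ t → P₁ t ⊎ N₁ t
    decide₁ t = RationalInertia.positive-or-negSemidefinite (RationalInertia.inertia (H t))

    N₁⇒N₂ : ∀ t → N₁ t → N₂ t
    N₁⇒N₂ t nsd = 𝐐.one , (λ _ → 0ℚ) , 0<1 ,
      𝐐.subtract-square-negSemidefinite (H t) (𝐐.row (H t) (λ _ → 0ℚ)) nsd

    -- Two inertia computations: one finds a positive `x`, the other looks for a positive direction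
    -- orthogonal to it.
    decide₂ : ∀ t → P₂ t ⊎ N₂ t
    decide₂ t = [ deflated , (λ nsd → inj₂ (N₁⇒N₂ t nsd)) ]′ (decide₁ t)
      where
      deflated : P₁ t → P₂ t ⊎ N₂ t
      deflated (x , p) = [ (λ (y , q) → inj₁ (𝐐.deflate-positive (H t) {x} {y} p q))
                         , (λ nsd → inj₂ (𝐐.B (H t) x x , x , p , nsd)) ]′
        (RationalInertia.positive-or-negSemidefinite (RationalInertia.inertia (𝐐.deflate (H t) x)))

    P₁⇒ : ∀ t → P₁ t → 𝐑.Positive Aᴿ Aᴿ-sym (fromℚ t)
    P₁⇒ t (x , p) = fromℚ ∘ x ,
      0<-constant {𝐑.B (Hᴿ (fromℚ t)) (fromℚ ∘ x) (fromℚ ∘ x)} (Hᴿ-constant t x x) p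

    P₂⇒ : ∀ t → P₂ t → 𝐑.TwoPositive (Hᴿ (fromℚ t))
    P₂⇒ t (x , y , p , q , o) = fromℚ ∘ x , fromℚ ∘ y , proj₂ (P₁⇒ t (x , p)) , proj₂ (P₁⇒ t (y , q)) ,
      ≗⇒≈ {𝐑.B (Hᴿ (fromℚ t)) (fromℚ ∘ x) (fromℚ ∘ y)} {0ℝ} λ k → trans (Hᴿ-constant t x y k) o

    N₁⇒ : ∀ t → N₁ t → 𝐑.NegSemidefinite (Hᴿ (fromℚ t))
    N₁⇒ t nsd z = NonNeg-samples (- 𝐑.B (Hᴿ (fromℚ t)) z z) λ k →
      subst 𝐐.NonNeg (cong ℚ.-_ (sym (seq-Hᴿ t z z k))) (nsd (sample z k))

    N₂⇒ : ∀ t → N₂ t → 𝐑.AtMostOnePositive Aᴿ Aᴿ-sym (fromℚ t)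
    N₂⇒ t (q , x , 0<q , nsd) = ℓ , λ z → 𝐑.hyperplane-negative Aᴿ Aᴿ-sym {fromℚ q} {fromℚ t} ℓ
      (0<-constant {fromℚ q} (λ _ → refl) 0<q) z
      (NonNeg-samples (- 𝐑.B (𝐑.rankOneUpdate (fromℚ q) (Hᴿ (fromℚ t)) (- 𝐑.one) ℓ) z z) λ k →
        subst 𝐐.NonNeg (cong ℚ.-_ (cong₂ ℚ._+_ (cong (q ℚ.*_) (sym (seq-Hᴿ t z z k)))
          (cong (λ s → ℚ.- 1ℚ ℚ.* (s ℚ.* s)) (sym (seq-Hᴿ t (fromℚ ∘ x) z k)))))
        (nsd (sample z k)))
      where ℓ = 𝐑.row (Hᴿ (fromℚ t)) (fromℚ ∘ x)

    module L₁ = Limit P₁ N₁ decide₁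
    module L₂ = Limit P₂ N₂ decide₂

    eigenvalue : ∀ {μ v} → 0ℝ < 𝐑.‖ v ‖² → 𝐑.Eigenvector Aᴿ Aᴿ-sym μ v → IsEigenvalue Aᴿ μ
    eigenvalue {μ} {v} v>0 ev = v ,
      (λ v≈0 → 𝐑.Pos⇒≉0 {𝐑.‖ v ‖²} v>0 (𝐑.‖‖²-of-zero v≈0)) , ev

  twoPositive⇒¬atMostOne : 𝐐.TwoPositive (𝐐.matrixForm A A-sym) → ¬ AtMostOnePositiveEigenvalue Aᴿ
  twoPositive⇒¬atMostOne tp atMostOne =
    -- λ₂ is nonnegative because its bracket starts at 0. It is not 0, since the two positive
    -- directions of A would then be present at the limit, where `¬twoPositive` excludes them.
    positive-limit λ₂≉0 λ 0<λ →
    𝐑.second-eigenvalue Aᴿ Aᴿ-sym {λ₂} above₂ below₂ λ where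
      (inj₂ (v , w , v>0 , w>0 , vw≈0 , ev , ew)) →
        simple λ₂ 0<λ v w ev ew (𝐑.orthogonal⇒independent v>0 w>0 vw≈0)
      (inj₁ ((x , p) , z , z>0 , ez)) →
        𝐑.largest-eigenvalue Aᴿ Aᴿ-sym {λ₁} above₁ below₁ λ where
          (nsd , v , v>0 , ev) → 𝐑.≉0⇒¬¬Pos {λ₁} (𝐑.NonNeg-resp {λ₁ + - 0ℝ} {λ₁} (minus-0 λ₁) (L₁.limit≥lo b₁))
            (λ λ₁≈0 → 𝐑.NonNeg⇒¬Pos- {𝐑.B (Hᴿ λ₁) xᴿ xᴿ} (nsd xᴿ)
              (𝐑.Pos-resp {𝐑.B (Hᴿ 0ℝ) xᴿ xᴿ} {𝐑.B (Hᴿ λ₁) xᴿ xᴿ}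
                (𝐑.shifted-cong Aᴿ Aᴿ-sym {0ℝ} {λ₁} (≈-sym {λ₁} {0ℝ} λ₁≈0) xᴿ xᴿ) (proj₂ (P₁⇒ 0ℚ P₁0))))
            -- `unique` identifies λ₁ with λ₂, yet the shifted form is positive at `x` for λ₂ and
            -- negative semidefinite for λ₁.
            λ 0<λ₁ → 𝐑.NonNeg⇒¬Pos- {𝐑.B (Hᴿ λ₁) x x} (nsd x)
              (𝐑.Pos-resp {𝐑.B (Hᴿ λ₂) x x} {𝐑.B (Hᴿ λ₁) x x} (𝐑.shifted-cong Aᴿ Aᴿ-sym {λ₂} {λ₁}
                (unique λ₂ λ₁ 0<λ 0<λ₁ (eigenvalue {λ₂} {z} z>0 ez) (eigenvalue {λ₁} {v} v>0 ev)) x x) p)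
    where
    open AtMostOnePositiveEigenvalue atMostOne
    bound = 𝐐.form-bound (𝐐.matrixForm A A-sym)
    K = proj₁ bound
    0≤K : 0ℚ ℚ.≤ K
    0≤K = ℚₚ.≮⇒≥ λ p → proj₁ (proj₂ bound) (ℚₚ.neg-antimono-< p)
    P₂0 : P₂ 0ℚ
    P₂0 = 𝐐.TwoPositive-resp (𝐐.matrixForm A A-sym) (H 0ℚ) (𝐐.shifted-0 A A-sym) tp
    P₁0 : P₁ 0ℚ
    P₁0 = proj₁ P₂0 , proj₁ (proj₂ (proj₂ P₂0))
    xᴿ = fromℚ ∘ proj₁ P₁0
    -- At 0 the form of A itself has the required positive directions, and at K it has none.
    b₁ = L₁.bracket 0ℚ K 0≤K P₁0 (proj₂ (proj₂ bound))
    b₂ = L₂.bracket 0ℚ K 0≤K P₂0 (N₁⇒N₂ K (proj₂ (proj₂ bound)))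
    λ₁ = L₁.limit b₁
    λ₂ = L₂.limit b₂
    above₁ : 𝐑.Above (λ κ → 𝐑.NegSemidefinite (Hᴿ κ)) λ₁
    above₁ = L₁.limit-above b₁ {λ κ → 𝐑.NegSemidefinite (Hᴿ κ)} N₁⇒
    below₁ : 𝐑.Below (𝐑.Positive Aᴿ Aᴿ-sym) λ₁
    below₁ = L₁.limit-below b₁ {𝐑.Positive Aᴿ Aᴿ-sym} P₁⇒
    above₂ : 𝐑.Above (𝐑.AtMostOnePositive Aᴿ Aᴿ-sym) λ₂
    above₂ = L₂.limit-above b₂ {𝐑.AtMostOnePositive Aᴿ Aᴿ-sym} N₂⇒
    below₂ : 𝐑.Below (𝐑.TwoPositive ∘ Hᴿ) λ₂
    below₂ = L₂.limit-below b₂ {𝐑.TwoPositive ∘ Hᴿ} P₂⇒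
    minus-0 : ∀ x → x + - 0ℝ ≈ x
    minus-0 x = ≗⇒≈ {x + - 0ℝ} {x} λ k → ℚₚ.+-identityʳ (seq x k)
    ¬twoPositive : ¬ 𝐑.TwoPositive (Hᴿ λ₂)
    ¬twoPositive = 𝐑.¬twoPositive Aᴿ Aᴿ-sym {λ₂} above₂ below₂
    positive-limit : ¬ (λ₂ ≈ 0ℝ) → ¬ ¬ (0ℝ < λ₂)
    positive-limit = 𝐑.≉0⇒¬¬Pos {λ₂} (𝐑.NonNeg-resp {λ₂ + - 0ℝ} {λ₂} (minus-0 λ₂) (L₂.limit≥lo b₂))
    λ₂≉0 : ¬ (λ₂ ≈ 0ℝ)
    λ₂≉0 λ₂≈0 = ¬twoPositive (𝐑.TwoPositive-resp (Hᴿ 0ℝ) (Hᴿ λ₂)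
      (𝐑.shifted-cong Aᴿ Aᴿ-sym {0ℝ} {λ₂} (≈-sym {λ₂} {0ℝ} λ₂≈0)) (P₂⇒ 0ℚ P₂0))

-- M-convexity of edge sets

pair : ∀ {n} → Fin n → Fin n → Exponent n
pair i j = 0ᵉ +e i +e j

+e-comm : ∀ {n} (α : Exponent n) i j → α +e i +e j ≡ α +e j +e i
+e-comm α i j with i ≟ j
... | yes refl = refl
... | no i≢j = sym (Vecₚ.updateAt-commutes i j i≢j α)

pair-comm : ∀ {n} (i j : Fin n) → pair i j ≡ pair j i
pair-comm = +e-comm 0ᵉ

+e-e : ∀ {n} (α : Exponent n) i → α +e i -e i ≡ α
+e-e α i = trans (Vecₚ.updateAt-updateAt i α) (Vecₚ.updateAt-id i α)

pair-eʳ : ∀ {n} (i j : Fin n) → pair i j -e j ≡ 0ᵉ +e i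
pair-eʳ i j = +e-e (0ᵉ +e i) j

lookup-pair-≢ : ∀ {n} {i j k : Fin n} → k ≢ i → k ≢ j → lookup (pair i j) k ≡ 0
lookup-pair-≢ {i = i} {j} {k} k≢i k≢j = trans (Vecₚ.lookup∘updateAt′ k j k≢j (0ᵉ +e i))
  (trans (Vecₚ.lookup∘updateAt′ k i k≢i 0ᵉ) (Vecₚ.lookup-replicate k 0))

lookup-pair-ˡ : ∀ {n} {i j : Fin n} → i ≢ j → lookup (pair i j) i ≡ 1
lookup-pair-ˡ {i = i} {j} i≢j = trans (Vecₚ.lookup∘updateAt′ i j i≢j (0ᵉ +e i))
  (trans (Vecₚ.lookup∘updateAt i 0ᵉ) (cong suc (Vecₚ.lookup-replicate i 0)))

lookup-pair-twice : ∀ {n} (i : Fin n) → lookup (pair i i) i ≡ 2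
lookup-pair-twice i = trans (Vecₚ.lookup∘updateAt i (0ᵉ +e i))
  (cong suc (trans (Vecₚ.lookup∘updateAt i 0ᵉ) (cong suc (Vecₚ.lookup-replicate i 0))))

0<lookup-pairˡ : ∀ {n} (i j : Fin n) → 0 ℕ.< lookup (pair i j) i
0<lookup-pairˡ i j with i ≟ j
... | yes refl = subst (0 ℕ.<_) (sym (lookup-pair-twice i)) (s≤s z≤n)
... | no i≢j = subst (0 ℕ.<_) (sym (lookup-pair-ˡ i≢j)) (s≤s z≤n)

0<lookup-pairʳ : ∀ {n} (i j : Fin n) → 0 ℕ.< lookup (pair i j) j
0<lookup-pairʳ i j = subst (λ α → 0 ℕ.< lookup α j) (pair-comm j i) (0<lookup-pairˡ j i)

lookup-pair-support : ∀ {n} {i j k : Fin n} → 0 ℕ.< lookup (pair i j) k → k ≡ i ⊎ k ≡ j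
lookup-pair-support {i = i} {j} {k} p with k ≟ i | k ≟ j
... | yes e | _ = inj₁ e
... | no _ | yes e = inj₂ e
... | no k≢i | no k≢j = ⊥-elim (ℕₚ.<-irrefl (sym (lookup-pair-≢ k≢i k≢j)) p)

single-injective : ∀ {n} {i j : Fin n} → 0ᵉ +e i ≡ 0ᵉ +e j → i ≡ j
single-injective {i = i} {j} e with i ≟ j
... | yes i≡j = i≡j
... | no i≢j = ⊥-elim (ℕₚ.1+n≢0 {0} (trans
  (sym (trans (Vecₚ.lookup∘updateAt i 0ᵉ) (cong suc (Vecₚ.lookup-replicate i 0))))
  (trans (cong (λ α → lookup α i) e)
    (trans (Vecₚ.lookup∘updateAt′ i j i≢j 0ᵉ) (Vecₚ.lookup-replicate i 0)))))

pair-cancelʳ : ∀ {n} {i j k : Fin n} → pair i k ≡ pair j k → i ≡ j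
pair-cancelʳ {i = i} {j} {k} e = single-injective
  (trans (sym (pair-eʳ i k)) (trans (cong (_-e k) e) (pair-eʳ j k)))

pair-injective : ∀ {n} {i j k l : Fin n} → pair i j ≡ pair k l → (i ≡ k × j ≡ l) ⊎ (i ≡ l × j ≡ k)
pair-injective {i = i} {j} {k} {l} e
  with lookup-pair-support {i = k} {l} (subst (λ α → 0 ℕ.< lookup α i) e (0<lookup-pairˡ i j))
... | inj₁ refl = inj₁ (refl , pair-cancelʳ (trans (pair-comm j i) (trans e (pair-comm i l))))
... | inj₂ refl = inj₂ (refl , pair-cancelʳ (trans (pair-comm j i) e))

module _ {n} (G : Graph n) where
  open Graph G using (adj; adj-sym)

  Adj-sym : ∀ {u v} → Adj G u v → Adj G v u
  Adj-sym {u} {v} = subst T (adj-sym u v)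

  Edge : Exponent n → Set
  Edge α = ∃[ u ] ∃[ v ] α ≡ pair u v × Adj G u v

  Edge-pair : ∀ {u v} → Edge (pair u v) → Adj G u v
  Edge-pair (k , l , e , kl) with pair-injective e
  ... | inj₁ (refl , refl) = kl
  ... | inj₂ (refl , refl) = Adj-sym kl

  record IsMultipartiteLike : Set where
    field
      looped⇒universal : ∀ u v → Adj G u u → Adj G u v
      ¬Adj-trans       : ∀ u v w → ¬ Adj G u v → ¬ Adj G v w → ¬ Adj G u w

  open IsMultipartiteLike

  -- M-convexity for the edges uv and rs, moving the vertex v.
  exchange : MConvex Edge → ∀ {u v r s} → Adj G u v → Adj G r s → v ≢ r → v ≢ s →
    Adj G u r ⊎ Adj G u s
  exchange mc {u} {v} {r} {s} uv rs v≢r v≢s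
    with mc (pair u v) (pair r s) (u , v , refl , uv) (r , s , refl , rs) v
            (ℕₚ.≤-<-trans (ℕₚ.≤-reflexive (lookup-pair-≢ v≢r v≢s)) (0<lookup-pairʳ u v))
  ... | j , a<b , e with lookup-pair-support {i = r} {s} (ℕₚ.≤-<-trans z≤n a<b)
  ...   | inj₁ refl = inj₁ (Edge-pair (subst Edge (cong (_+e j) (pair-eʳ u v)) e))
  ...   | inj₂ refl = inj₂ (Edge-pair (subst Edge (cong (_+e j) (pair-eʳ u v)) e))

  -- Since no vertex is isolated, the vertex in question has an edge whose other end can be
  -- exchanged. Against a loop vv the only possible replacement is v. Against an edge uw, an edge vz
  -- becomes vu or vw.
  MConvex⇒multipartiteLike : NoIsolatedVertices G → MConvex Edge → IsMultipartiteLike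
  MConvex⇒multipartiteLike noIsolated mc .looped⇒universal v u vv =
    decidable-stable (T? (adj v u)) λ ¬vu →
      let w , uw = noIsolated u
          w≢v : w ≢ v
          w≢v = λ w≡v → ¬vu (Adj-sym (subst (Adj G u) w≡v uw))
      in ¬vu (Adj-sym (reduce (exchange mc uw vv w≢v w≢v)))
    where
    reduce : ∀ {A : Set} → A ⊎ A → A
    reduce (inj₁ a) = a
    reduce (inj₂ a) = a
  MConvex⇒multipartiteLike noIsolated mc .¬Adj-trans u v w ¬uv ¬vw uw =
    let z , vz = noIsolated v in
    contra (exchange mc vz uw (λ z≡u → ¬uv (Adj-sym (subst (Adj G v) z≡u vz)))
                              (λ z≡w → ¬vw (subst (Adj G v) z≡w vz)))
    where
    contra : ¬ (Adj G v u ⊎ Adj G v w)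
    contra (inj₁ vu) = ¬uv (Adj-sym vu)
    contra (inj₂ vw) = ¬vw vw

  module _ (M : IsMultipartiteLike) where
    private
      Exchange : (p q r s i : Fin n) → Set
      Exchange p q r s i = ∃[ j ] lookup (pair p q) j ℕ.< lookup (pair r s) j × Edge (pair p q -e i +e j)

      edge-out : ∀ p {q j} → Adj G q j → Edge (pair p q -e p +e j)
      edge-out p {q} {j} qj = q , j ,
        cong (_+e j) (trans (cong (_-e p) (pair-comm p q)) (pair-eʳ q p)) , qj

      -- The removed vertex p lies on the edge ps: then p carries a loop.
      exchange-loop : ∀ p q s → Adj G p s → lookup (pair p s) p ℕ.< lookup (pair p q) p → Exchange p q p s p
      exchange-loop p q s ps b<a with q ≟ p | s ≟ p
      ... | no q≢p | _ = ⊥-elim (ℕₚ.<⇒≱ b<a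
        (subst (ℕ._≤ _) (sym (lookup-pair-ˡ (q≢p ∘ sym))) (0<lookup-pairˡ p s)))
      ... | yes refl | yes refl = ⊥-elim (ℕₚ.<-irrefl refl b<a)
      ... | yes refl | no s≢p = s , ℕₚ.≤-<-trans (ℕₚ.≤-reflexive (lookup-pair-≢ s≢p s≢p)) (0<lookup-pairʳ p s) , edge-out p ps

      -- Replacing p by s turns pq into the target edge qs itself. If s = q, this is a loop of
      -- multiplicity two, so s still counts as deficient.
      exchange-shared : ∀ p q s → Adj G q s → p ≢ q → p ≢ s → Exchange p q q s p
      exchange-shared p q s qs p≢q p≢s with s ≟ q
      ... | yes refl = s , subst₂ ℕ._<_
        (sym (trans (cong (λ α → lookup α s) (pair-comm p s)) (lookup-pair-ˡ (p≢q ∘ sym))))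
        (sym (lookup-pair-twice s)) (s≤s (s≤s z≤n)) , edge-out p qs
      ... | no s≢q = s , ℕₚ.≤-<-trans (ℕₚ.≤-reflexive (lookup-pair-≢ (p≢s ∘ sym) s≢q)) (0<lookup-pairʳ q s) , edge-out p qs

      -- If the remaining vertex q were adjacent to neither end of rs, transitivity of non-adjacency
      -- through q would remove the edge rs.
      exchange-disjoint : ∀ p q r s → Adj G r s → p ≢ r → p ≢ s → q ≢ r → q ≢ s → Exchange p q r s p
      exchange-disjoint p q r s rs p≢r p≢s q≢r q≢s with T? (adj q r) | T? (adj q s)
      ... | yes qr | _ = r , ℕₚ.≤-<-trans (ℕₚ.≤-reflexive (lookup-pair-≢ (p≢r ∘ sym) (q≢r ∘ sym))) (0<lookup-pairˡ r s) , edge-out p qr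
      ... | no _ | yes qs = s , ℕₚ.≤-<-trans (ℕₚ.≤-reflexive (lookup-pair-≢ (p≢s ∘ sym) (q≢s ∘ sym))) (0<lookup-pairʳ r s) , edge-out p qs
      ... | no ¬qr | no ¬qs = ⊥-elim (¬Adj-trans M r q s (¬qr ∘ Adj-sym) ¬qs rs)

      swap-target : ∀ {p q r s i} → Exchange p q r s i → Exchange p q s r i
      swap-target {p} {q} {r} {s} (j , a<b , e) = j , subst (λ α → _ ℕ.< lookup α j) (pair-comm r s) a<b , e

      swap-source : ∀ {p q r s i} → Exchange p q r s i → Exchange q p r s i
      swap-source {p} {q} {r} {s} {i} (j , a<b , e) =
        j , subst (λ α → lookup α j ℕ.< _) (pair-comm p q) a<b ,
        subst (λ α → Edge (α -e i +e j)) (pair-comm p q) e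

      exchange-at : ∀ p q r s → Adj G r s → lookup (pair r s) p ℕ.< lookup (pair p q) p → Exchange p q r s p
      exchange-at p q r s rs b<a with p ≟ r | p ≟ s | q ≟ r | q ≟ s
      ... | yes refl | _ | _ | _ = exchange-loop p q s rs b<a
      ... | no _ | yes refl | _ | _ = swap-target (exchange-loop p q r (Adj-sym rs)
        (subst (λ α → lookup α p ℕ.< _) (pair-comm r p) b<a))
      ... | no p≢r | no p≢s | yes refl | _ = exchange-shared p q s rs p≢r p≢s
      ... | no p≢r | no p≢s | no _ | yes refl = swap-target (exchange-shared p q r (Adj-sym rs) p≢s p≢r)
      ... | no p≢r | no p≢s | no q≢r | no q≢s = exchange-disjoint p q r s rs p≢r p≢s q≢r q≢s

    multipartiteLike⇒MConvex : MConvex Edge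
    multipartiteLike⇒MConvex _ _ (p , q , refl , pq) (r , s , refl , rs) i b<a
      with lookup-pair-support {i = p} {q} (ℕₚ.≤-<-trans z≤n b<a)
    ... | inj₁ refl = exchange-at p q r s rs b<a
    ... | inj₂ refl = swap-source (exchange-at q p r s rs
      (subst (λ α → _ ℕ.< lookup α q) (pair-comm p q) b<a))

    neighbours : Fin n → Fin n → Fin 2
    neighbours u w = if adj u w then zero else suc zero

    part : Fin n → Fin (2 ℕ.^ n)
    part u = funToFin (neighbours u)

    private
      neighbours-≡ : ∀ {u v} w → neighbours u w ≡ neighbours v w → adj u w ≡ adj v w
      neighbours-≡ {u} {v} w e with adj u w | adj v w | e
      ... | true | true | _ = refl
      ... | false | false | _ = refl

      funToFin-cong : ∀ {m k} {f g : Fin m → Fin k} → (∀ i → f i ≡ g i) → funToFin f ≡ funToFin g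
      funToFin-cong {zero} e = refl
      funToFin-cong {suc m} e = cong₂ combine (e zero) (funToFin-cong (e ∘ suc))

      T-⇔⇒≡ : ∀ {b c} → (T b → T c) → (T c → T b) → b ≡ c
      T-⇔⇒≡ {true} {true} f g = refl
      T-⇔⇒≡ {true} {false} f g = ⊥-elim (f _)
      T-⇔⇒≡ {false} {true} f g = ⊥-elim (g _)
      T-⇔⇒≡ {false} {false} f g = refl

    ¬Adj⇒part-≡ : ∀ {u v} → ¬ Adj G u v → part u ≡ part v
    ¬Adj⇒part-≡ {u} {v} ¬uv = funToFin-cong λ w → cong (λ b → if b then zero else suc zero)
      (T-⇔⇒≡ (λ uw → decidable-stable (T? (adj v w)) λ ¬vw → ¬Adj-trans M u v w ¬uv ¬vw uw)
             (λ vw → decidable-stable (T? (adj u w)) λ ¬uw → ¬Adj-trans M v u w (¬uv ∘ Adj-sym) ¬uw vw))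

    -- If uv were an edge, u would lie in the neighbourhood of v, which is also its own, giving a
    -- loop at u.
    part-≡⇒¬Adj : ∀ {u v} → ¬ Adj G u u → part u ≡ part v → ¬ Adj G u v
    part-≡⇒¬Adj {u} {v} ¬uu e uv = ¬uu (subst T (sym (neighbours-≡ u (trans (sym (finToFun-funToFin (neighbours u) u))
      (trans (cong (λ k → finToFun k u) e) (finToFun-funToFin (neighbours v) u))))) (Adj-sym uv))

    multipartiteLike⇒decomposition : HasMultipartiteDecomposition G
    multipartiteLike⇒decomposition = ∁ looped , looped ,
      (λ (x , x∈) → let x∈∁ , x∈l = x∈p∩q⁻ (∁ looped) looped x∈ in x∈∁p⇒x∉p x∈∁ x∈l) ,
      trans (∪-comm (∁ looped) looped) (p∪∁p≡⊤ looped) ,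
      (2 ℕ.^ n , part , λ u v u∈ v∈ → mk⇔
        (λ uv e → part-≡⇒¬Adj (λ uu → x∈∁p⇒x∉p u∈ (∈-looped⁺ uu)) e uv)
        (λ ≢ → decidable-stable (T? (adj u v)) (λ ¬uv → ≢ (¬Adj⇒part-≡ ¬uv)))) ,
      (λ v v∈ → ∈-looped⁻ v∈ , λ u → looped⇒universal M v u (∈-looped⁻ v∈))
      where
      looped : Subset n
      looped = tabulate λ v → adj v v
      ∈-looped⁺ : ∀ {v} → Adj G v v → v ∈ looped
      ∈-looped⁺ {v} vv = Vecₚ.lookup⇒[]= v looped (trans (Vecₚ.lookup∘tabulate _ v) (T-⇔⇒≡ _ (λ _ → vv)))
      ∈-looped⁻ : ∀ {v} → v ∈ looped → Adj G v v
      ∈-looped⁻ {v} v∈ = subst T (sym (trans (sym (Vecₚ.lookup∘tabulate _ v)) (Vecₚ.[]=⇒lookup v∈))) _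

  decomposition⇒multipartiteLike : HasMultipartiteDecomposition G → IsMultipartiteLike
  decomposition⇒multipartiteLike (V₁ , V₂ , _ , cover , (k , part , multipartite) , universal) = record
    { looped⇒universal = λ u v uu → loop-universal (side u) uu v
    ; ¬Adj-trans = λ u v w ¬uv ¬vw uw → transitive (side u) (side v) (side w) ¬uv ¬vw uw
    }
    where
    side : ∀ v → v ∈ V₁ ⊎ v ∈ V₂
    side v = x∈p∪q⁻ V₁ V₂ (subst (v ∈_) (sym cover) ∈⊤)
    module _ {u v} (u∈ : u ∈ V₁) (v∈ : v ∈ V₁) where open Equivalence (multipartite u v u∈ v∈) public
    loop-universal : ∀ {u} → u ∈ V₁ ⊎ u ∈ V₂ → Adj G u u → ∀ v → Adj G u v
    loop-universal (inj₁ u∈) uu v = ⊥-elim (to u∈ u∈ uu refl)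
    loop-universal (inj₂ u∈) uu v = proj₂ (universal _ u∈) v
    transitive : ∀ {u v w} → u ∈ V₁ ⊎ u ∈ V₂ → v ∈ V₁ ⊎ v ∈ V₂ → w ∈ V₁ ⊎ w ∈ V₂ →
      ¬ Adj G u v → ¬ Adj G v w → ¬ Adj G u w
    transitive (inj₂ u∈) _ _ ¬uv ¬vw uw = ¬uv (proj₂ (universal _ u∈) _)
    transitive _ (inj₂ v∈) _ ¬uv ¬vw uw = ¬vw (proj₂ (universal _ v∈) _)
    transitive _ _ (inj₂ w∈) ¬uv ¬vw uw = ¬vw (Adj-sym (proj₂ (universal _ w∈) _))
    transitive (inj₁ u∈) (inj₁ v∈) (inj₁ w∈) ¬uv ¬vw uw = ¬uv (from u∈ v∈ λ u≡v →
      ¬vw (from v∈ w∈ λ v≡w → to u∈ w∈ uw (trans u≡v v≡w)))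

-- The adjacency form and the polynomial of a graph

module 𝐐ᵢ = Incidence ℚ-orderedRing
module 𝐑ᵢ = Incidence ℝ-orderedRing

T⇒≡true : ∀ {b} → T b → b ≡ true
T⇒≡true {true} _ = refl

¬T⇒≡false : ∀ {b} → ¬ T b → b ≡ false
¬T⇒≡false {true} ¬t = ⊥-elim (¬t _)
¬T⇒≡false {false} _ = refl

indicator : Bool → ℚ
indicator b = if b then 1ℚ else 0ℚ

private
  2ℚ : ℚ
  2ℚ = 1ℚ ℚ.+ 1ℚ

  -- The Gram determinant of e_v and e_u + e_w under the adjacency form, where v
  -- is looped, not adjacent to u, and w is a neighbour of u; letters stand for
  -- undetermined adjacencies.
  gram₁ : ∀ uu ww vw → 0ℚ ℚ.< 1ℚ ℚ.* (1ℚ ℚ.* 1ℚ ℚ.* indicator uu ℚ.+ 2ℚ ℚ.* (1ℚ ℚ.* 1ℚ) ℚ.* 1ℚ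
    ℚ.+ 1ℚ ℚ.* 1ℚ ℚ.* indicator ww)
    ℚ.- (1ℚ ℚ.* 0ℚ ℚ.+ 1ℚ ℚ.* indicator vw) ℚ.* (1ℚ ℚ.* 0ℚ ℚ.+ 1ℚ ℚ.* indicator vw)
  gram₁ true true true = ℚ.*<* (ℤ.+<+ (ℕ.s≤s ℕ.z≤n))
  gram₁ true true false = ℚ.*<* (ℤ.+<+ (ℕ.s≤s ℕ.z≤n))
  gram₁ true false true = ℚ.*<* (ℤ.+<+ (ℕ.s≤s ℕ.z≤n))
  gram₁ true false false = ℚ.*<* (ℤ.+<+ (ℕ.s≤s ℕ.z≤n))
  gram₁ false true true = ℚ.*<* (ℤ.+<+ (ℕ.s≤s ℕ.z≤n))
  gram₁ false true false = ℚ.*<* (ℤ.+<+ (ℕ.s≤s ℕ.z≤n))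
  gram₁ false false true = ℚ.*<* (ℤ.+<+ (ℕ.s≤s ℕ.z≤n))
  gram₁ false false false = ℚ.*<* (ℤ.+<+ (ℕ.s≤s ℕ.z≤n))

  -- Likewise for e_u + e_w and 2 e_v + e_z, where u, v, w are loopless, uw and
  -- vz are edges, and v is adjacent to neither u nor w.
  gram₂ : ∀ zz zu zw →
    let b = 2ℚ ℚ.* (1ℚ ℚ.* 0ℚ ℚ.+ 1ℚ ℚ.* 0ℚ) ℚ.+ 1ℚ ℚ.* (1ℚ ℚ.* indicator zu ℚ.+ 1ℚ ℚ.* indicator zw) in
    0ℚ ℚ.< (1ℚ ℚ.* 1ℚ ℚ.* 0ℚ ℚ.+ 2ℚ ℚ.* (1ℚ ℚ.* 1ℚ) ℚ.* 1ℚ ℚ.+ 1ℚ ℚ.* 1ℚ ℚ.* 0ℚ)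
      ℚ.* (2ℚ ℚ.* 2ℚ ℚ.* 0ℚ ℚ.+ 2ℚ ℚ.* (2ℚ ℚ.* 1ℚ) ℚ.* 1ℚ ℚ.+ 1ℚ ℚ.* 1ℚ ℚ.* indicator zz)
      ℚ.- b ℚ.* b
  gram₂ true true true = ℚ.*<* (ℤ.+<+ (ℕ.s≤s ℕ.z≤n))
  gram₂ true true false = ℚ.*<* (ℤ.+<+ (ℕ.s≤s ℕ.z≤n))
  gram₂ true false true = ℚ.*<* (ℤ.+<+ (ℕ.s≤s ℕ.z≤n))
  gram₂ true false false = ℚ.*<* (ℤ.+<+ (ℕ.s≤s ℕ.z≤n))
  gram₂ false true true = ℚ.*<* (ℤ.+<+ (ℕ.s≤s ℕ.z≤n))
  gram₂ false true false = ℚ.*<* (ℤ.+<+ (ℕ.s≤s ℕ.z≤n))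
  gram₂ false false true = ℚ.*<* (ℤ.+<+ (ℕ.s≤s ℕ.z≤n))
  gram₂ false false false = ℚ.*<* (ℤ.+<+ (ℕ.s≤s ℕ.z≤n))

AtMostOne-cong : ∀ {n} (A A′ : Matrix n) → (∀ i j → A i j ≈ A′ i j) →
  AtMostOnePositiveEigenvalue A → AtMostOnePositiveEigenvalue A′
AtMostOne-cong A A′ A≈A′ atMostOne = record
  { unique = λ κ μ κ>0 μ>0 (v , v≉0 , ev) (w , w≉0 , ew) →
      unique κ μ κ>0 μ>0 (v , v≉0 , back κ v ev) (w , w≉0 , back μ w ew)
  ; simple = λ μ μ>0 v w ev ew → simple μ μ>0 v w (back μ v ev) (back μ w ew)
  }
  where
  open AtMostOnePositiveEigenvalue atMostOne
  back : ∀ μ v → InEigenspace A′ μ v → InEigenspace A μ v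
  back = 𝐑ᵢ.eigenvector-cong A′ A (λ i j → ≈-sym {A i j} {A′ i j} (A≈A′ i j))

hyperplane⇒atMostOne : ∀ {n} (A : Matrix n) (A-sym : Symmetric A) (ℓ : 𝐑.LinearForm n) →
  (∀ z → 𝐑.⟨_⟩ ℓ z ≈ 0ℝ → 𝐑.NonNeg (- 𝐑.B (𝐑.matrixForm A A-sym) z z)) →
  AtMostOnePositiveEigenvalue A
hyperplane⇒atMostOne A A-sym ℓ h = record
  { unique = λ κ μ κ>0 μ>0 (v , v≉0 , ev) (w , w≉0 , ew) → 𝐑ᵢ.minus-zero⇒≈ κ μ
      (𝐑.eigenvalue-unique A A-sym ℓ h {κ} {μ} {v} {w} κ>0 μ>0 ev ew v≉0 w≉0)
  ; simple = λ μ μ>0 v w ev ew → 𝐑.eigenspace-simple A A-sym ℓ h {μ} {v} {w} μ>0 ev ew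
  }

module _ {n} (G : Graph n) where
  open Graph G using (adj; adj-sym)

  adjacencyℚ : Fin n → Fin n → ℚ
  adjacencyℚ i j = indicator (adj i j)

  adjacencyℚ-sym : ∀ i j → adjacencyℚ i j ≡ adjacencyℚ j i
  adjacencyℚ-sym i j = cong indicator (adj-sym i j)

  seq-adjacencyMatrix : ∀ i j k → seq (adjacencyMatrix G i j) k ≡ adjacencyℚ i j
  seq-adjacencyMatrix i j k with adj i j
  ... | true = refl
  ... | false = refl

  adjacencyMatrix-sym : Symmetric (adjacencyMatrix G)
  adjacencyMatrix-sym i j = ≗⇒≈ {adjacencyMatrix G i j} {adjacencyMatrix G j i} λ k →
    trans (seq-adjacencyMatrix i j k) (trans (adjacencyℚ-sym i j) (sym (seq-adjacencyMatrix j i k)))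

  private
    F = 𝐐.matrixForm adjacencyℚ adjacencyℚ-sym
    e = 𝐐ᵢ.basis {n}

    F-basis : ∀ u v → 𝐐.B F (e u) (e v) ≡ indicator (adj u v)
    F-basis = 𝐐ᵢ.matrixForm-basis adjacencyℚ adjacencyℚ-sym

    F-adj : ∀ {u v} → Adj G u v → 𝐐.B F (e u) (e v) ≡ 1ℚ
    F-adj {u} {v} uv = trans (F-basis u v) (cong indicator (T⇒≡true uv))

    F-¬adj : ∀ {u v} → ¬ Adj G u v → 𝐐.B F (e u) (e v) ≡ 0ℚ
    F-¬adj {u} {v} ¬uv = trans (F-basis u v) (cong indicator (¬T⇒≡false ¬uv))

    infixr 7 _⊙_
    infixl 6 _⊕_
    _⊙_ = 𝐐._⊙_ {n}
    _⊕_ = 𝐐._⊕_ {n}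

    F-binomial : ∀ s t u v {a b c} → 𝐐.B F (e u) (e u) ≡ a → 𝐐.B F (e u) (e v) ≡ b → 𝐐.B F (e v) (e v) ≡ c →
      𝐐.B F (s ⊙ e u ⊕ t ⊙ e v) (s ⊙ e u ⊕ t ⊙ e v) ≡ s ℚ.* s ℚ.* a ℚ.+ 2ℚ ℚ.* (s ℚ.* t) ℚ.* b ℚ.+ t ℚ.* t ℚ.* c
    F-binomial s t u v refl refl refl = 𝐐.B-binomial F s t (e u) (e v)

    F-comb : ∀ s t u v x {a b} → 𝐐.B F x (e u) ≡ a → 𝐐.B F x (e v) ≡ b →
      𝐐.B F x (s ⊙ e u ⊕ t ⊙ e v) ≡ s ℚ.* a ℚ.+ t ℚ.* b
    F-comb s t u v x refl refl = 𝐐.B-comb F s t (e u) (e v) x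

    -- With letters for adjacencies, the Gram determinant of e_v and e_u + e_w is uu + ww + 2 - vw²,
    -- at least 1.
    looped-nonneighbour : ∀ {u v w} → Adj G v v → ¬ Adj G v u → Adj G u w → 𝐐.TwoPositive F
    looped-nonneighbour {u} {v} {w} vv ¬vu uw = 𝐐.gram⇒twoPositive F {e v} {1ℚ ⊙ e u ⊕ 1ℚ ⊙ e w}
      (F-adj vv)
      (F-comb 1ℚ 1ℚ u w (e v) (F-¬adj ¬vu) (F-basis v w))
      (F-binomial 1ℚ 1ℚ u w (F-basis u u) (F-adj uw) (F-basis w w))
      0<1 (gram₁ (adj u u) (adj w w) (adj v w))

    -- The Gram determinant is 2(4 + zz) - (zu + zw)², at least 4. The weight 2 on e_v matters: with
    -- e_v + e_z it would vanish for a loopless z adjacent to both u and w.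
    isolated-from-edge : ∀ {u v w z} → ¬ Adj G u u → ¬ Adj G v v → ¬ Adj G w w →
      Adj G u w → ¬ Adj G v u → ¬ Adj G v w → Adj G v z → 𝐐.TwoPositive F
    isolated-from-edge {u} {v} {w} {z} ¬uu ¬vv ¬ww uw ¬vu ¬vw vz =
      𝐐.gram⇒twoPositive F {x} {2ℚ ⊙ e v ⊕ 1ℚ ⊙ e z}
        (F-binomial 1ℚ 1ℚ u w (F-¬adj ¬uu) (F-adj uw) (F-¬adj ¬ww))
        (F-comb 2ℚ 1ℚ v z x
          (trans (𝐐.B-sym F x (e v)) (F-comb 1ℚ 1ℚ u w (e v) (F-¬adj ¬vu) (F-¬adj ¬vw)))
          (trans (𝐐.B-sym F x (e z)) (F-comb 1ℚ 1ℚ u w (e z) (F-basis z u) (F-basis z w))))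
        (F-binomial 2ℚ 1ℚ v z (F-¬adj ¬vv) (F-adj vz) (F-basis z z))
        (ℚ.*<* (ℤ.+<+ (ℕ.s≤s ℕ.z≤n))) (gram₂ (adj z z) (adj z u) (adj z w))
      where x = 1ℚ ⊙ e u ⊕ 1ℚ ⊙ e w

  atMostOne⇒multipartiteLike : NoIsolatedVertices G →
    AtMostOnePositiveEigenvalue (adjacencyMatrix G) → IsMultipartiteLike G
  atMostOne⇒multipartiteLike noIsolated atMostOne = record
    { looped⇒universal = universal
    ; ¬Adj-trans = λ u v w ¬uv ¬vw uw → ¬two (isolated-from-edge
        -- A loop at any of the three vertices would make it universal, against the assumed
        -- non-adjacencies.
        (λ uu → ¬uv (universal u v uu)) (λ vv → ¬vw (universal v w vv))
        (λ ww → ¬vw (Adj-sym G (universal w v ww)))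
        uw (¬uv ∘ Adj-sym G) ¬vw (proj₂ (noIsolated v)))
    }
    where
    ¬two : ¬ 𝐐.TwoPositive F
    ¬two two = twoPositive⇒¬atMostOne adjacencyℚ adjacencyℚ-sym (adjacencyMatrix G) seq-adjacencyMatrix two atMostOne
    universal : ∀ u v → Adj G u u → Adj G u v
    universal u v uu = decidable-stable (T? (adj u v)) λ ¬uv →
      ¬two (looped-nonneighbour uu ¬uv (proj₂ (noIsolated v)))

  module _ (M : IsMultipartiteLike G) where
    open IsMultipartiteLike M

    private
      nonlooped : Fin n → Bool
      nonlooped i = not (adj i i)

      adj-by-parts : ∀ i j → adj i j ≡ not (nonlooped i ∧ nonlooped j ∧ ⌊ part G M i ≟ part G M j ⌋)
      adj-by-parts i j with T? (adj i i) | T? (adj j j) | part G M i ≟ part G M j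
      ... | yes ii | _ | _ rewrite T⇒≡true ii = T⇒≡true (looped⇒universal i j ii)
      ... | no ¬ii | yes jj | _ rewrite ¬T⇒≡false ¬ii | T⇒≡true jj = T⇒≡true (Adj-sym G (looped⇒universal j i jj))
      ... | no ¬ii | no ¬jj | yes p rewrite ¬T⇒≡false ¬ii | ¬T⇒≡false ¬jj = ¬T⇒≡false (part-≡⇒¬Adj G M ¬ii p)
      ... | no ¬ii | no ¬jj | no ¬p rewrite ¬T⇒≡false ¬ii | ¬T⇒≡false ¬jj =
        T⇒≡true (decidable-stable (T? (adj i j)) λ ¬ij → ¬p (¬Adj⇒part-≡ G M ¬ij))

      -- Looped vertices are left out of every part, so their rows in J - Σ_c P_c P_cᵀ are all ones,
      -- as universality demands.
      P : Fin (2 ℕ.^ n) → Vector ℝ n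
      P c i = if nonlooped i then 𝐑ᵢ.basis (part G M i) c else 0ℝ

      entry : ∀ i j → adjacencyMatrix G i j ≈ 1ℝ + - sum (λ c → P c i * P c j)
      entry i j = ≈-trans {adjacencyMatrix G i j} {1ℝ + - σ} {1ℝ + - sum (λ c → P c i * P c j)}
        (not-indicator (adj-by-parts i j))
        (𝐑.+-congˡ {1ℝ} { - σ} { - sum (λ c → P c i * P c j)}
          (𝐑.-‿cong {σ} {sum (λ c → P c i * P c j)} (≈-sym {sum (λ c → P c i * P c j)} {σ}
            (𝐑ᵢ.sum-parts nonlooped (part G M) i j))))
        where
        σ = if nonlooped i ∧ nonlooped j ∧ ⌊ part G M i ≟ part G M j ⌋ then 1ℝ else 0ℝ
        not-indicator : ∀ {a b} → a ≡ not b → (if a then 1ℝ else 0ℝ) ≈ 1ℝ + - (if b then 1ℝ else 0ℝ)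
        not-indicator {b = true} refl = ≗⇒≈ {0ℝ} {1ℝ + - 1ℝ} λ _ → refl
        not-indicator {b = false} refl = ≗⇒≈ {1ℝ} {1ℝ + - 0ℝ} λ _ → refl

    multipartiteLike⇒atMostOne : AtMostOnePositiveEigenvalue (adjacencyMatrix G)
    multipartiteLike⇒atMostOne = hyperplane⇒atMostOne (adjacencyMatrix G) adjacencyMatrix-sym
      (𝐑.row (𝐑.euclidean n) 𝐑ᵢ.ones)
      (𝐑ᵢ.nonpositive-on-hyperplane (adjacencyMatrix G) adjacencyMatrix-sym P entry)

-- Coefficients, Hessian and support of the polynomial of a graph

sum-+e : ∀ {n} (α : Exponent n) i → Vec.sum (α +e i) ≡ suc (Vec.sum α)
sum-+e (a ∷ α) zero = refl
sum-+e (a ∷ α) (suc i) = trans (cong (a ℕ.+_) (sum-+e α i)) (ℕₚ.+-suc a (Vec.sum α))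

sum-pair-≡2 : ∀ {n} (i j : Fin n) → Vec.sum (pair i j) ≡ 2
sum-pair-≡2 {n} i j = trans (sum-+e (0ᵉ +e i) j) (cong suc (trans (sum-+e 0ᵉ i) (cong suc (sum-0ᵉ n))))
  where
  sum-0ᵉ : ∀ n → Vec.sum (0ᵉ {n}) ≡ 0
  sum-0ᵉ zero = refl
  sum-0ᵉ (suc n) = sum-0ᵉ n

module _ {n} (G : Graph n) where
  open Graph G using (adj; adj-sym)

  _≟ᵉ_ : (α β : Exponent n) → Dec (α ≡ β)
  _≟ᵉ_ = Vecₚ.≡-dec ℕₚ._≟_

  term : Exponent n → Fin n → Fin n → ℚ
  term α k l = if ⌊ α ≟ᵉ pair k l ⌋ then ½ ℚ.* indicator (adj k l) else 0ℚ

  coefficient : Exponent n → ℚ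
  coefficient α = 𝐐.sum λ k → 𝐐.sum λ l → term α k l

  seq-Q : ∀ α m → seq (Q G α) m ≡ coefficient α
  seq-Q α m = trans (seq-sum (λ k → sum (λ l → monomial′ k l)) m)
    (𝐐.sum-cong-≋ λ k → trans (seq-sum (monomial′ k) m) (𝐐.sum-cong-≋ λ l → entry k l))
    where
    monomial′ : Fin n → Fin n → ℝ
    monomial′ k l = monomial (½ℝ * adjacencyMatrix G k l) (pair k l) α
    entry : ∀ k l → seq (monomial′ k l) m ≡ term α k l
    entry k l with α ≟ᵉ pair k l
    ... | yes _ = cong (½ ℚ.*_) (seq-adjacencyMatrix G k l m)
    ... | no _ = refl

  private
    term-≡ : ∀ i j → term (pair i j) i j ≡ ½ ℚ.* indicator (adj i j)
    term-≡ i j with pair i j ≟ᵉ pair i j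
    ... | yes _ = refl
    ... | no ≢ = ⊥-elim (≢ refl)

    term-≢ : ∀ {α k l} → α ≢ pair k l → term α k l ≡ 0ℚ
    term-≢ {α} {k} {l} ≢ with α ≟ᵉ pair k l
    ... | yes e = ⊥-elim (≢ e)
    ... | no _ = refl

    term-other : ∀ {i j k l} → ¬ (k ≡ i × l ≡ j) → ¬ (k ≡ j × l ≡ i) → term (pair i j) k l ≡ 0ℚ
    term-other {i} {j} {k} {l} ≢₁ ≢₂ = term-≢ λ e → case-⊥ (pair-injective e)
      where
      case-⊥ : ¬ ((i ≡ k × j ≡ l) ⊎ (i ≡ l × j ≡ k))
      case-⊥ (inj₁ (i≡k , j≡l)) = ≢₁ (sym i≡k , sym j≡l)
      case-⊥ (inj₂ (i≡l , j≡k)) = ≢₂ (sym j≡k , sym i≡l)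

  coefficient-twice : ∀ i → coefficient (pair i i) ≡ ½ ℚ.* indicator (adj i i)
  coefficient-twice i = trans
    (𝐐ᵢ.sum-single _ i λ k k≢i → 𝐐ᵢ.sum-zero {n} {term (pair i i) k} λ l → term-other (k≢i ∘ proj₁) (k≢i ∘ proj₁))
    (trans (𝐐ᵢ.sum-single _ i λ l l≢i → term-other (l≢i ∘ proj₂) (l≢i ∘ proj₂)) (term-≡ i i))

  -- The monomial occurs for both orders of the pair, and the two halves add up; a square occurs
  -- only once and keeps its ½.
  coefficient-pair : ∀ {i j} → i ≢ j → coefficient (pair i j) ≡ indicator (adj i j)
  coefficient-pair {i} {j} i≢j = trans
    (𝐐ᵢ.sum-pair _ i≢j λ k k≢i k≢j → 𝐐ᵢ.sum-zero {n} {term (pair i j) k} λ l → term-other (k≢i ∘ proj₁) (k≢j ∘ proj₁))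
    (trans (cong₂ ℚ._+_
      (trans (𝐐ᵢ.sum-single _ j λ l l≢j → term-other (l≢j ∘ proj₂) (i≢j ∘ proj₁)) (term-≡ i j))
      (trans (𝐐ᵢ.sum-single _ i λ l l≢i → term-other (i≢j ∘ sym ∘ proj₁) (l≢i ∘ proj₂))
        (trans (cong (λ α → term α j i) (pair-comm i j)) (trans (term-≡ j i)
          (cong (λ b → ½ ℚ.* indicator b) (adj-sym j i))))))
      (trans (sym (ℚₚ.*-distribʳ-+ (indicator (adj i j)) ½ ½)) (ℚₚ.*-identityˡ _)))

  -- On the diagonal the factor 2 from differentiating a square twice cancels the ½.
  hessian≈adjacencyMatrix : ∀ i j → hessian (Q G) i j ≈ adjacencyMatrix G i j
  hessian≈adjacencyMatrix i j = ≗⇒≈ {hessian (Q G) i j} {adjacencyMatrix G i j} λ m →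
    trans (value m (i ≟ j)) (sym (seq-adjacencyMatrix G i j m))
    where
    value : ∀ m → Dec (i ≡ j) → seq (hessian (Q G) i j) m ≡ adjacencyℚ G i j
    value m (no i≢j) rewrite Vecₚ.lookup-replicate i 0 | Vecₚ.lookup∘updateAt′ j i {suc} (i≢j ∘ sym) 0ᵉ
      | Vecₚ.lookup-replicate j 0 = trans (ℚₚ.+-identityʳ _) (trans (ℚₚ.+-identityʳ _)
        (trans (seq-Q (pair i j) m) (coefficient-pair i≢j)))
    value m (yes refl) rewrite Vecₚ.lookup-replicate i 0 | Vecₚ.lookup∘updateAt i {suc} (0ᵉ {n})
      | Vecₚ.lookup-replicate i 0 = trans (ℚₚ.+-identityʳ _) (trans
        (cong₂ (λ x y → x ℚ.+ (y ℚ.+ 0ℚ)) (seq-Q (pair i i) m) (seq-Q (pair i i) m))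
        (trans (cong (λ x → x ℚ.+ (x ℚ.+ 0ℚ)) (coefficient-twice i)) (double (adj i i))))
      where
      double : ∀ b → ½ ℚ.* indicator b ℚ.+ (½ ℚ.* indicator b ℚ.+ 0ℚ) ≡ indicator b
      double true = refl
      double false = refl

  coefficient≡0 : ∀ {α} → (∀ k l → α ≢ pair k l) → coefficient α ≡ 0ℚ
  coefficient≡0 ≢ = 𝐐ᵢ.sum-zero λ k → 𝐐ᵢ.sum-zero λ l → term-≢ (≢ k l)

  Q-homogeneous : Homogeneous 2 (Q G)
  Q-homogeneous α deg≢2 = ≗⇒≈ {Q G α} {0ℝ} λ m → trans (seq-Q α m)
    (coefficient≡0 λ k l α≡ → deg≢2 (trans (cong Vec.sum α≡) (sum-pair-≡2 k l)))

  edge-coefficient-positive : ∀ {i j} → Adj G i j → 0ℚ ℚ.< coefficient (pair i j)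
  edge-coefficient-positive {i} {j} ij with i ≟ j
  ... | yes refl = subst (0ℚ ℚ.<_) (sym (trans (coefficient-twice i) (cong (λ b → ½ ℚ.* indicator b) (T⇒≡true ij)))) 0<½
  ... | no i≢j = subst (0ℚ ℚ.<_) (sym (trans (coefficient-pair i≢j) (cong indicator (T⇒≡true ij)))) 0<1

  edge? : ∀ α → Dec (Edge G α)
  edge? α = any? λ u → any? λ v → (α ≟ᵉ pair u v) ×-dec T? (adj u v)

  ¬edge⇒coefficient≡0 : ∀ {α} → ¬ Edge G α → coefficient α ≡ 0ℚ
  ¬edge⇒coefficient≡0 {α} ¬edge = 𝐐ᵢ.sum-zero λ k → 𝐐ᵢ.sum-zero λ l → zero-term k l
    where
    zero-term : ∀ k l → term α k l ≡ 0ℚ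
    zero-term k l with α ≟ᵉ pair k l
    ... | no _ = refl
    ... | yes e = trans (cong (λ b → ½ ℚ.* indicator b) (¬T⇒≡false λ kl → ¬edge (k , l , e , kl))) (ℚₚ.*-zeroʳ ½)

  Q-nonnegative : NonnegativeCoefficients (Q G)
  Q-nonnegative α (ε , 0<ε , N , below) = ℚₚ.<-irrefl refl (ℚₚ.<-≤-trans
    (ℚₚ.<-trans (ℚₚ.+-mono-≤-< (0≤coefficient (edge? α)) 0<ε)
      (subst (λ q → q ℚ.+ ε ℚ.< 0ℚ) (seq-Q α N) (below N ℕₚ.≤-refl))) ℚₚ.≤-refl)
    where
    0≤coefficient : Dec (Edge G α) → 0ℚ ℚ.≤ coefficient α
    0≤coefficient (yes (u , v , refl , uv)) = ℚₚ.<⇒≤ (edge-coefficient-positive uv)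
    0≤coefficient (no ¬edge) = ℚₚ.≤-reflexive (sym (¬edge⇒coefficient≡0 ¬edge))

  -- Membership in the support is only a negation; the finite search `edge?` recovers actual
  -- endpoints from it.
  supp⇒Edge : ∀ {α} → supp (Q G) α → Edge G α
  supp⇒Edge {α} α∈ = decidable-stable (edge? α) λ ¬edge → α∈
    (≗⇒≈ {Q G α} {0ℝ} λ m → trans (seq-Q α m) (¬edge⇒coefficient≡0 ¬edge))

  Edge⇒supp : ∀ {α} → Edge G α → supp (Q G) α
  Edge⇒supp {α} (u , v , refl , uv) =
    𝐑.Pos⇒≉0 {Q G α} (0<-constant {Q G α} (seq-Q α) (edge-coefficient-positive uv))

  adjacencyMatrix-nonnegative : Nonnegative (adjacencyMatrix G)
  adjacencyMatrix-nonnegative i j (ε , 0<ε , N , below) = ℚₚ.<-irrefl refl (ℚₚ.<-≤-trans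
    (ℚₚ.<-trans (ℚₚ.+-mono-≤-< (0≤indicator (adj i j)) 0<ε)
      (subst (λ q → q ℚ.+ ε ℚ.< 0ℚ) (seq-adjacencyMatrix G i j N) (below N ℕₚ.≤-refl))) ℚₚ.≤-refl)
    where
    0≤indicator : ∀ b → 0ℚ ℚ.≤ indicator b
    0≤indicator true = ℚₚ.<⇒≤ 0<1
    0≤indicator false = ℚₚ.≤-refl

MConvex-cong : ∀ {n} {S S′ : Exponent n → Set} → (∀ {α} → S α → S′ α) → (∀ {α} → S′ α → S α) →
  MConvex S → MConvex S′
MConvex-cong to from mc a b a∈ b∈ i b<a = let j , a<b , e = mc a b (from a∈) (from b∈) i b<a in j , a<b , to e

theorem3p2 : ∀ (n : ℕ) (G : Graph n) → NoIsolatedVertices G →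
    (Antiferromagnetic (adjacencyMatrix G) ⇔ Lorentzian 2 (Q G)) ×
    (Lorentzian 2 (Q G) ⇔ MConvex (supp (Q G))) ×
    (MConvex (supp (Q G)) ⇔ HasMultipartiteDecomposition G)
theorem3p2 n G noIsolated =
  mk⇔ (λ af → atMostOne⇒lorentzian (Antiferromagnetic.atMostOne af))
      (λ lor → record { symmetric = adjacencyMatrix-sym G
                      ; nonnegative = adjacencyMatrix-nonnegative G
                      ; atMostOne = lorentzian⇒atMostOne lor }) ,
  mk⇔ (λ lor → multipartiteLike⇒MConvex-supp
        (atMostOne⇒multipartiteLike G noIsolated (lorentzian⇒atMostOne lor)))
      (λ mc → atMostOne⇒lorentzian (multipartiteLike⇒atMostOne G (MConvex-supp⇒multipartiteLike mc))) ,
  mk⇔ (λ mc → multipartiteLike⇒decomposition G (MConvex-supp⇒multipartiteLike mc))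
      (λ decomposition → multipartiteLike⇒MConvex-supp (decomposition⇒multipartiteLike G decomposition))
  where
  atMostOne⇒lorentzian : AtMostOnePositiveEigenvalue (adjacencyMatrix G) → Lorentzian 2 (Q G)
  atMostOne⇒lorentzian atMostOne = Q-homogeneous G , Q-nonnegative G ,
    AtMostOne-cong (adjacencyMatrix G) (hessian (Q G))
      (λ i j → ≈-sym {hessian (Q G) i j} {adjacencyMatrix G i j} (hessian≈adjacencyMatrix G i j)) atMostOne

  lorentzian⇒atMostOne : Lorentzian 2 (Q G) → AtMostOnePositiveEigenvalue (adjacencyMatrix G)
  lorentzian⇒atMostOne (_ , _ , atMostOne) =
    AtMostOne-cong (hessian (Q G)) (adjacencyMatrix G) (hessian≈adjacencyMatrix G) atMostOne

  multipartiteLike⇒MConvex-supp : IsMultipartiteLike G → MConvex (supp (Q G))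
  multipartiteLike⇒MConvex-supp M = MConvex-cong (λ {α} → Edge⇒supp G {α}) (λ {α} → supp⇒Edge G {α})
    (multipartiteLike⇒MConvex G M)

  MConvex-supp⇒multipartiteLike : MConvex (supp (Q G)) → IsMultipartiteLike G
  MConvex-supp⇒multipartiteLike mc = MConvex⇒multipartiteLike G noIsolated
    (MConvex-cong (λ {α} → supp⇒Edge G {α}) (λ {α} → Edge⇒supp G {α}) mc)
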